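{- Let $F$ be a 3-CNF formula on $n$ variables that has no satisfying assignment of Hamming weight less than $n/2$, and suppose that $F$ is negation closed, meaning that whenever an assignment $\alpha$ satisfies $F$, the assignment obtained from $\alpha$ by negating every bit also satisfies $F$. Then the number of satisfying assignments of $F$ of Hamming weight exactly $n/2$ is at most $6^{n/4}$.
   Context: A 3-CNF is a conjunction of clauses, each a disjunction of at most 3 literals. The Hamming weight of a 0/1 assignment is the number of variables set to 1. -}

module Defs where

open import Data.Bool.Base using (Bool; true; false; not)
open import Data.Bool.Properties using () renaming (_≟_ to _≟ᵇ_)
open import Data.Fin.Base using (Fin)
open import Data.List.Base using (List; []; _∷_; [_]; _++_; map; filter; length)
open import Data.List.Relation.Unary.All using (All; all?)
open import Data.List.Relation.Unary.Any using (Any; any?)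
open import Data.Nat.Base using (ℕ; zero; suc; _*_; _≤_; _<_)
open import Data.Nat.Properties using () renaming (_≟_ to _≟ⁿ_)
open import Data.Product.Base using (_×_)
open import Data.Vec.Base as Vec using (Vec; []; _∷_; lookup; count)
open import Relation.Binary.PropositionalEquality.Core using (_≡_)
open import Relation.Nullary.Decidable.Core using (Dec; _×-dec_)
open import Relation.Nullary.Negation.Core using (¬_)

data Literal (n : ℕ) : Set where
  pos neg : Fin n → Literal n

Clause : ℕ → Set
Clause n = List (Literal n)

CNF : ℕ → Set
CNF n = List (Clause n)

Is3CNF : ∀ {n} → CNF n → Set
Is3CNF F = All (λ C → length C ≤ 3) F

Assignment : ℕ → Set
Assignment n = Vec Bool n

eval : ∀ {n} → Assignment n → Literal n → Bool
eval α (pos i) = lookup α i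
eval α (neg i) = not (lookup α i)

SatisfiesClause : ∀ {n} → Assignment n → Clause n → Set
SatisfiesClause α C = Any (λ ℓ → eval α ℓ ≡ true) C

Satisfies : ∀ {n} → Assignment n → CNF n → Set
Satisfies α F = All (SatisfiesClause α) F

satisfies? : ∀ {n} (α : Assignment n) (F : CNF n) → Dec (Satisfies α F)
satisfies? α F = all? (λ C → any? (λ ℓ → eval α ℓ ≟ᵇ true) C) F

weight : ∀ {n} → Assignment n → ℕ
weight α = count (_≟ᵇ true) α

negate : ∀ {n} → Assignment n → Assignment n
negate α = Vec.map not α

NegationClosed : ∀ {n} → CNF n → Set
NegationClosed F = ∀ α → Satisfies α F → Satisfies (negate α) F

-- "weight α < n / 2" with the denominator cleared, so that n may be odd.
NoLightSolution : ∀ {n} → CNF n → Set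
NoLightSolution {n} F = ∀ (α : Assignment n) → 2 * weight α < n → ¬ Satisfies α F

-- Each of the 2 ^ n assignments occurs exactly once.
assignments : ∀ n → List (Assignment n)
assignments zero    = [ [] ]
assignments (suc n) = map (false ∷_) (assignments n) ++ map (true ∷_) (assignments n)

-- "weight α = n / 2" with the denominator cleared; for odd n there is no
-- such α.
IsBalancedSolution : ∀ {n} → CNF n → Assignment n → Set
IsBalancedSolution {n} F α = Satisfies α F × 2 * weight α ≡ n

isBalancedSolution? : ∀ {n} (F : CNF n) (α : Assignment n) → Dec (IsBalancedSolution F α)
isBalancedSolution? {n} F α = satisfies? α F ×-dec (2 * weight α ≟ⁿ n)

#balancedSolutions : ∀ {n} → CNF n → ℕ
#balancedSolutions {n} F = length (filter (isBalancedSolution? F) (assignments n))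

{-# OPTIONS --safe #-}
module Submission where

-- Negating a solution preserves satisfaction, so every solution has weight exactly m = n / 2, and no solution is
-- constant on a clause of three positive literals; call such a triple not-all-equal.
--
-- A state assigns a status to each variable, and with it a weight to each solution and a value to each variable.
-- The claim is that the total weight of all solutions is at most (4 / √6) ^ m times the product of the values; for the
-- state with all variables fresh, this is the theorem. It is proved by branching to states with more decided variables.
-- While fewer than m variables have status one, the assignment that is true exactly there is too light to be a solution,
-- so it violates a clause, and every solution compatible with the state makes one of the remaining positive literals of
-- that clause true: branch on which. This is affordable unless the clause contains two fresh variables and one more
-- undecided one.
--
-- Such clauses are eliminated beforehand. Take a disjoint family of not-all-equal triples (triangles, score 3) and of pairs
-- of not-all-equal triples sharing one vertex (cherries, score 4) of maximal score, and branch on its members one by one.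
-- Maximality restricts how the remaining triples meet the family enough for each of these branchings to be affordable.
--
-- As √6 is irrational, it is replaced by x / y with x² = 6 y² + 1; for large y the error disappears by integrality.

open import Algebra.Properties.CommutativeSemigroup using (interchange)
open import Data.Bool.Base using (Bool; true; false; not; _∧_; _∨_; T)
open import Data.Bool.Properties using (T-∧; T-≡) renaming (_≟_ to _≟ᵇ_)
open import Data.Empty using (⊥; ⊥-elim)
open import Data.Fin using (#_)
open import Data.Fin.Base using (Fin; zero; suc)
open import Data.Fin.Properties using (injective⇒≤) renaming (_≟_ to _≟ᶠ_)
open import Data.List.Base using (List; []; _∷_; _++_; map; filter; length; concatMap) renaming (lookup to lookupᴸ)
open import Data.List.Membership.DecPropositional using (_∈?_)
open import Data.List.Membership.Propositional using (_∈_; _∉_; find)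
open import Data.List.Membership.Propositional.Properties using (∈-map⁻; ∈-++⁺ˡ; ∈-++⁺ʳ; ∈-++⁻; ∈-∃++; ∈-filter⁻) renaming (∈-lookup to ∈-lookupᴸ)
open import Data.List.Properties using (++-assoc; concatMap-++; length-map; map-++)
open import Data.List.Relation.Binary.Permutation.Propositional as Perm using (↭⇒↭ₛ; _↭_; ↭-refl; ↭-sym; ↭-trans; prep; swap)
open import Data.List.Relation.Binary.Permutation.Propositional.Properties using (∈-resp-↭; shift; ++⁺ˡ; shifts; ↭-length) renaming (map⁺ to ↭-map⁺)
open import Data.List.Relation.Binary.Permutation.Setoid.Properties using (Unique-resp-↭)
open import Data.List.Relation.Unary.All as All using (All; []; _∷_)
open import Data.List.Relation.Unary.All.Properties using (¬All⇒Any¬; ¬Any⇒All¬)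
open import Data.List.Relation.Unary.AllPairs using ([]; _∷_)
open import Data.List.Relation.Unary.Any using (here; there; any?)
open import Data.List.Relation.Unary.Unique.DecPropositional using (unique?)
import Data.List.Relation.Unary.Unique.Propositional as List
open import Data.List.Relation.Unary.Unique.Propositional.Properties using () renaming (map⁺ to Unique-map⁺; ++⁺ to Unique-++⁺)
open import Data.Nat.Base hiding (_/_)
open import Data.Nat.ListAction using (sum)
open import Data.Nat.ListAction.Properties using (sum-↭; sum-++)
open import Data.Nat.Properties
open import Data.Nat.Tactic.RingSolver using (solve-∀)
open import Data.Product.Base using (Σ; ∃; _×_; _,_; proj₁; proj₂)
open import Data.Sum.Base using (_⊎_; inj₁; inj₂; [_,_]′)
open import Data.Unit.Base using (⊤; tt)
open import Data.Vec.Base as Vec using (Vec; []; _∷_; lookup)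
open import Data.Vec.Functional using (updateAt)
open import Data.Vec.Functional.Properties using (updateAt-updates; updateAt-minimal)
open import Data.Vec.Membership.Propositional.Properties using (∈-lookup)
import Data.Vec.Properties as Vecₚ
open import Data.Vec.Relation.Unary.All as VAll using ([]; _∷_)
open import Data.Vec.Relation.Unary.All.Properties using () renaming (++⁺ to All-++⁺)
open import Data.Vec.Relation.Unary.AllPairs using ([]; _∷_)
open import Data.Vec.Relation.Unary.AllPairs.Properties using () renaming (++⁺ to AllPairs-++⁺)
open import Data.Vec.Relation.Unary.Unique.Propositional using (Unique)
open import Defs
open import Function.Base using (_∘_; const; id)
open import Function.Bundles using (Equivalence)
open import Relation.Binary.PropositionalEquality
open import Relation.Nullary using (¬_; Dec; yes; no; contradiction)
open import Relation.Nullary.Decidable.Core using (True; toWitness)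

-- Write f and o for the values of `fresh` and `one`. The final bound is (f² / o) ^ m, and two
-- branchings constrain it. A clause with one fresh and two half variables requires o ≤ f / 2; a
-- triangle of fresh variables requires 3 o ≤ f³. So f² / o is at least the maximum of 2 f and 3 /
-- f, which is smallest at f = √6 / 2. This fixes both values and the constant 6. The value 2 of
-- `half` is its weight at false, which has to be paid at the end, and a clause of a fresh, a half
-- and a full variable forces at least 5/4 for `full`. The obstacle is a clause of two fresh
-- variables and a half one: it would require √6 ≥ 5/2. Branching on a cherry must leave no such
-- clause behind, and making its vertices full is slightly too expensive. What saves it is a pair:
-- when the center is true, the two vertices of a petal are never both true, and such partners can
-- do with a smaller value than `full`. Its square must be at least 1.4375 for a clause with a
-- fresh, a half and a paired variable, and at most about 1.438 for the branching that creates the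
-- pair; hence 1.199.

square-cancel : ∀ {a b} → a * a ≤ b * b → a ≤ b
square-cancel le = ≮⇒≥ (λ lt → <⇒≱ (*-mono-< lt lt) le)

-- Finite products and sums, and their change under overwriting

prod : ∀ {n} → (Fin n → ℕ) → ℕ
prod {zero}  f = 1
prod {suc n} f = f zero * prod (f ∘ suc)

prod-cong : ∀ {n} {f g : Fin n → ℕ} → (∀ i → f i ≡ g i) → prod f ≡ prod g
prod-cong {zero}  eq = refl
prod-cong {suc n} eq = cong₂ _*_ (eq zero) (prod-cong (eq ∘ suc))

prod-mono : ∀ {n} {f g : Fin n → ℕ} → (∀ i → f i ≤ g i) → prod f ≤ prod g
prod-mono {zero}  le = ≤-refl
prod-mono {suc n} le = *-mono-≤ (le zero) (prod-mono (le ∘ suc))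

prod-zero : ∀ {n} {f : Fin n → ℕ} i → f i ≡ 0 → prod f ≡ 0
prod-zero {f = f} zero    eq rewrite eq = refl
prod-zero {f = f} (suc i) eq rewrite prod-zero {f = f ∘ suc} i eq = *-zeroʳ (f zero)

private
  swap-end : ∀ a b c → (a * b) * c ≡ (c * b) * a
  swap-end = solve-∀
  swap-last : ∀ a b c → (a * b) * c ≡ (a * c) * b
  swap-last = solve-∀

-- The quotient of the new and the old factor is cross-multiplied, which keeps the equation in ℕ and
-- valid for vanishing factors.
prod-updateAt : ∀ {A : Set} {n} (g : Fin n → A → ℕ) (f : Fin n → A) i a →
  prod (λ j → g j (updateAt f i (const a) j)) * g i (f i) ≡ prod (λ j → g j (f j)) * g i a
prod-updateAt {n = suc n} g f zero a = swap-end (g zero a) (prod (λ j → g (suc j) (f (suc j)))) (g zero (f zero))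
prod-updateAt {n = suc n} g f (suc i) a = begin
  (g zero (f zero) * prod (λ j → g (suc j) (updateAt (f ∘ suc) i (const a) j))) * g (suc i) (f (suc i))
    ≡⟨ *-assoc (g zero (f zero)) _ _ ⟩
  g zero (f zero) * (prod (λ j → g (suc j) (updateAt (f ∘ suc) i (const a) j)) * g (suc i) (f (suc i)))
    ≡⟨ cong (g zero (f zero) *_) (prod-updateAt (g ∘ suc) (f ∘ suc) i a) ⟩
  g zero (f zero) * (prod (λ j → g (suc j) (f (suc j))) * g (suc i) a)
    ≡⟨ sym (*-assoc (g zero (f zero)) _ _) ⟩
  (g zero (f zero) * prod (λ j → g (suc j) (f (suc j)))) * g (suc i) a ∎
  where open ≡-Reasoning

setAll : ∀ {A : Set} {n k} → Vec (Fin n) k → Vec A k → (Fin n → A) → Fin n → A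
setAll []      []       f = f
setAll (i ∷ L) (a ∷ as) f = updateAt (setAll L as f) i (const a)

setAll-outside : ∀ {A : Set} {n k} (L : Vec (Fin n) k) (as : Vec A k) (f : Fin n → A) {j} →
  VAll.All (j ≢_) L → setAll L as f j ≡ f j
setAll-outside []      []       f _        = refl
setAll-outside (i ∷ L) (a ∷ as) f (j≢i ∷ j∉L) =
  trans (updateAt-minimal _ i (setAll L as f) j≢i) (setAll-outside L as f j∉L)

prodV : ∀ {A : Set} {n k} → (Fin n → A → ℕ) → Vec (Fin n) k → Vec A k → ℕ
prodV g []      []       = 1
prodV g (i ∷ L) (a ∷ as) = g i a * prodV g L as

-- Distinctness of the positions guarantees that each overwritten value is still the one of `f`.
prod-setAll : ∀ {A : Set} {n k} (g : Fin n → A → ℕ) {L : Vec (Fin n) k} (as : Vec A k) (f : Fin n → A) → Unique L →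
  prod (λ j → g j (setAll L as f j)) * prodV g L (Vec.map f L) ≡ prod (λ j → g j (f j)) * prodV g L as
prod-setAll g {[]} [] f [] = refl
prod-setAll g {i ∷ L} (a ∷ as) f (i∉L ∷ uL) = begin
  P′ * (g i (f i) * O) ≡⟨ cong (λ s → P′ * (g i s * O)) (sym (setAll-outside L as f i∉L)) ⟩
  P′ * (g i (f₁ i) * O) ≡⟨ sym (*-assoc P′ _ _) ⟩
  P′ * g i (f₁ i) * O ≡⟨ cong (_* O) (prod-updateAt g f₁ i a) ⟩
  P₁ * g i a * O ≡⟨ swap-last P₁ (g i a) O ⟩
  P₁ * O * g i a ≡⟨ cong (_* g i a) (prod-setAll g as f uL) ⟩
  P * N * g i a ≡⟨ trans (*-assoc P N _) (cong (P *_) (*-comm N _)) ⟩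
  P * (g i a * N) ∎
  where
  open ≡-Reasoning
  f₁ = setAll L as f
  P′ = prod (λ j → g j (updateAt f₁ i (const a) j))
  P₁ = prod (λ j → g j (f₁ j))
  P = prod (λ j → g j (f j))
  O = prodV g L (Vec.map f L)
  N = prodV g L as

sumBy : ∀ {A : Set} → List A → (A → ℕ) → ℕ
sumBy xs f = sum (map f xs)

sumBy-mono : ∀ {A : Set} (xs : List A) {f g : A → ℕ} → (∀ {a} → a ∈ xs → f a ≤ g a) → sumBy xs f ≤ sumBy xs g
sumBy-mono []       le = ≤-refl
sumBy-mono (x ∷ xs) le = +-mono-≤ (le (here refl)) (sumBy-mono xs (le ∘ there))

sumBy-cong : ∀ {A : Set} (xs : List A) {f g : A → ℕ} → (∀ {a} → a ∈ xs → f a ≡ g a) → sumBy xs f ≡ sumBy xs g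
sumBy-cong []       eq = refl
sumBy-cong (x ∷ xs) eq = cong₂ _+_ (eq (here refl)) (sumBy-cong xs (eq ∘ there))

sumBy-*ʳ : ∀ {A : Set} (xs : List A) (f : A → ℕ) c → sumBy xs (λ a → f a * c) ≡ sumBy xs f * c
sumBy-*ʳ []       f c = refl
sumBy-*ʳ (x ∷ xs) f c = trans (cong (f x * c +_) (sumBy-*ʳ xs f c)) (sym (*-distribʳ-+ c (f x) (sumBy xs f)))

sumBy-*ˡ : ∀ {A : Set} (xs : List A) (f : A → ℕ) c → sumBy xs (λ a → c * f a) ≡ c * sumBy xs f
sumBy-*ˡ []       f c = sym (*-zeroʳ c)
sumBy-*ˡ (x ∷ xs) f c = trans (cong (c * f x +_) (sumBy-*ˡ xs f c)) (sym (*-distribˡ-+ c (f x) (sumBy xs f)))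

sumBy-0 : ∀ {A : Set} (xs : List A) → sumBy xs (λ _ → 0) ≡ 0
sumBy-0 []       = refl
sumBy-0 (x ∷ xs) = sumBy-0 xs

sumBy-+ : ∀ {A : Set} (xs : List A) (f g : A → ℕ) → sumBy xs (λ a → f a + g a) ≡ sumBy xs f + sumBy xs g
sumBy-+ []       f g = refl
sumBy-+ (x ∷ xs) f g rewrite sumBy-+ xs f g = interchange +-commutativeSemigroup (f x) (g x) (sumBy xs f) (sumBy xs g)

sumBy-swap : ∀ {A B : Set} (xs : List A) (ys : List B) (f : A → B → ℕ) →
  sumBy xs (λ a → sumBy ys (f a)) ≡ sumBy ys (λ b → sumBy xs (λ a → f a b))
sumBy-swap []       ys f = sym (sumBy-0 ys)
sumBy-swap (x ∷ xs) ys f = trans (cong (sumBy ys (f x) +_) (sumBy-swap xs ys f)) (sym (sumBy-+ ys (f x) _))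

-- States, weights, values and the general branching step

data Status (n : ℕ) : Set where
  one dead half full fresh : Status n
  paired : Fin n → Status n

-- Decided variables are `one` (true) or `dead` (false). A `half` variable has been passed over in
-- an earlier branching; a `full` one is undecided but no longer fresh; a `paired` one names a
-- partner that is never true together with it.
State : ℕ → Set
State n = Fin n → Status n

-- With the weights 2 and 1 of half, the three branches one, half, half of a not-all-equal triple give total weight 4
-- to every solution, whether it sets one or two of the variables to true.
weight₁ : ∀ {n} → Status n → Bool → ℕ
weight₁ one  false = 0
weight₁ one  true  = 1
weight₁ dead false = 1
weight₁ dead true  = 0
weight₁ half false = 2
weight₁ half true  = 1
weight₁ full  _    = 1
weight₁ fresh _    = 1
weight₁ (paired _) _ = 1

Compatible : ∀ {n} → Status n → Bool → Set
Compatible s b = weight₁ s b ≢ 0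

Agree : ∀ {n} → State n → Assignment n → Set
Agree st α = ∀ i → Compatible (st i) (lookup α i)

weightOf : ∀ {n} → State n → Assignment n → ℕ
weightOf st α = prod (λ i → weight₁ (st i) (lookup α i))

weightOf≢0⇒agree : ∀ {n} (st : State n) α → weightOf st α ≢ 0 → Agree st α
weightOf≢0⇒agree st α nz i eq = nz (prod-zero i eq)

prodV-nonzero : ∀ {A : Set} {n k} (g : Fin n → A → ℕ) (L : Vec (Fin n) k) (f : Fin n → A) →
  (∀ i → g i (f i) ≢ 0) → prodV g L (Vec.map f L) ≢ 0
prodV-nonzero g []      f nz ()
prodV-nonzero g (i ∷ L) f nz eq with m*n≡0⇒m≡0∨n≡0 (g i (f i)) eq
... | inj₁ z = nz i z
... | inj₂ z = prodV-nonzero g L f nz z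

module Weighted {n} (sols : List (Assignment n)) (x y K : ℕ) (x>0 : 0 < x) (y>0 : 0 < y) where

  -- In units of 1000 * y, and with √6 in place of x / y: √6/4, 1, 2, 5/4, 1.199 and √6/2.
  value : Status n → ℕ
  value one        = 250 * x
  value dead       = 1000 * y
  value half       = 2000 * y
  value full       = 1250 * y
  value (paired _) = 1199 * y
  value fresh      = 500 * x

  value≢0 : ∀ s → value s ≢ 0
  value≢0 s eq = <-irrefl (sym eq) (value-pos s)
    where
    value-pos : ∀ s → 0 < value s
    value-pos one        = *-mono-< (z<s {249}) x>0
    value-pos dead       = *-mono-< (z<s {999}) y>0
    value-pos half       = *-mono-< (z<s {1999}) y>0
    value-pos full       = *-mono-< (z<s {1249}) y>0
    value-pos (paired _) = *-mono-< (z<s {1198}) y>0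
    value-pos fresh      = *-mono-< (z<s {499}) x>0

  total : State n → ℕ
  total st = sumBy sols (weightOf st)

  potential : State n → ℕ
  potential st = prod (λ i → value (st i))

  -- `K` will be the product of m values of `one` and m values of `dead`, so this is the claim with
  -- the power of 4 / √6 moved to the left side; the units cancel because n = 2 m.
  Bounded : State n → Set
  Bounded st = total st * K ≤ potential st

  weightV : ∀ {k} → Assignment n → Vec (Fin n) k → Vec (Status n) k → ℕ
  weightV α = prodV (λ i s → weight₁ s (lookup α i))

  valueV : ∀ {k} → Vec (Status n) k → ℕ
  valueV []       = 1
  valueV (s ∷ ss) = value s * valueV ss

  valueV-prodV : ∀ {k} (L : Vec (Fin n) k) ss → prodV (λ _ → value) L ss ≡ valueV ss
  valueV-prodV []      []       = refl
  valueV-prodV (i ∷ L) (s ∷ ss) = cong (value s *_) (valueV-prodV L ss)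

  Child : ℕ → Set
  Child k = ℕ × Vec (Status n) k

  -- Outside `L` neither weights nor values change, so two inequalities about the positions in `L`
  -- suffice. Counting the state `c` times and each child `d` times replaces fractional
  -- multiplicities.
  branch : ∀ {k} {L : Vec (Fin n) k} → Unique L → (st : State n) (c : ℕ) → c ≢ 0 → (children : List (Child k)) →
    (∀ {α} → α ∈ sols → Agree st α →
       c * weightV α L (Vec.map st L) ≤ sumBy children (λ (d , ss) → d * weightV α L ss)) →
    sumBy children (λ (d , ss) → d * valueV ss) ≤ c * valueV (Vec.map st L) →
    (∀ {d ss} → (d , ss) ∈ children → Bounded (setAll L ss st)) →
    Bounded st
  branch {L = L} uL st c c≢0 children pointwise values bounded =
    *-cancelˡ-≤ c {{≢-nonZero c≢0}} (begin
      c * (total st * K) ≡⟨ sym (*-assoc c _ K) ⟩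
      c * total st * K ≤⟨ *-monoˡ-≤ K totals ⟩
      sumBy children (λ (d , ss) → d * total (setAll L ss st)) * K ≡⟨ sym (sumBy-*ʳ children _ K) ⟩
      sumBy children (λ (d , ss) → d * total (setAll L ss st) * K)
        ≤⟨ sumBy-mono children (λ {(d , ss)} m → ≤-trans (≤-reflexive (*-assoc d _ K)) (*-monoʳ-≤ d (bounded m))) ⟩
      sumBy children (λ (d , ss) → d * potential (setAll L ss st)) ≤⟨ potentials ⟩
      c * potential st ∎)
    where
    open ≤-Reasoning
    local : ∀ {α} → α ∈ sols → c * weightOf st α ≤ sumBy children (λ (d , ss) → d * weightOf (setAll L ss st) α)
    local {α} α∈ with weightOf st α ≟ 0
    ... | yes z rewrite z | *-zeroʳ c = z≤n
    -- A nonzero product has nonzero factors, so the old weight on `L` can be cancelled.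
    ... | no nz = *-cancelʳ-≤ _ _ (weightV α L (Vec.map st L)) {{≢-nonZero (prodV-nonzero _ L st agree)}} (begin
      c * weightOf st α * weightV α L (Vec.map st L) ≡⟨ swap-last c (weightOf st α) _ ⟩
      c * weightV α L (Vec.map st L) * weightOf st α ≤⟨ *-monoˡ-≤ (weightOf st α) (pointwise α∈ agree) ⟩
      sumBy children (λ (d , ss) → d * weightV α L ss) * weightOf st α ≡⟨ sym (sumBy-*ʳ children _ _) ⟩
      sumBy children (λ (d , ss) → d * weightV α L ss * weightOf st α)
        ≡⟨ sumBy-cong children (λ {(d , ss)} _ → rearrange d ss) ⟩
      sumBy children (λ (d , ss) → d * weightOf (setAll L ss st) α * weightV α L (Vec.map st L))
        ≡⟨ sumBy-*ʳ children _ _ ⟩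
      sumBy children (λ (d , ss) → d * weightOf (setAll L ss st) α) * weightV α L (Vec.map st L) ∎)
      where
      agree = weightOf≢0⇒agree st α nz
      rearrange : ∀ d ss → d * weightV α L ss * weightOf st α ≡ d * weightOf (setAll L ss st) α * weightV α L (Vec.map st L)
      rearrange d ss = trans (*-assoc d _ _) (trans (cong (d *_) (trans (*-comm (weightV α L ss) _)
        (sym (prod-setAll (λ i s → weight₁ s (lookup α i)) ss st uL)))) (sym (*-assoc d _ _)))
    totals : c * total st ≤ sumBy children (λ (d , ss) → d * total (setAll L ss st))
    totals = begin
      c * total st ≡⟨ sym (sumBy-*ˡ sols (weightOf st) c) ⟩
      sumBy sols (λ α → c * weightOf st α) ≤⟨ sumBy-mono sols local ⟩
      sumBy sols (λ α → sumBy children (λ (d , ss) → d * weightOf (setAll L ss st) α)) ≡⟨ sumBy-swap sols children _ ⟩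
      sumBy children (λ (d , ss) → sumBy sols (λ α → d * weightOf (setAll L ss st) α))
        ≡⟨ sumBy-cong children (λ {(d , ss)} _ → sumBy-*ˡ sols (weightOf (setAll L ss st)) d) ⟩
      sumBy children (λ (d , ss) → d * total (setAll L ss st)) ∎
    V = valueV (Vec.map st L)
    potentials : sumBy children (λ (d , ss) → d * potential (setAll L ss st)) ≤ c * potential st
    potentials = *-cancelʳ-≤ _ _ (prodV (λ _ → value) L (Vec.map st L))
      {{≢-nonZero (prodV-nonzero (λ _ → value) L st (λ i → value≢0 (st i)))}} (begin
      sumBy children (λ (d , ss) → d * potential (setAll L ss st)) * prodV (λ _ → value) L (Vec.map st L)
        ≡⟨ sym (sumBy-*ʳ children _ _) ⟩
      sumBy children (λ (d , ss) → d * potential (setAll L ss st) * prodV (λ _ → value) L (Vec.map st L))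
        ≡⟨ sumBy-cong children (λ {(d , ss)} _ → rearrange d ss) ⟩
      sumBy children (λ (d , ss) → d * valueV ss * potential st) ≡⟨ sumBy-*ʳ children _ _ ⟩
      sumBy children (λ (d , ss) → d * valueV ss) * potential st ≤⟨ *-monoˡ-≤ (potential st) values ⟩
      c * valueV (Vec.map st L) * potential st ≡⟨ swap-last c _ _ ⟩
      c * potential st * valueV (Vec.map st L) ≡⟨ cong (c * potential st *_) (sym (valueV-prodV L _)) ⟩
      c * potential st * prodV (λ _ → value) L (Vec.map st L) ∎)
      where
      rearrange : ∀ d ss → d * potential (setAll L ss st) * prodV (λ _ → value) L (Vec.map st L) ≡ d * valueV ss * potential st
      rearrange d ss = trans (*-assoc d _ _) (trans (cong (d *_) (trans (prod-setAll (λ _ → value) ss st uL)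
        (trans (*-comm (potential st) _) (cong (_* potential st) (valueV-prodV L ss))))) (sym (*-assoc d _ _)))

-- Properties of overwritten states

Zip : ∀ {A : Set} {n k} → (Fin n → A → Set) → Vec (Fin n) k → Vec A k → Set
Zip P []      []       = ⊤
Zip P (i ∷ L) (a ∷ as) = P i a × Zip P L as

ZipAny : ∀ {A : Set} {n k} → (Fin n → A → Set) → Vec (Fin n) k → Vec A k → Set
ZipAny P []      []       = ⊥
ZipAny P (i ∷ L) (a ∷ as) = P i a ⊎ ZipAny P L as

Outside : ∀ {n k} → Fin n → Vec (Fin n) k → Set
Outside j = VAll.All (j ≢_)

setAll-∀ : ∀ {A : Set} {n k} (P : Fin n → A → Set) {L : Vec (Fin n) k} {as : Vec A k} {f : Fin n → A} →
  Zip P L as → (∀ j → Outside j L → P j (f j)) → ∀ j → P j (setAll L as f j)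
setAll-∀ P {[]}    {[]}     _           out j = out j []
setAll-∀ P {i ∷ L} {a ∷ as} {f} (pa , pas) out j with j ≟ᶠ i
... | yes refl = subst (P i) (sym (updateAt-updates i (setAll L as f))) pa
... | no j≢i = subst (P j) (sym (updateAt-minimal j i (setAll L as f) j≢i))
  (setAll-∀ (λ k a → k ≢ i → P k a) (weaken pas) (λ k k∉L k≢i → out k (k≢i ∷ k∉L)) j j≢i)
  where
  weaken : ∀ {k} {L : Vec _ k} {as} → Zip P L as → Zip (λ k a → k ≢ i → P k a) L as
  weaken {L = []}    {[]}     _        = tt
  weaken {L = _ ∷ _} {_ ∷ _} (p , ps) = (λ _ → p) , weaken ps

setAll-inside : ∀ {A : Set} {n k} (P : Fin n → A → Set) {L : Vec (Fin n) k} {as : Vec A k} {f : Fin n → A} → Unique L →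
  Zip P L as → VAll.All (λ j → P j (setAll L as f j)) L
setAll-inside P {[]}    {[]}     []           _          = []
setAll-inside P {i ∷ L} {a ∷ as} {f} (i∉L ∷ u) (pa , pas) =
  subst (P i) (sym (updateAt-updates i (setAll L as f))) pa ∷ go i∉L (setAll-inside P u pas)
  where
  go : ∀ {k} {M : Vec _ k} → VAll.All (i ≢_) M → VAll.All (λ j → P j (setAll L as f j)) M →
       VAll.All (λ j → P j (updateAt (setAll L as f) i (const a) j)) M
  go []          []       = []
  go (i≢j ∷ i∉M) (p ∷ ps) = subst (P _) (sym (updateAt-minimal _ i (setAll L as f) (i≢j ∘ sym))) p ∷ go i∉M ps

ZipAny-setAll : ∀ {A : Set} {n k} (P : Fin n → A → Set) {L : Vec (Fin n) k} {as : Vec A k} {f : Fin n → A} → Unique L →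
  ZipAny P L as → ∃ λ j → P j (setAll L as f j)
ZipAny-setAll P {[]} {[]} _ ()
ZipAny-setAll P {i ∷ L} {a ∷ as} {f} (i∉L ∷ u) (inj₁ p) = i , subst (P i) (sym (updateAt-updates i (setAll L as f))) p
ZipAny-setAll P {i ∷ L} {a ∷ as} {f} (i∉L ∷ u) (inj₂ ps) =
  let j , j≢i , q = ZipAny-setAll (λ j a → j ≢ i × P j a) u (strengthen i∉L ps)
  in  j , subst (P j) (sym (updateAt-minimal j i (setAll L as f) j≢i)) q
  where
  strengthen : ∀ {k} {L : Vec _ k} {as} → VAll.All (i ≢_) L → ZipAny P L as → ZipAny (λ j a → j ≢ i × P j a) L as
  strengthen {L = []} {[]} _ ()
  strengthen {L = _ ∷ _} {_ ∷ _} (i≢j ∷ _)  (inj₁ p)  = inj₁ (i≢j ∘ sym , p)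
  strengthen {L = _ ∷ _} {_ ∷ _} (_ ∷ i∉L) (inj₂ ps) = inj₂ (strengthen i∉L ps)

-- Admissible status changes and pairs

Live : ∀ {n} → Status n → Set
Live s = s ≢ one × s ≢ dead

data Settled {n} : Status n → Set where
  one  : Settled one
  dead : Settled dead
  half : Settled half

infix 4 _⇝_
-- Along these changes freshness, liveness and the compatible values can only be lost. Every
-- condition that forbids live or fresh variables, or that speaks of all compatible solutions, thus
-- survives later branching. A settled variable stays settled, so a live one among them is always
-- `half`.
_⇝_ : ∀ {n} → Status n → Status n → Set
one      ⇝ t = t ≡ one
dead     ⇝ t = t ≡ dead
half     ⇝ t = Settled t
full     ⇝ t = t ≢ fresh
paired _ ⇝ t = t ≢ fresh
fresh    ⇝ t = ⊤

⇝-refl : ∀ {n} (s : Status n) → s ⇝ s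
⇝-refl one        = refl
⇝-refl dead       = refl
⇝-refl half       = half
⇝-refl full       = λ ()
⇝-refl (paired _) = λ ()
⇝-refl fresh      = tt

⇝-fresh : ∀ {n} {s t : Status n} → s ⇝ t → t ≡ fresh → s ≡ fresh
⇝-fresh {s = one}      refl ()
⇝-fresh {s = dead}     refl ()
⇝-fresh {s = half}     ()   refl
⇝-fresh {s = full}     ne   eq = contradiction eq ne
⇝-fresh {s = paired _} ne   eq = contradiction eq ne
⇝-fresh {s = fresh}    _    _  = refl

⇝-live : ∀ {n} {s t : Status n} → s ⇝ t → Live t → Live s
⇝-live {s = one}  refl live = live
⇝-live {s = dead} refl live = live
⇝-live {s = half}     _ _ = (λ ()) , λ ()
⇝-live {s = full}     _ _ = (λ ()) , λ ()
⇝-live {s = paired _} _ _ = (λ ()) , λ ()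
⇝-live {s = fresh}    _ _ = (λ ()) , λ ()

⇝-settled : ∀ {n} {s t : Status n} → s ⇝ t → Settled s → Settled t
⇝-settled refl one  = one
⇝-settled refl dead = dead
⇝-settled st   half = st

⇝-compatible : ∀ {n} {s t : Status n} b → s ⇝ t → Compatible t b → Compatible s b
⇝-compatible {s = one}      b refl c = c
⇝-compatible {s = dead}     b refl c = c
⇝-compatible {s = half}     false _ _ ()
⇝-compatible {s = half}     true  _ _ ()
⇝-compatible {s = full}     b _ _ ()
⇝-compatible {s = paired _} b _ _ ()
⇝-compatible {s = fresh}    b _ _ ()

Later : ∀ {n} → State n → State n → Set
Later st st′ = ∀ j → st j ⇝ st′ j

Later-agree : ∀ {n} {st st′ : State n} α → Later st st′ → Agree st′ α → Agree st α
Later-agree α later agree j = ⇝-compatible _ (later j) (agree j)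

setAll-later : ∀ {n k} {L : Vec (Fin n) k} {ss} {st : State n} → Zip (λ j s → st j ⇝ s) L ss → Later st (setAll L ss st)
setAll-later {st = st} z = setAll-∀ (λ j s → st j ⇝ s) z (λ j _ → ⇝-refl (st j))

nae : Bool → Bool → Bool → Bool
nae a b c = not ((a ∧ b ∧ c) ∨ (not a ∧ not b ∧ not c))

-- A pair is changed as a whole or not at all; otherwise one partner would point to a variable that
-- no longer points back.
Closed : ∀ {n k} → State n → Vec (Fin n) k → Set
Closed st L = VAll.All (λ j → ∀ v → st j ≡ paired v → ¬ Outside v L) L

module _ {n} (sols : List (Assignment n)) where

  NAE : Fin n → Fin n → Fin n → Set
  NAE a b c = ∀ {α} → α ∈ sols → nae (lookup α a) (lookup α b) (lookup α c) ≡ true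

  -- `isolated` keeps partners from meeting in a not-all-equal triple with a live third variable, so
  -- that the variables of such a clause can be treated independently.
  record Pair (st : State n) (v w : Fin n) : Set where
    field
      symmetric : st w ≡ paired v
      distinct  : v ≢ w
      exclusive : ∀ {α} → α ∈ sols → Agree st α → lookup α v ≡ true → lookup α w ≡ false
      isolated  : ∀ c → c ≢ v → c ≢ w → NAE v w c → ¬ Live (st c)

  PairsOK : State n → Set
  PairsOK st = ∀ {v w} → st v ≡ paired w → Pair st v w

  NotPaired : Status n → Set
  NotPaired s = ∀ {w} → s ≢ paired w

  -- The new statuses on `L` are not paired, so a variable that is paired afterwards lies outside
  -- `L`; by closedness so does its partner. The remaining fields are monotone under admissible
  -- changes.
  PairsOK-setAll : ∀ {k} {L : Vec (Fin n) k} {ss} {st : State n} →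
    Zip (λ j s → st j ⇝ s) L ss → Zip (λ _ → NotPaired) L ss → Unique L →
    Closed st L →
    PairsOK st → PairsOK (setAll L ss st)
  PairsOK-setAll {L = L} {ss} {st} moves np uL closed ok {v} {w} eq = record
    { symmetric = trans (setAll-outside L ss st w∉L) (Pair.symmetric p)
    ; distinct  = Pair.distinct p
    ; exclusive = λ {α} α∈ agree → Pair.exclusive p α∈ (Later-agree α later agree)
    ; isolated  = λ c c≢v c≢w t live → Pair.isolated p c c≢v c≢w t (⇝-live (later c) live)
    }
    where
    later = setAll-later {L = L} {ss} {st} moves
    v-outside : Outside v L
    v-outside = decide L (setAll-inside (λ _ → NotPaired) {f = st} uL np)
      where
      decide : ∀ {k} (M : Vec (Fin n) k) → VAll.All (λ j → NotPaired (setAll L ss st j)) M → Outside v M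
      decide []      []         = []
      decide (j ∷ M) (nj ∷ nps) = (λ { refl → nj eq }) ∷ decide M nps
    p = ok (trans (sym (setAll-outside L ss st v-outside)) eq)
    w∉L : Outside w L
    w∉L = decide closed
      where
      decide : ∀ {k} {M : Vec (Fin n) k} → VAll.All (λ j → ∀ v → st j ≡ paired v → ¬ Outside v L) M → Outside w M
      decide []       = []
      decide (c ∷ cs) = (λ { refl → c v (Pair.symmetric p) v-outside }) ∷ decide cs

-- Numerical inequalities for branching on a clause

data Old : Set where
  half full pair : Old

data Kind : Set where
  new : Kind
  old : Old → Kind

count : Bool → ℕ
count true  = 1
count false = 0

trues : ∀ {n} → Assignment n → List (Fin n) → ℕ
trues α []       = 0
trues α (c ∷ cs) = count (lookup α c) + trues α cs

-- The factor that raises the weight of a false variable to 2, its weight as `half`.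
mult : Kind → ℕ
mult (old half) = 1
mult _          = 2

-- For pair, the values of both partners are multiplied.
before chosen missed : Old → ℕ
before half = 2000
before full = 2500
before pair = 2875202
chosen half = 250
chosen full = 500
chosen pair = 500000
missed half = 2000
missed full = 2000
missed pair = 2500000

every : (Old → Bool) → Bool
every p = p half ∧ p full ∧ p pair

every-sound : ∀ p → T (every p) → ∀ k → T (p k)
every-sound p t half = proj₁ (Equivalence.to T-∧ t)
every-sound p t full = proj₁ (Equivalence.to T-∧ (proj₂ (Equivalence.to (T-∧ {p half}) t)))
every-sound p t pair = proj₂ (Equivalence.to (T-∧ {p full}) (proj₂ (Equivalence.to (T-∧ {p half}) t)))

-- The quotient x / y lies between √6, about 2.44949, and 2.4499.
record Near√6 (x y : ℕ) : Set where
  field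
    2y≤x         : 2 * y ≤ x
    10⁴x≤24499y : 10000 * x ≤ 24499 * y
    6yy≤xx       : 6 * (y * y) ≤ x * x

module Kinds (x y : ℕ) (near : Near√6 x y) where

  open Near√6 near

  -- A pair occupies two positions, hence one more unit `y`.
  scale : Old → ℕ
  scale half = 1
  scale full = 1
  scale pair = y

  Before Chosen Missed : Kind → ℕ
  Before new     = 1000 * x
  Before (old k) = before k * (y * scale k)
  Chosen new     = 500 * x
  Chosen (old k) = chosen k * (x * scale k)
  Missed new     = 2000 * y
  Missed (old k) = missed k * (y * scale k)

  BeforeAll ChosenOne MissedAll : List Kind → ℕ
  BeforeAll []       = 1
  BeforeAll (k ∷ ks) = Before k * BeforeAll ks
  MissedAll []       = 1
  MissedAll (k ∷ ks) = Missed k * MissedAll ks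
  ChosenOne []       = 0
  ChosenOne (k ∷ ks) = Chosen k * MissedAll ks + Missed k * ChosenOne ks

  private
    -- Reduces an inequality with one more `x` on the left to numerals, by x / y ≤ 2.4499.
    compare-scaled : ∀ A B → T (24499 * A ≤ᵇ 10000 * B) → x * A ≤ y * B
    compare-scaled A B t = *-cancelˡ-≤ 10000 (begin
      10000 * (x * A) ≡⟨ sym (*-assoc 10000 x A) ⟩
      10000 * x * A ≤⟨ *-monoˡ-≤ A 10⁴x≤24499y ⟩
      24499 * y * A ≡⟨ swap₁ 24499 y A ⟩
      y * (24499 * A) ≤⟨ *-monoʳ-≤ y (≤ᵇ⇒≤ (24499 * A) (10000 * B) t) ⟩
      y * (10000 * B) ≡⟨ swap₂ 10000 y B ⟩
      10000 * (y * B) ∎)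
      where
      open ≤-Reasoning
      swap₁ : ∀ a b c → a * b * c ≡ b * (a * c)
      swap₁ = solve-∀
      swap₂ : ∀ a b c → b * (a * c) ≡ a * (b * c)
      swap₂ = solve-∀

  choose₁ : ∀ a → Chosen a ≤ Before a
  choose₁ new     = *-monoˡ-≤ x (≤ᵇ⇒≤ 500 1000 tt)
  choose₁ (old a) = begin
    chosen a * (x * scale a) ≡⟨ r₁ (chosen a) x (scale a) ⟩
    scale a * (x * chosen a) ≤⟨ *-monoʳ-≤ (scale a) (compare-scaled (chosen a) (before a)
      (every-sound (λ k → 24499 * chosen k ≤ᵇ 10000 * before k) tt a)) ⟩
    scale a * (y * before a) ≡⟨ sym (r₁ (before a) y (scale a)) ⟩
    before a * (y * scale a) ∎
    where
    open ≤-Reasoning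
    r₁ : ∀ a b c → a * (b * c) ≡ c * (b * a)
    r₁ = solve-∀

  -- The degree in `x` decides. Two new variables leave an extra `x` on the right, and 2 y ≤ x
  -- suffices; one new variable balances both sides, and numerals are compared; without new
  -- variables the extra `x` is on the left.
  choose₂ : ∀ a b → Chosen a * Missed b + Missed a * Chosen b ≤ Before a * Before b
  choose₂ new new = begin
    500 * x * (2000 * y) + 2000 * y * (500 * x) ≡⟨ r 500 2000 x y ⟩
    500 * 2000 * x * (2 * y) ≤⟨ *-monoʳ-≤ (500 * 2000 * x) 2y≤x ⟩
    500 * 2000 * x * x ≡⟨ r′ 500 x ⟩
    1000 * x * (1000 * x) ∎
    where
    open ≤-Reasoning
    r : ∀ a b x y → a * x * (b * y) + b * y * (a * x) ≡ a * b * x * (2 * y)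
    r = solve-∀
    r′ : ∀ a x → a * (4 * a) * x * x ≡ (2 * a) * x * ((2 * a) * x)
    r′ = solve-∀
  choose₂ new (old b) = begin
    500 * x * (missed b * (y * scale b)) + 2000 * y * (chosen b * (x * scale b))
      ≡⟨ r 500 2000 (missed b) (chosen b) x y (scale b) ⟩
    x * y * scale b * (500 * missed b + 2000 * chosen b)
      ≤⟨ *-monoʳ-≤ (x * y * scale b) (≤ᵇ⇒≤ _ _
        (every-sound (λ b → 500 * missed b + 2000 * chosen b ≤ᵇ 1000 * before b) tt b)) ⟩
    x * y * scale b * (1000 * before b) ≡⟨ r′ 1000 (before b) x y (scale b) ⟩
    1000 * x * (before b * (y * scale b)) ∎
    where
    open ≤-Reasoning
    r : ∀ a b m c x y s → a * x * (m * (y * s)) + b * y * (c * (x * s)) ≡ x * y * s * (a * m + b * c)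
    r = solve-∀
    r′ : ∀ a b x y s → x * y * s * (a * b) ≡ a * x * (b * (y * s))
    r′ = solve-∀
  choose₂ (old a) new = subst₂ _≤_ (r (Chosen new) (Missed (old a)) (Missed new) (Chosen (old a)))
    (*-comm (Before new) (Before (old a))) (choose₂ new (old a))
    where
    r : ∀ a b c d → a * b + c * d ≡ d * c + b * a
    r = solve-∀
  choose₂ (old a) (old b) = begin
    chosen a * (x * scale a) * (missed b * (y * scale b)) + missed a * (y * scale a) * (chosen b * (x * scale b))
      ≡⟨ r (chosen a) (missed a) (chosen b) (missed b) x y (scale a) (scale b) ⟩
    y * (scale a * scale b) * (x * (chosen a * missed b + missed a * chosen b))
      ≤⟨ *-monoʳ-≤ (y * (scale a * scale b)) (compare-scaled _ (before a * before b)
         (every-sound (test a) (every-sound (λ a → every (test a)) tt a) b)) ⟩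
    y * (scale a * scale b) * (y * (before a * before b)) ≡⟨ r′ (before a) (before b) y (scale a) (scale b) ⟩
    before a * (y * scale a) * (before b * (y * scale b)) ∎
    where
    open ≤-Reasoning
    test : Old → Old → Bool
    test a b = 24499 * (chosen a * missed b + missed a * chosen b) ≤ᵇ 10000 * (before a * before b)
    r : ∀ c m c′ m′ x y s t → c * (x * s) * (m′ * (y * t)) + m * (y * s) * (c′ * (x * t)) ≡
      y * (s * t) * (x * (c * m′ + m * c′))
    r = solve-∀
    r′ : ∀ a b y s t → y * (s * t) * (y * (a * b)) ≡ a * (y * s) * (b * (y * t))
    r′ = solve-∀

  three : (f g : Kind → ℕ) → Kind → Kind → Kind → ℕ
  three f g a b c = f a * g b * g c + g a * f b * g c + g a * g b * f c

  private
    -- One `x` stands on each side, so only numerals are compared. Equality holds for half with half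
    -- and for half with full, which leaves no room in these values.
    new-old-old : ∀ b c → three Chosen Missed new (old b) (old c) ≤ Before new * Before (old b) * Before (old c)
    new-old-old b c = begin
      three Chosen Missed new (old b) (old c)
        ≡⟨ r 500 2000 (chosen b) (missed b) (chosen c) (missed c) x y (scale b) (scale c) ⟩
      x * y * y * (scale b * scale c) * (500 * missed b * missed c + 2000 * chosen b * missed c + 2000 * missed b * chosen c)
        ≤⟨ *-monoʳ-≤ (x * y * y * (scale b * scale c)) (≤ᵇ⇒≤ _ _
          (every-sound (test b) (every-sound (λ b → every (test b)) tt b) c)) ⟩
      x * y * y * (scale b * scale c) * (1000 * before b * before c) ≡⟨ r′ 1000 (before b) (before c) x y (scale b) (scale c) ⟩
      1000 * x * (before b * (y * scale b)) * (before c * (y * scale c)) ∎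
      where
      open ≤-Reasoning
      test : Old → Old → Bool
      test b c = 500 * missed b * missed c + 2000 * chosen b * missed c + 2000 * missed b * chosen c ≤ᵇ 1000 * before b * before c
      r : ∀ a d c m c′ m′ x y s t →
        a * x * (m * (y * s)) * (m′ * (y * t)) + d * y * (c * (x * s)) * (m′ * (y * t)) + d * y * (m * (y * s)) * (c′ * (x * t)) ≡
        x * y * y * (s * t) * (a * m * m′ + d * c * m′ + d * m * c′)
      r = solve-∀
      r′ : ∀ a b c x y s t → x * y * y * (s * t) * (a * b * c) ≡ a * x * (b * (y * s)) * (c * (y * t))
      r′ = solve-∀

    old-old-old : ∀ a b c → three Chosen Missed (old a) (old b) (old c) ≤ Before (old a) * Before (old b) * Before (old c)
    old-old-old a b c = begin
      three Chosen Missed (old a) (old b) (old c)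
        ≡⟨ r (chosen a) (missed a) (chosen b) (missed b) (chosen c) (missed c) x y (scale a) (scale b) (scale c) ⟩
      y * y * (scale a * scale b * scale c) *
        (x * (chosen a * missed b * missed c + missed a * chosen b * missed c + missed a * missed b * chosen c))
        ≤⟨ *-monoʳ-≤ (y * y * (scale a * scale b * scale c)) (compare-scaled _ (before a * before b * before c)
          (every-sound (test a b) (every-sound (λ b → every (test a b))
            (every-sound (λ a → every (λ b → every (test a b))) tt a) b) c)) ⟩
      y * y * (scale a * scale b * scale c) * (y * (before a * before b * before c))
        ≡⟨ r′ (before a) (before b) (before c) y (scale a) (scale b) (scale c) ⟩
      before a * (y * scale a) * (before b * (y * scale b)) * (before c * (y * scale c)) ∎
      where
      open ≤-Reasoning
      test : Old → Old → Old → Bool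
      test a b c = 24499 * (chosen a * missed b * missed c + missed a * chosen b * missed c + missed a * missed b * chosen c)
        ≤ᵇ 10000 * (before a * before b * before c)
      r : ∀ c m c′ m′ c″ m″ x y s t u →
        c * (x * s) * (m′ * (y * t)) * (m″ * (y * u)) + m * (y * s) * (c′ * (x * t)) * (m″ * (y * u)) +
          m * (y * s) * (m′ * (y * t)) * (c″ * (x * u)) ≡
        y * y * (s * t * u) * (x * (c * m′ * m″ + m * c′ * m″ + m * m′ * c″))
      r = solve-∀
      r′ : ∀ a b c y s t u → y * y * (s * t * u) * (y * (a * b * c)) ≡ a * (y * s) * (b * (y * t)) * (c * (y * u))
      r′ = solve-∀

  -- The hypotheses keep out the combination new, new, half, for which the inequality would say 5 y
  -- ≤ 2 x, false near √6.
  choose₃ : ∀ a b c → ¬ (a ≡ new × b ≡ new) → ¬ (a ≡ new × c ≡ new) → ¬ (b ≡ new × c ≡ new) →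
    three Chosen Missed a b c ≤ Before a * Before b * Before c
  choose₃ new     new     c       ab _ _ = contradiction (refl , refl) ab
  choose₃ new     (old b) new     _ ac _ = contradiction (refl , refl) ac
  choose₃ new     (old b) (old c) _ _ _ = new-old-old b c
  choose₃ (old a) new     new     _ _ bc = contradiction (refl , refl) bc
  choose₃ (old a) new     (old c) _ _ _ = subst₂ _≤_
    (r (Chosen new) (Missed new) (Chosen (old a)) (Missed (old a)) (Chosen (old c)) (Missed (old c)))
    (cong (_* Before (old c)) (*-comm (Before new) (Before (old a)))) (new-old-old a c)
    where
    r : ∀ c m c′ m′ c″ m″ → c * m′ * m″ + m * c′ * m″ + m * m′ * c″ ≡ c′ * m * m″ + m′ * c * m″ + m′ * m * c″
    r = solve-∀
  choose₃ (old a) (old b) new     _ _ _ = subst₂ _≤_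
    (r (Chosen new) (Missed new) (Chosen (old a)) (Missed (old a)) (Chosen (old b)) (Missed (old b)))
    (trans (*-assoc (Before new) _ _) (*-comm (Before new) _)) (new-old-old a b)
    where
    r : ∀ c m c′ m′ c″ m″ → c * m′ * m″ + m * c′ * m″ + m * m′ * c″ ≡ c′ * m″ * m + m′ * c″ * m + m′ * m″ * c
    r = solve-∀
  choose₃ (old a) (old b) (old c) _ _ _ = old-old-old a b c

-- Branching on the variables of a clause

prodV-++ : ∀ {A : Set} {n k l} (g : Fin n → A → ℕ) (L : Vec (Fin n) k) (M : Vec (Fin n) l) as bs →
  prodV g (L Vec.++ M) (as Vec.++ bs) ≡ prodV g L as * prodV g M bs
prodV-++ g []      M []       bs = sym (+-identityʳ _)
prodV-++ g (i ∷ L) M (a ∷ as) bs = trans (cong (g i a *_) (prodV-++ g L M as bs)) (sym (*-assoc (g i a) _ _))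

Zip-++ : ∀ {A : Set} {n k l} {P : Fin n → A → Set} {L : Vec (Fin n) k} {M : Vec (Fin n) l} {as bs} →
  Zip P L as → Zip P M bs → Zip P (L Vec.++ M) (as Vec.++ bs)
Zip-++ {L = []}    {as = []}    _        q = q
Zip-++ {L = _ ∷ _} {as = _ ∷ _} (p , ps) q = p , Zip-++ ps q

ZipAny-++ˡ : ∀ {A : Set} {n k l} {P : Fin n → A → Set} {L : Vec (Fin n) k} {M : Vec (Fin n) l} {as bs} →
  ZipAny P L as → ZipAny P (L Vec.++ M) (as Vec.++ bs)
ZipAny-++ˡ {L = []}    {as = []}    ()
ZipAny-++ˡ {L = _ ∷ _} {as = _ ∷ _} (inj₁ p)  = inj₁ p
ZipAny-++ˡ {L = _ ∷ _} {as = _ ∷ _} (inj₂ ps) = inj₂ (ZipAny-++ˡ ps)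

ZipAny-++ʳ : ∀ {A : Set} {n k l} {P : Fin n → A → Set} (L : Vec (Fin n) k) {M : Vec (Fin n) l} as {bs} →
  ZipAny P M bs → ZipAny P (L Vec.++ M) (as Vec.++ bs)
ZipAny-++ʳ []      []       q = q
ZipAny-++ʳ (_ ∷ L) (_ ∷ as) q = inj₂ (ZipAny-++ʳ L as q)

sumBy-map : ∀ {A B : Set} (h : A → B) (xs : List A) (f : B → ℕ) → sumBy (map h xs) f ≡ sumBy xs (f ∘ h)
sumBy-map h []       f = refl
sumBy-map h (x ∷ xs) f = cong (f (h x) +_) (sumBy-map h xs f)

module Blocks {n} (sols : List (Assignment n)) (x y K : ℕ) (x>0 : 0 < x) (y>0 : 0 < y)
  (near : Near√6 x y) where

  open Weighted sols x y K x>0 y>0 public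
  open Kinds x y near public

  Gains : State n → Fin n → Status n → Set
  Gains st j s = s ≡ one × st j ≢ one

  record Move (st : State n) {k} (L : Vec (Fin n) k) (ss : Vec (Status n) k) : Set where
    constructor mkMove
    field
      moves     : Zip (λ j s → st j ⇝ s) L ss
      notPaired : Zip (λ _ → NotPaired sols) L ss

  Move-++ : ∀ {st k l} {L : Vec (Fin n) k} {M : Vec (Fin n) l} {ss ts} → Move st L ss → Move st M ts → Move st (L Vec.++ M) (ss Vec.++ ts)
  Move-++ (mkMove a b) (mkMove c d) = mkMove (Zip-++ a c) (Zip-++ b d)

  -- Branching on the elements of cs: one of them is chosen (status one), the others are missed.
  record Block (st : State n) (cs : List (Fin n)) : Set where
    field
      {size}  : ℕ
      spots     : Vec (Fin n) size
      none    : Vec (Status n) size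
      picks   : List (Child size)
      factor  : ℕ
      kinds   : List Kind
      factor≢0 : factor ≢ 0
      unique  : Unique spots
      members : VAll.All (λ j → j ∈ cs ⊎ (∃ λ c → c ∈ cs × st c ≡ paired j)) spots
      closed  : Closed st spots
      none-value  : valueV none ≡ MissedAll kinds
      picks-value : sumBy picks (λ (d , ss) → d * valueV ss) ≡ ChosenOne kinds
      old-value   : factor * valueV (Vec.map st spots) ≡ BeforeAll kinds
      trues≡0 : ∀ {α} → α ∈ sols → Agree st α → trues α cs ≡ 0 →
        factor * weightV α spots (Vec.map st spots) ≤ weightV α spots none
      trues≤1 : ∀ {α} → α ∈ sols → Agree st α → trues α cs ≤ 1 →
        factor * weightV α spots (Vec.map st spots) ≤ 2 * weightV α spots none
      trues≤2 : ∀ {α} → α ∈ sols → Agree st α → 1 ≤ trues α cs → trues α cs ≤ 2 →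
        factor * weightV α spots (Vec.map st spots) ≤ sumBy picks (λ (d , ss) → d * weightV α spots ss)
      none-move   : Move st spots none
      picks-move  : ∀ {d ss} → (d , ss) ∈ picks → Move st spots ss × ZipAny (Gains st) spots ss

  empty : ∀ {st} → Block st []
  empty = record
    { spots = [] ; none = [] ; picks = [] ; factor = 1 ; kinds = []
    ; factor≢0 = λ () ; unique = [] ; members = [] ; closed = []
    ; none-value = refl ; picks-value = refl ; old-value = refl
    ; trues≡0 = λ _ _ _ → ≤-refl ; trues≤1 = λ _ _ _ → s≤s z≤n ; trues≤2 = λ _ _ ()
    ; none-move = mkMove tt tt ; picks-move = λ () }

  -- The contribution of one variable, together with its partner if it has one. The multiplicity is
  -- recovered in full when the variable is false and missed; a true variable keeps its weight only
  -- once, whether picked or missed.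
  record Cell (st : State n) (c : Fin n) : Set where
    field
      {size}  : ℕ
      spots     : Vec (Fin n) size
      none    : Vec (Status n) size
      pick    : Vec (Status n) size
      kind    : Kind
      unique  : Unique spots
      members : VAll.All (λ j → j ≡ c ⊎ st c ≡ paired j) spots
      closed  : Closed st spots
      none-value : valueV none ≡ Missed kind
      pick-value : mult kind * valueV pick ≡ Chosen kind
      old-value  : mult kind * valueV (Vec.map st spots) ≡ Before kind
      if-false : ∀ {α} → α ∈ sols → Agree st α → lookup α c ≡ false →
        mult kind * weightV α spots (Vec.map st spots) ≤ weightV α spots none
      if-true : ∀ {α} → α ∈ sols → Agree st α → lookup α c ≡ true →
        weightV α spots (Vec.map st spots) ≤ weightV α spots none × weightV α spots (Vec.map st spots) ≤ weightV α spots pick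
      none-move : Move st spots none
      pick-move : Move st spots pick
      pick-gain : ZipAny (Gains st) spots pick

  mult≤2 : ∀ k → mult k ≡ 1 ⊎ mult k ≡ 2
  mult≤2 new        = inj₂ refl
  mult≤2 (old half) = inj₁ refl
  mult≤2 (old full) = inj₂ refl
  mult≤2 (old pair) = inj₂ refl

  mult≢0 : ∀ k → mult k ≢ 0
  mult≢0 (old half) ()

  private
    -- Here a is the weighted remainder of the clause, u its weight with all variables missed, and s
    -- its weight summed over its own picks. Multiplicity 2 is paid by one use of each bound,
    -- multiplicity 1 by s.
    factor-bound : ∀ {m} → m ≡ 1 ⊎ m ≡ 2 → ∀ {a u s} → a ≤ 2 * u → a ≤ s → m * a ≤ m * u + s
    factor-bound {m} (inj₁ refl) {a} {u} {s} a≤2u a≤s = begin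
      1 * a ≡⟨ *-identityˡ a ⟩
      a ≤⟨ a≤s ⟩
      s ≤⟨ m≤n+m s (1 * u) ⟩
      1 * u + s ∎
      where open ≤-Reasoning
    factor-bound {m} (inj₂ refl) {a} {u} {s} a≤2u a≤s =
      subst (_≤ 2 * u + s) (cong (a +_) (sym (+-identityʳ a))) (+-mono-≤ a≤2u a≤s)

  module _ {st : State n} {c cs} (C : Cell st c) (B : Block st cs) where
    private
      module C = Cell C
      module B = Block B

    -- If `c` is false, its missed status pays its multiplicity in every child. If `c` alone is
    -- true, its own pick pays. If `c` and one more variable are true, the pick of `c` and those of
    -- the others share the cost by `factor-bound`; this is why a block must also control solutions
    -- with at most one true variable.
    extend : (∀ {j} → j ∈ cs → j ≢ c) → (∀ {j} → j ∈ cs → st j ≢ paired c) → (∀ {j} → j ∈ cs → st c ≢ paired j) →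
      PairsOK sols st → Block st (c ∷ cs)
    extend c∉cs not-partner₁ not-partner₂ pairs = record
      { spots = C.spots Vec.++ B.spots
      ; none = C.none Vec.++ B.none
      ; picks = (mult C.kind , C.pick Vec.++ B.none) ∷ map (λ (d , ss) → d , C.none Vec.++ ss) B.picks
      ; factor = mult C.kind * B.factor
      ; kinds = C.kind ∷ B.kinds
      ; factor≢0 = λ eq → [ mult≢0 C.kind , B.factor≢0 ]′ (m*n≡0⇒m≡0∨n≡0 (mult C.kind) eq)
      ; unique = AllPairs-++⁺ C.unique B.unique
          (VAll.map (λ cj → VAll.map (λ bj → disjoint cj bj) B.members) C.members)
      ; members = All-++⁺
          (VAll.map (λ { (inj₁ eq) → inj₁ (here eq) ; (inj₂ eq) → inj₂ (c , here refl , eq) }) C.members)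
          (VAll.map (λ { (inj₁ j∈) → inj₁ (there j∈) ; (inj₂ (d , d∈ , eq)) → inj₂ (d , there d∈ , eq) }) B.members)
      ; closed = All-++⁺
          (VAll.map (λ f v eq out → f v eq (outsideˡ C.spots out)) C.closed)
          (VAll.map (λ f v eq out → f v eq (outsideʳ C.spots out)) B.closed)
      ; none-value = trans (valueV-++ C.none B.none) (cong₂ _*_ C.none-value B.none-value)
      ; picks-value = cong₂ _+_
          (trans (cong (mult C.kind *_) (valueV-++ C.pick B.none))
            (trans (sym (*-assoc (mult C.kind) _ _)) (cong₂ _*_ C.pick-value B.none-value)))
          (trans (sumBy-map _ B.picks _) (trans (sumBy-cong B.picks (λ {(d , ss)} _ →
              trans (cong (d *_) (valueV-++ C.none ss)) (swap-mid d (valueV C.none) (valueV ss))))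
            (trans (sumBy-*ˡ B.picks (λ (d , ss) → d * valueV ss) (valueV C.none)) (cong₂ _*_ C.none-value B.picks-value))))
      ; old-value = trans (cong (mult C.kind * B.factor *_) (trans (cong valueV (Vecₚ.map-++ st C.spots B.spots))
            (valueV-++ (Vec.map st C.spots) (Vec.map st B.spots))))
          (trans ([m*n]*[o*p]≡[m*o]*[n*p] (mult C.kind) B.factor _ _) (cong₂ _*_ C.old-value B.old-value))
      ; trues≡0 = λ {α} → zero-case {α}
      ; trues≤1 = λ {α} → one-case {α}
      ; trues≤2 = λ {α} → two-case {α}
      ; none-move = Move-++ C.none-move B.none-move
      ; picks-move = picks-move′
      }
      where
      spots = C.spots Vec.++ B.spots
      μ = mult C.kind
      swap-mid : ∀ a b c → a * (b * c) ≡ b * (a * c)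
      swap-mid = solve-∀
      outsideˡ : ∀ {j k l} (L : Vec (Fin n) k) {M : Vec (Fin n) l} → Outside j (L Vec.++ M) → Outside j L
      outsideˡ []      _        = []
      outsideˡ (_ ∷ L) (p ∷ ps) = p ∷ outsideˡ L ps
      outsideʳ : ∀ {j k l} (L : Vec (Fin n) k) {M : Vec (Fin n) l} → Outside j (L Vec.++ M) → Outside j M
      outsideʳ []      ps       = ps
      outsideʳ (_ ∷ L) (p ∷ ps) = outsideʳ L ps
      valueV-++ : ∀ {k l} (ss : Vec (Status n) k) (ts : Vec (Status n) l) → valueV (ss Vec.++ ts) ≡ valueV ss * valueV ts
      valueV-++ []       ts = sym (+-identityʳ _)
      valueV-++ (s ∷ ss) ts = trans (cong (value s *_) (valueV-++ ss ts)) (sym (*-assoc (value s) _ _))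
      paired-injective : ∀ {s : Status n} {i j} → s ≡ paired i → s ≡ paired j → i ≡ j
      paired-injective refl refl = refl
      disjoint : ∀ {i j} → i ≡ c ⊎ st c ≡ paired i → j ∈ cs ⊎ (∃ λ d → d ∈ cs × st d ≡ paired j) → i ≢ j
      disjoint (inj₁ refl) (inj₁ j∈) refl = c∉cs j∈ refl
      disjoint (inj₁ refl) (inj₂ (d , d∈ , eq)) refl = not-partner₁ d∈ eq
      disjoint (inj₂ eq) (inj₁ j∈) refl = not-partner₂ j∈ eq
      disjoint (inj₂ eq) (inj₂ (d , d∈ , eq′)) refl =
        c∉cs d∈ (paired-injective (Pair.symmetric (pairs eq′)) (Pair.symmetric (pairs eq)))
      W : ∀ α {k} (L : Vec (Fin n) k) → ℕ
      W α L = weightV α L (Vec.map st L)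
      split-old : ∀ α → μ * B.factor * W α spots ≡ (μ * W α C.spots) * (B.factor * W α B.spots)
      split-old α = trans (cong (μ * B.factor *_) (trans (cong (weightV α spots) (Vecₚ.map-++ st C.spots B.spots))
        (prodV-++ _ C.spots B.spots _ _))) ([m*n]*[o*p]≡[m*o]*[n*p] μ B.factor _ _)
      split-none : ∀ α → weightV α spots (C.none Vec.++ B.none) ≡ weightV α C.spots C.none * weightV α B.spots B.none
      split-none α = prodV-++ _ C.spots B.spots C.none B.none
      picks-sum : ∀ α → sumBy (map (λ (d , ss) → d , C.none Vec.++ ss) B.picks) (λ (d , ss) → d * weightV α spots ss)
        ≡ weightV α C.spots C.none * sumBy B.picks (λ (d , ss) → d * weightV α B.spots ss)
      picks-sum α = trans (sumBy-map _ B.picks _) (trans (sumBy-cong B.picks (λ {(d , ss)} _ →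
          trans (cong (d *_) (prodV-++ _ C.spots B.spots C.none ss)) (swap-mid d (weightV α C.spots C.none) (weightV α B.spots ss))))
        (sumBy-*ˡ B.picks (λ (d , ss) → d * weightV α B.spots ss) (weightV α C.spots C.none)))
      zero-case : ∀ {α} → α ∈ sols → Agree st α → trues α (c ∷ cs) ≡ 0 →
        μ * B.factor * W α spots ≤ weightV α spots (C.none Vec.++ B.none)
      zero-case {α} α∈ agree eq with lookup α c in bit
      ... | false = subst₂ _≤_ (sym (split-old α)) (sym (split-none α))
        (*-mono-≤ (C.if-false α∈ agree bit) (B.trues≡0 α∈ agree eq))
      one-case : ∀ {α} → α ∈ sols → Agree st α → trues α (c ∷ cs) ≤ 1 →
        μ * B.factor * W α spots ≤ 2 * weightV α spots (C.none Vec.++ B.none)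
      one-case {α} α∈ agree le with lookup α c in bit
      ... | false = subst₂ _≤_ (sym (split-old α)) (trans (swap-mid (weightV α C.spots C.none) 2 _) (cong (2 *_) (sym (split-none α))))
        (*-mono-≤ (C.if-false α∈ agree bit) (B.trues≤1 α∈ agree le))
      ... | true = subst₂ _≤_ (sym (split-old α)) (trans (*-assoc 2 (weightV α C.spots C.none) (weightV α B.spots B.none)) (cong (2 *_) (sym (split-none α))))
        (*-mono-≤ (*-mono-≤ (m≤2 (mult≤2 C.kind)) (proj₁ (C.if-true α∈ agree bit)))
          (B.trues≡0 α∈ agree (n≤0⇒n≡0 (≤-pred le))))
        where
        m≤2 : ∀ {m} → m ≡ 1 ⊎ m ≡ 2 → m ≤ 2
        m≤2 (inj₁ refl) = s≤s z≤n
        m≤2 (inj₂ refl) = ≤-refl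
      two-case : ∀ {α} → α ∈ sols → Agree st α → 1 ≤ trues α (c ∷ cs) → trues α (c ∷ cs) ≤ 2 →
        μ * B.factor * W α spots ≤
        μ * weightV α spots (C.pick Vec.++ B.none) +
        sumBy (map (λ (d , ss) → d , C.none Vec.++ ss) B.picks) (λ (d , ss) → d * weightV α spots ss)
      two-case {α} α∈ agree ge le with lookup α c in bit
      ... | false = subst₂ _≤_ (sym (split-old α)) (cong (μ * weightV α spots (C.pick Vec.++ B.none) +_) (sym (picks-sum α)))
        (≤-trans (*-mono-≤ (C.if-false α∈ agree bit) (B.trues≤2 α∈ agree ge le)) (m≤n+m _ _))
      ... | true with trues α cs in count
      ...   | zero = ≤-trans
        (subst₂ _≤_ (sym (split-old α))
          (trans (*-assoc μ _ _) (cong (μ *_) (sym (prodV-++ _ C.spots B.spots C.pick B.none))))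
          (*-mono-≤ (*-monoʳ-≤ μ (proj₂ (C.if-true α∈ agree bit))) (B.trues≡0 α∈ agree count)))
        (m≤m+n _ _)
      ...   | suc t = begin
        μ * B.factor * W α spots ≡⟨ split-old α ⟩
        (μ * W α C.spots) * (B.factor * W α B.spots)
          ≡⟨ trans (*-assoc μ _ _) (trans (swap-mid μ (W α C.spots) _) refl) ⟩
        W α C.spots * (μ * (B.factor * W α B.spots))
          ≤⟨ *-monoʳ-≤ (W α C.spots) (factor-bound (mult≤2 C.kind)
              (B.trues≤1 α∈ agree (subst (_≤ 1) (sym count) (≤-pred le)))
              (B.trues≤2 α∈ agree (subst (1 ≤_) (sym count) (s≤s z≤n)) (subst (_≤ 2) (sym count) (≤-trans (≤-pred le) (s≤s z≤n))))) ⟩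
        W α C.spots * (μ * weightV α B.spots B.none + sumBy B.picks (λ (d , ss) → d * weightV α B.spots ss))
          ≡⟨ trans (*-distribˡ-+ (W α C.spots) _ _) (cong (_+ W α C.spots * sumBy B.picks (λ (d , ss) → d * weightV α B.spots ss)) (swap-mid (W α C.spots) μ _)) ⟩
        μ * (W α C.spots * weightV α B.spots B.none) + W α C.spots * sumBy B.picks (λ (d , ss) → d * weightV α B.spots ss)
          ≤⟨ +-mono-≤ (*-monoʳ-≤ μ (*-monoˡ-≤ _ (proj₂ (C.if-true α∈ agree bit))))
              (*-monoˡ-≤ _ (proj₁ (C.if-true α∈ agree bit))) ⟩
        μ * (weightV α C.spots C.pick * weightV α B.spots B.none) +
          weightV α C.spots C.none * sumBy B.picks (λ (d , ss) → d * weightV α B.spots ss)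
          ≡⟨ cong₂ _+_ (cong (μ *_) (sym (prodV-++ _ C.spots B.spots C.pick B.none))) (sym (picks-sum α)) ⟩
        μ * weightV α spots (C.pick Vec.++ B.none) +
          sumBy (map (λ (d , ss) → d , C.none Vec.++ ss) B.picks) (λ (d , ss) → d * weightV α spots ss) ∎
        where open ≤-Reasoning
      picks-move′ : ∀ {d ss} → (d , ss) ∈ (μ , C.pick Vec.++ B.none) ∷ map (λ (d , ss) → d , C.none Vec.++ ss) B.picks →
        Move st spots ss × ZipAny (Gains st) spots ss
      picks-move′ (here refl) = Move-++ C.pick-move B.none-move , ZipAny-++ˡ C.pick-gain
      picks-move′ (there m) with ∈-map⁻ _ m
      ... | (d , ss) , m′ , refl with B.picks-move m′
      ...   | move , gain = Move-++ C.none-move move , ZipAny-++ʳ C.spots C.none gain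

  single : ∀ {st} c s k → mult k * value s ≡ Before k → mult k * value one ≡ Chosen k → value half ≡ Missed k →
    mult k * weight₁ s false ≤ 2 → weight₁ s true ≤ 1 →
    s ⇝ one → s ⇝ half → s ≢ one → NotPaired sols s → st c ≡ s → Cell st c
  single {st} c s k before-k chosen-k missed-k false-k true-k to-one to-half s≢one np eq = record
    { spots = c ∷ [] ; none = half ∷ [] ; pick = one ∷ [] ; kind = k
    ; unique = [] ∷ []
    ; members = inj₁ refl ∷ []
    ; closed = (λ _ e _ → np (trans (sym eq) e)) ∷ []
    ; none-value = trans (*-identityʳ _) missed-k
    ; pick-value = trans (cong (mult k *_) (*-identityʳ _)) chosen-k
    ; old-value = trans (cong (mult k *_) (trans (*-identityʳ _) (cong value eq))) before-k
    ; if-false = λ {α} _ _ → if-false′ {α}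
    ; if-true = λ {α} _ _ → if-true′ {α}
    ; none-move = mkMove (subst (_⇝ half) (sym eq) to-half , tt) ((λ ()) , tt)
    ; pick-move = mkMove (subst (_⇝ one) (sym eq) to-one , tt) ((λ ()) , tt)
    ; pick-gain = inj₁ (refl , λ e → s≢one (trans (sym eq) e))
    }
    where
    if-false′ : ∀ {α} → lookup α c ≡ false → mult k * weightV α (c ∷ []) (st c ∷ []) ≤ weightV α (c ∷ []) (half ∷ [])
    if-false′ bit rewrite eq | bit | *-identityʳ (weight₁ s false) = false-k
    if-true′ : ∀ {α} → lookup α c ≡ true → weightV α (c ∷ []) (st c ∷ []) ≤ weightV α (c ∷ []) (half ∷ []) ×
      weightV α (c ∷ []) (st c ∷ []) ≤ weightV α (c ∷ []) (one ∷ [])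
    if-true′ bit rewrite eq | bit | *-identityʳ (weight₁ s true) = true-k , true-k

  private
    product : ∀ a b c x y → c ≡ a * b → a * x * (b * y * 1) ≡ c * (x * y)
    product a b c x y refl = solve a b x y
      where
      solve : ∀ a b x y → a * x * (b * y * 1) ≡ (a * b) * (x * y)
      solve = solve-∀

    twice : ∀ a b y → b ≡ 2 * a → 2 * (a * y) ≡ b * y
    twice a b y refl = sym (*-assoc 2 a y)

    unit : ∀ a b y s → a ≡ b → 1 ≡ s → a * y ≡ b * (y * s)
    unit a b y s refl refl = cong (a *_) (sym (*-identityʳ y))

    -- Avoids unfolding the multiplication by a large literal during conversion.
    convert : ∀ {a b c s t} → a ≡ b → s ≡ t → a * (c * s) ≡ b * (c * t)
    convert refl refl = refl

    full-before : 2 * value full ≡ Before (old full)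
    full-before = trans (twice 1250 2500 y refl) (unit 2500 (before full) y (scale full) refl refl)

    full-chosen : 2 * value one ≡ Chosen (old full)
    full-chosen = trans (twice 250 500 x refl) (unit 500 (chosen full) x (scale full) refl refl)

    half-before : 1 * value half ≡ Before (old half)
    half-before = trans (*-identityˡ (value half)) (unit 2000 (before half) y (scale half) refl refl)

    half-chosen : 1 * value one ≡ Chosen (old half)
    half-chosen = trans (*-identityˡ (value one)) (unit 250 (chosen half) x (scale half) refl refl)

    new-before : 2 * value fresh ≡ Before new
    new-before = twice 500 1000 x refl

    new-chosen : 2 * value one ≡ Chosen new
    new-chosen = twice 250 500 x refl

    pair-none : valueV (half ∷ full ∷ []) ≡ Missed (old pair)
    pair-none = trans (product 2000 1250 2500000 y y refl) (convert {2500000} {missed pair} {y} {y} {scale pair} refl refl)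

    pair-pick : 2 * valueV (one ∷ dead ∷ []) ≡ Chosen (old pair)
    pair-pick = trans (cong (2 *_) (product 250 1000 250000 x y refl)) (trans (twice 250000 500000 (x * y) refl)
      (convert {500000} {chosen pair} {x} {y} {scale pair} refl refl))

    pair-old : ∀ v w → 2 * valueV (paired v ∷ paired w ∷ []) ≡ Before (old pair)
    pair-old v w = trans (cong (2 *_) (product 1199 1199 1437601 y y refl)) (trans (twice 1437601 2875202 (y * y) refl)
      (convert {2875202} {before pair} {y} {y} {scale pair} refl refl))

    valueV-cong : ∀ {s t s′ t′ : Status n} → s ≡ s′ → t ≡ t′ → valueV (s ∷ t ∷ []) ≡ valueV (s′ ∷ t′ ∷ [])
    valueV-cong refl refl = refl

    pair-if-false : ∀ {st : State n} {c w} {α : Assignment n} → st c ≡ paired w → st w ≡ paired c → lookup α c ≡ false →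
      2 * weightV α (c ∷ w ∷ []) (st c ∷ st w ∷ []) ≤ weightV α (c ∷ w ∷ []) (half ∷ full ∷ [])
    pair-if-false eq eq′ bit rewrite eq | eq′ | bit = ≤-refl

    pair-if-true : ∀ {st : State n} {c w} {α : Assignment n} → st c ≡ paired w → st w ≡ paired c →
      lookup α c ≡ true → lookup α w ≡ false →
      weightV α (c ∷ w ∷ []) (st c ∷ st w ∷ []) ≤ weightV α (c ∷ w ∷ []) (half ∷ full ∷ []) ×
      weightV α (c ∷ w ∷ []) (st c ∷ st w ∷ []) ≤ weightV α (c ∷ w ∷ []) (one ∷ dead ∷ [])
    pair-if-true eq eq′ bit bit′ rewrite eq | eq′ | bit | bit′ = ≤-refl , ≤-refl

    -- A picked variable makes its partner `dead` by exclusivity. A missed one dissolves the pair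
    -- and leaves the partner `full`.
    pair-cell : ∀ {st} → PairsOK sols st → ∀ c w → st c ≡ paired w → Σ (Cell st c) λ C → Cell.kind C ≡ old pair
    pair-cell {st} pairs c w eq = record
      { spots = c ∷ w ∷ [] ; none = half ∷ full ∷ [] ; pick = one ∷ dead ∷ [] ; kind = old pair
      ; unique = (distinct ∷ []) ∷ [] ∷ []
      ; members = inj₁ refl ∷ inj₂ eq ∷ []
      ; closed = (λ { _ e (_ ∷ v≢w ∷ []) → v≢w (inj (trans (sym e) eq)) }) ∷ (λ { _ e (v≢c ∷ _) → v≢c (inj (trans (sym e) symmetric)) }) ∷ []
      ; none-value = pair-none
      ; pick-value = pair-pick
      ; old-value = trans (cong (2 *_) (valueV-cong eq symmetric)) (pair-old w c)
      ; if-false = λ {α} _ _ bit → pair-if-false {st} {c} {w} {α} eq symmetric bit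
      ; if-true = λ {α} α∈ agree bit → pair-if-true {st} {c} {w} {α} eq symmetric bit (exclusive α∈ agree bit)
      ; none-move = mkMove (subst (_⇝ half) (sym eq) (λ ()) , subst (_⇝ full) (sym symmetric) (λ ()) , tt) ((λ ()) , (λ ()) , tt)
      ; pick-move = mkMove (subst (_⇝ one) (sym eq) (λ ()) , subst (_⇝ dead) (sym symmetric) (λ ()) , tt) ((λ ()) , (λ ()) , tt)
      ; pick-gain = inj₁ (refl , λ e → contradiction (trans (sym e) eq) (λ ()))
      } , refl
      where
      open Pair (pairs eq)
      inj : ∀ {i j : Fin n} → paired i ≡ paired j → i ≡ j
      inj refl = refl

  kindOf : Status n → Kind
  kindOf half       = old half
  kindOf full       = old full
  kindOf (paired _) = old pair
  -- Besides `fresh` this catches `one` and `dead`, which are not live.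
  kindOf _          = new

  cell-of : ∀ {st} → PairsOK sols st → ∀ c s → st c ≡ s → Live s → Σ (Cell st c) λ C → Cell.kind C ≡ kindOf s
  cell-of pairs c one        eq (¬one , _)  = contradiction refl ¬one
  cell-of pairs c dead       eq (_ , ¬dead) = contradiction refl ¬dead
  cell-of pairs c half       eq _ =
    single c half (old half) half-before half-chosen (unit 2000 (missed half) y (scale half) refl refl) ≤-refl ≤-refl one half (λ ()) (λ ()) eq , refl
  cell-of pairs c full       eq _ =
    single c full (old full) full-before full-chosen (unit 2000 (missed full) y (scale full) refl refl) ≤-refl ≤-refl (λ ()) (λ ()) (λ ()) (λ ()) eq , refl
  cell-of pairs c fresh      eq _ = single c fresh new new-before new-chosen refl ≤-refl ≤-refl tt tt (λ ()) (λ ()) eq , refl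
  cell-of pairs c (paired w) eq _ = pair-cell pairs c w eq

-- The final branching on clean states

isOne : ∀ {n} → Status n → ℕ
isOne one = 1
isOne _   = 0

sumF : ∀ {n} → (Fin n → ℕ) → ℕ
sumF {zero}  f = 0
sumF {suc n} f = f zero + sumF (f ∘ suc)

sumF-mono : ∀ {n} {f g : Fin n → ℕ} → (∀ i → f i ≤ g i) → sumF f ≤ sumF g
sumF-mono {zero}  le = z≤n
sumF-mono {suc n} le = +-mono-≤ (le zero) (sumF-mono (le ∘ suc))

sumF-strict : ∀ {n} {f g : Fin n → ℕ} → (∀ i → f i ≤ g i) → ∀ i → f i < g i → sumF f < sumF g
sumF-strict {suc n} le zero    lt = +-mono-<-≤ lt (sumF-mono (le ∘ suc))
sumF-strict {suc n} le (suc i) lt = +-mono-≤-< (le zero) (sumF-strict (le ∘ suc) i lt)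

ones : ∀ {n} → State n → ℕ
ones st = sumF (λ i → isOne (st i))

ones-strict : ∀ {n} {st st′ : State n} → Later st st′ → (∃ λ j → st′ j ≡ one × st j ≢ one) → ones st < ones st′
ones-strict {st = st} {st′} later (j , eq , ne) = sumF-strict mono j strict
  where
  mono : ∀ i → isOne (st i) ≤ isOne (st′ i)
  mono i with st i | later i
  ... | one      | eq rewrite eq = ≤-refl
  ... | dead     | _ = z≤n
  ... | half     | _ = z≤n
  ... | full     | _ = z≤n
  ... | fresh    | _ = z≤n
  ... | paired _ | _ = z≤n
  strict : isOne (st j) < isOne (st′ j)
  strict rewrite eq with st j
  ... | one      = contradiction refl ne
  ... | dead     = s≤s z≤n
  ... | half     = s≤s z≤n
  ... | full     = s≤s z≤n
  ... | fresh    = s≤s z≤n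
  ... | paired _ = s≤s z≤n

module _ {n} (sols : List (Assignment n)) where

  Clean : State n → Set
  Clean st = ∀ {a b c} → a ≢ b → a ≢ c → b ≢ c → NAE sols a b c → st a ≡ fresh → st b ≡ fresh → ¬ Live (st c)

  Hits : State n → List (Fin n) → Set
  Hits st cs = ∀ {α} → α ∈ sols → Agree st α → 1 ≤ trues α cs

  -- What a violated clause leaves after repeated and impossible literals are removed. With three
  -- variables left nothing was removed, so the clause was purely positive and the triple is
  -- not-all-equal.
  data Falsified (st : State n) : Set where
    none  : Hits st [] → Falsified st
    unit  : ∀ {a} → Live (st a) → Hits st (a ∷ []) → Falsified st
    two   : ∀ {a b} → a ≢ b → Live (st a) → Live (st b) → Hits st (a ∷ b ∷ []) → Falsified st
    three : ∀ {a b c} → a ≢ b → a ≢ c → b ≢ c → Live (st a) → Live (st b) → Live (st c) →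
            NAE sols a b c → Hits st (a ∷ b ∷ c ∷ []) → Falsified st

NAE-rotate : ∀ {n} (sols : List (Assignment n)) {a b c} → NAE sols a b c → NAE sols b c a
NAE-rotate sols {a} {b} {c} t {α} α∈ = go (lookup α a) (lookup α b) (lookup α c) (t α∈)
  where
  go : ∀ a b c → nae a b c ≡ true → nae b c a ≡ true
  go true  true  false _ = refl
  go true  false true  _ = refl
  go true  false false _ = refl
  go false true  true  _ = refl
  go false true  false _ = refl
  go false false true  _ = refl

NAE-swap : ∀ {n} (sols : List (Assignment n)) {a b c} → NAE sols a b c → NAE sols b a c
NAE-swap sols {a} {b} {c} t {α} α∈ = go (lookup α a) (lookup α b) (lookup α c) (t α∈)
  where
  go : ∀ a b c → nae a b c ≡ true → nae b a c ≡ true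
  go true  true  false _ = refl
  go true  false true  _ = refl
  go true  false false _ = refl
  go false true  true  _ = refl
  go false true  false _ = refl
  go false false true  _ = refl

module Finish {n} (sols : List (Assignment n)) (x y K : ℕ) (x>0 : 0 < x) (y>0 : 0 < y) (near : Near√6 x y) (m : ℕ)
  (falsified : ∀ st → ones st < m → Falsified sols st)
  (saturated : ∀ st → m ≤ ones st → Weighted.Bounded sols x y K x>0 y>0 st) where

  open Blocks sols x y K x>0 y>0 near public
  open Near√6 near

  kind-new : ∀ {s} → Live s → kindOf s ≡ new → s ≡ fresh
  kind-new {one}   (¬one , _)  _ = contradiction refl ¬one
  kind-new {dead}  (_ , ¬dead) _ = contradiction refl ¬dead
  kind-new {fresh} _ _ = refl

  Clean-later : ∀ {st st′} → Later st st′ → Clean sols st → Clean sols st′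
  Clean-later later clean ab ac bc t fa fb live =
    clean ab ac bc t (⇝-fresh (later _) fa) (⇝-fresh (later _) fb) (⇝-live (later _) live)

  -- Induction on the number of ones still missing from m: every child has gained a `one`.
  finish : ∀ k st → m ≤ ones st + k → PairsOK sols st → Clean sols st → Bounded st
  finish zero    st le _ _ = saturated st (subst (m ≤_) (+-identityʳ _) le)
  finish (suc k) st le pairs clean with m ≤? ones st
  ... | yes m≤ones = saturated st m≤ones
  ... | no m≰ones = go (falsified st (≰⇒> m≰ones))
    where
    next : ∀ {l} {L : Vec (Fin n) l} {ss} → Unique L → Closed st L →
      Move st L ss → ZipAny (Gains st) L ss → Bounded (setAll L ss st)
    next {L = L} {ss} uL closed (mkMove moves np) gain =
      finish k (setAll L ss st)
        (≤-trans le (≤-trans (≤-reflexive (+-suc (ones st) k)) (+-monoˡ-≤ k (ones-strict later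
          (let j , s≡one , ne = ZipAny-setAll (Gains st) {f = st} uL gain in j , s≡one , ne)))))
        (PairsOK-setAll sols moves np uL closed pairs) (Clean-later later clean)
      where
      later : Later st (setAll L ss st)
      later = setAll-later {L = L} moves

    block : ∀ {cs} (B : Block st cs) → ChosenOne (Block.kinds B) ≤ BeforeAll (Block.kinds B) →
      Hits sols st cs → (∀ {α} → α ∈ sols → trues α cs ≤ 2) → Bounded st
    block B le hits atMost = branch unique st factor factor≢0 picks
      (λ α∈ agree → trues≤2 α∈ agree (hits α∈ agree) (atMost α∈))
      (subst₂ _≤_ (sym picks-value) (sym old-value) le)
      (λ m → let move , gain = picks-move m in next unique closed move gain)
      where open Block B

    trues-∷ : ∀ α a (cs : List (Fin n)) → trues α (a ∷ cs) ≤ suc (trues α cs)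
    trues-∷ α a cs with lookup α a
    ... | true  = ≤-refl
    ... | false = n≤1+n _

    go : Falsified sols st → Bounded st
    -- No solution is compatible, so a branching without children is enough.
    go (none hits) = branch {L = []} [] st 1 (λ ()) [] (λ {α} α∈ agree → contradiction (hits {α} α∈ agree) (λ ())) z≤n (λ ())
    go (unit {a} la hits) = block (extend C empty (λ ()) (λ ()) (λ ()) pairs)
      (subst (λ k → ChosenOne (k ∷ []) ≤ BeforeAll (k ∷ [])) (sym eq) (small (kindOf (st a)))) hits
      (λ {α} _ → ≤-trans (trues-∷ α a []) (s≤s z≤n))
      where
      C = proj₁ (cell-of pairs a (st a) refl la)
      eq = proj₂ (cell-of pairs a (st a) refl la)
      small : ∀ k → ChosenOne (k ∷ []) ≤ BeforeAll (k ∷ [])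
      small k = subst₂ _≤_ (r (Chosen k) (Missed k)) (sym (*-identityʳ _)) (choose₁ k)
        where
        r : ∀ a b → a ≡ a * 1 + b * 0
        r = solve-∀
    go (two {a} {b} a≢b la lb hits) with paired? (st a)
      where
      paired? : ∀ s → (s ≡ paired b) ⊎ (s ≢ paired b)
      paired? one      = inj₂ λ ()
      paired? dead     = inj₂ λ ()
      paired? half     = inj₂ λ ()
      paired? full     = inj₂ λ ()
      paired? fresh    = inj₂ λ ()
      paired? (paired w) with w ≟ᶠ b
      ... | yes refl = inj₁ refl
      ... | no w≢b   = inj₂ λ { refl → w≢b refl }
    -- The cells of two partners overlap, so pairs are treated directly: exactly one of them is
    -- true, at cost 2 · √6 / 4 against 1.199².
    ... | inj₁ eq = branch uL st 1 (λ ()) ((1 , one ∷ dead ∷ []) ∷ (1 , dead ∷ one ∷ []) ∷ []) pointwise values children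
      where
      open Pair (pairs eq)
      uL : Unique (a ∷ b ∷ [])
      uL = (a≢b ∷ []) ∷ [] ∷ []
      inj : ∀ {i j : Fin n} → paired i ≡ paired j → i ≡ j
      inj refl = refl
      closed : Closed st (a ∷ b ∷ [])
      closed = (λ { v e (_ ∷ v≢b ∷ []) → v≢b (inj (trans (sym e) eq)) }) ∷ (λ { v e (v≢a ∷ _) → v≢a (inj (trans (sym e) symmetric)) }) ∷ []
      children : ∀ {d ss} → (d , ss) ∈ ((1 , one ∷ dead ∷ []) ∷ (1 , dead ∷ one ∷ []) ∷ []) → Bounded (setAll (a ∷ b ∷ []) ss st)
      children (here refl) = next uL closed
        (mkMove (subst (_⇝ one) (sym eq) (λ ()) , subst (_⇝ dead) (sym symmetric) (λ ()) , tt) ((λ ()) , (λ ()) , tt))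
        (inj₁ (refl , λ e → contradiction (trans (sym e) eq) (λ ())))
      children (there (here refl)) = next uL closed
        (mkMove (subst (_⇝ dead) (sym eq) (λ ()) , subst (_⇝ one) (sym symmetric) (λ ()) , tt) ((λ ()) , (λ ()) , tt))
        (inj₂ (inj₁ (refl , λ e → contradiction (trans (sym e) symmetric) (λ ()))))
      exactly : ∀ {α} → lookup α a ≡ true → lookup α b ≡ false →
        1 * weightV α (a ∷ b ∷ []) (st a ∷ st b ∷ []) ≤
        1 * weightV α (a ∷ b ∷ []) (one ∷ dead ∷ []) + (1 * weightV α (a ∷ b ∷ []) (dead ∷ one ∷ []) + 0)
      exactly ta fb rewrite eq | symmetric | ta | fb = ≤-refl
      exactly′ : ∀ {α} → lookup α a ≡ false → lookup α b ≡ true →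
        1 * weightV α (a ∷ b ∷ []) (st a ∷ st b ∷ []) ≤
        1 * weightV α (a ∷ b ∷ []) (one ∷ dead ∷ []) + (1 * weightV α (a ∷ b ∷ []) (dead ∷ one ∷ []) + 0)
      exactly′ fa tb rewrite eq | symmetric | fa | tb = ≤-refl
      Splits : Assignment n → Set
      Splits α = 1 * weightV α (a ∷ b ∷ []) (st a ∷ st b ∷ []) ≤
        1 * weightV α (a ∷ b ∷ []) (one ∷ dead ∷ []) + (1 * weightV α (a ∷ b ∷ []) (dead ∷ one ∷ []) + 0)
      pointwise : ∀ {α} → α ∈ sols → Agree st α → Splits α
      pointwise {α} α∈ agree = cases (lookup α a) refl (lookup α b) refl
        where
        cases : ∀ p → lookup α a ≡ p → ∀ q → lookup α b ≡ q → Splits α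
        cases true  ta _     _  = exactly {α} ta (exclusive α∈ agree ta)
        cases false fa true  tb = exactly′ {α} fa tb
        cases false fa false fb = contradiction (hits α∈ agree) (impossible fa fb)
          where
          impossible : lookup α a ≡ false → lookup α b ≡ false → ¬ (1 ≤ trues α (a ∷ b ∷ []))
          impossible fa fb le rewrite fa | fb = contradiction le (λ ())
      values : 1 * valueV (one ∷ dead ∷ []) + (1 * valueV (dead ∷ one ∷ []) + 0) ≤ 1 * valueV (st a ∷ st b ∷ [])
      values = begin
        1 * valueV (one ∷ dead ∷ []) + (1 * valueV (dead ∷ one ∷ []) + 0) ≡⟨ r x y ⟩
        50 * (10000 * x) * y ≤⟨ *-monoˡ-≤ y (*-monoʳ-≤ 50 10⁴x≤24499y) ⟩
        50 * (24499 * y) * y ≡⟨ r′ 50 24499 y ⟩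
        50 * 24499 * (y * y) ≤⟨ *-monoˡ-≤ (y * y) (≤ᵇ⇒≤ (50 * 24499) (1199 * 1199) tt) ⟩
        1199 * 1199 * (y * y) ≡⟨ r″ 1199 y ⟩
        1 * valueV (paired b ∷ paired a ∷ []) ≡⟨ cong₂ (λ s t → 1 * valueV (s ∷ t ∷ [])) (sym eq) (sym symmetric) ⟩
        1 * valueV (st a ∷ st b ∷ []) ∎
        where
        open ≤-Reasoning
        r₀ : ∀ a b x y → 1 * (a * x * (b * y * 1)) + (1 * (b * y * (a * x * 1)) + 0) ≡ (2 * (a * b)) * (x * y)
        r₀ = solve-∀
        r₁ : ∀ a b x y → a * (b * x) * y ≡ (a * b) * (x * y)
        r₁ = solve-∀
        r : ∀ x y → 1 * (250 * x * (1000 * y * 1)) + (1 * (1000 * y * (250 * x * 1)) + 0) ≡ 50 * (10000 * x) * y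
        r x y = trans (r₀ 250 1000 x y) (sym (r₁ 50 10000 x y))
        r′ : ∀ a b y → a * (b * y) * y ≡ a * b * (y * y)
        r′ = solve-∀
        r″ : ∀ a y → a * a * (y * y) ≡ 1 * (a * y * (a * y * 1))
        r″ = solve-∀
    ... | inj₂ ne = block (extend Ca (extend Cb empty (λ ()) (λ ()) (λ ()) pairs)
            (λ { (here refl) e → a≢b (sym e) }) (λ { (here refl) e → ne (Pair.symmetric (pairs e)) }) (λ { (here refl) e → ne e }) pairs)
        (subst₂ (λ k l → ChosenOne (k ∷ l ∷ []) ≤ BeforeAll (k ∷ l ∷ [])) (sym ea) (sym eb) (small (kindOf (st a)) (kindOf (st b)))) hits
        (λ {α} _ → ≤-trans (trues-∷ α a (b ∷ [])) (s≤s (trues-∷ α b [])))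
      where
      Ca = proj₁ (cell-of pairs a (st a) refl la)
      ea = proj₂ (cell-of pairs a (st a) refl la)
      Cb = proj₁ (cell-of pairs b (st b) refl lb)
      eb = proj₂ (cell-of pairs b (st b) refl lb)
      small : ∀ k l → ChosenOne (k ∷ l ∷ []) ≤ BeforeAll (k ∷ l ∷ [])
      small k l = subst₂ _≤_ (r (Chosen k) (Missed k) (Chosen l) (Missed l)) (cong (Before k *_) (sym (*-identityʳ _))) (choose₂ k l)
        where
        r : ∀ a b c d → a * d + b * c ≡ a * (d * 1) + b * (c * 1 + d * 0)
        r = solve-∀
    -- No two of the variables are partners, since the third is live and pairs are isolated; hence
    -- the three cells are disjoint.
    go (three {a} {b} {c} a≢b a≢c b≢c la lb lc t hits) = block
        (extend Ca (extend Cb (extend Cc empty (λ ()) (λ ()) (λ ()) pairs)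
            (λ { (here refl) e → b≢c (sym e) })
            (λ { (here refl) e → Pair.isolated (pairs e) a a≢c a≢b (NAE-swap sols (NAE-rotate sols t)) la })
            (λ { (here refl) e → Pair.isolated (pairs e) a a≢b a≢c (NAE-rotate sols t) la }) pairs)
          (λ { (here refl) e → a≢b (sym e) ; (there (here refl)) e → a≢c (sym e) })
          (λ { (here refl) e → Pair.isolated (pairs e) c (b≢c ∘ sym) (a≢c ∘ sym) (NAE-swap sols t) lc
             ; (there (here refl)) e → Pair.isolated (pairs e) b b≢c (a≢b ∘ sym) (NAE-rotate sols (NAE-rotate sols t)) lb })
          (λ { (here refl) e → Pair.isolated (pairs e) c (a≢c ∘ sym) (b≢c ∘ sym) t lc
             ; (there (here refl)) e → Pair.isolated (pairs e) b (a≢b ∘ sym) b≢c (NAE-swap sols (NAE-rotate sols (NAE-rotate sols t))) lb }) pairs)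
        (subst (λ k → ChosenOne (k ∷ Cell.kind Cb ∷ Cell.kind Cc ∷ []) ≤ BeforeAll (k ∷ Cell.kind Cb ∷ Cell.kind Cc ∷ [])) (sym ea)
          (subst₂ (λ k l → ChosenOne (kindOf (st a) ∷ k ∷ l ∷ []) ≤ BeforeAll (kindOf (st a) ∷ k ∷ l ∷ [])) (sym eb) (sym ec)
            (small (kindOf (st a)) (kindOf (st b)) (kindOf (st c))
              (λ (ka , kb) → clean a≢b a≢c b≢c t (kind-new la ka) (kind-new lb kb) lc)
              (λ (ka , kc) → clean a≢c a≢b (b≢c ∘ sym) (NAE-swap sols (NAE-rotate sols (NAE-rotate sols t))) (kind-new la ka) (kind-new lc kc) lb)
              (λ (kb , kc) → clean b≢c (a≢b ∘ sym) (a≢c ∘ sym) (NAE-rotate sols t) (kind-new lb kb) (kind-new lc kc) la))))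
        hits atMost
      where
      Ca = proj₁ (cell-of pairs a (st a) refl la)
      ea = proj₂ (cell-of pairs a (st a) refl la)
      Cb = proj₁ (cell-of pairs b (st b) refl lb)
      eb = proj₂ (cell-of pairs b (st b) refl lb)
      Cc = proj₁ (cell-of pairs c (st c) refl lc)
      ec = proj₂ (cell-of pairs c (st c) refl lc)
      small : ∀ k l o → ¬ (k ≡ new × l ≡ new) → ¬ (k ≡ new × o ≡ new) → ¬ (l ≡ new × o ≡ new) →
        ChosenOne (k ∷ l ∷ o ∷ []) ≤ BeforeAll (k ∷ l ∷ o ∷ [])
      small k l o p q r = subst₂ _≤_ (s (Chosen k) (Missed k) (Chosen l) (Missed l) (Chosen o) (Missed o))
        (trans (*-assoc (Before k) _ _) (cong (λ z → Before k * (Before l * z)) (sym (*-identityʳ _)))) (choose₃ k l o p q r)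
        where
        s : ∀ c m c′ m′ c″ m″ → c * m′ * m″ + m * c′ * m″ + m * m′ * c″ ≡
          c * (m′ * (m″ * 1)) + m * (c′ * (m″ * 1) + m′ * (c″ * 1 + m″ * 0))
        s = solve-∀
      atMost : ∀ {α} → α ∈ sols → trues α (a ∷ b ∷ c ∷ []) ≤ 2
      atMost {α} α∈ with lookup α a | lookup α b | lookup α c | t α∈
      ... | true  | true  | true  | ()
      ... | true  | true  | false | _ = ≤-refl
      ... | true  | false | true  | _ = ≤-refl
      ... | true  | false | false | _ = s≤s z≤n
      ... | false | true  | true  | _ = ≤-refl
      ... | false | true  | false | _ = s≤s z≤n
      ... | false | false | true  | _ = s≤s z≤n
      ... | false | false | false | _ = z≤n

-- Explicit branchings for triangles and cherries

_⇒_ : Bool → Bool → Bool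
a ⇒ b = not a ∨ b

⇒-elim : ∀ {a b} → T (a ⇒ b) → T a → T b
⇒-elim {true} {true} _ _ = tt

allBits : ∀ k → (Vec Bool k → Bool) → Bool
allBits zero    p = p []
allBits (suc k) p = allBits k (λ bs → p (false ∷ bs)) ∧ allBits k (λ bs → p (true ∷ bs))

allBits-sound : ∀ {k} (p : Vec Bool k → Bool) → T (allBits k p) → ∀ bs → T (p bs)
allBits-sound p t []           = t
allBits-sound p t (false ∷ bs) = allBits-sound (λ bs → p (false ∷ bs)) (proj₁ (Equivalence.to T-∧ t)) bs
allBits-sound {suc k} p t (true ∷ bs) =
  allBits-sound (λ bs → p (true ∷ bs)) (proj₂ (Equivalence.to (T-∧ {allBits k (λ bs → p (false ∷ bs))}) t)) bs

bitWeight : ∀ {n k} → Vec (Status n) k → Vec Bool k → ℕ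
bitWeight []       []       = 1
bitWeight (s ∷ ss) (b ∷ bs) = weight₁ s b * bitWeight ss bs

-- `p` is the value of `one`, `q` a quarter of the value of `dead`, and `c` the value of a paired
-- variable. They are abstract so that the polynomial inequalities are not unfolded into the large
-- literals 250 and 1199.
module Gadgets {n} (sols : List (Assignment n)) (x y K : ℕ) (x>0 : 0 < x) (y>0 : 0 < y) (near : Near√6 x y)
  (p q c : ℕ) (p-def : p ≡ 250 * x) (q-def : q ≡ 250 * y) (c-def : c ≡ 1199 * y) where

  open Blocks sols x y K x>0 y>0 near public

  scaled : Status n → ℕ
  scaled one        = p
  scaled dead       = 4 * q
  scaled half       = 8 * q
  scaled full       = 5 * q
  scaled fresh      = 2 * p
  scaled (paired _) = c

  scaledV : ∀ {k} → Vec (Status n) k → ℕ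
  scaledV []       = 1
  scaledV (s ∷ ss) = scaled s * scaledV ss

  value≡scaled : ∀ s → value s ≡ scaled s
  value≡scaled one        = sym p-def
  value≡scaled dead       = trans (*-assoc 4 250 y) (cong (4 *_) (sym q-def))
  value≡scaled half       = trans (*-assoc 8 250 y) (cong (8 *_) (sym q-def))
  value≡scaled full       = trans (*-assoc 5 250 y) (cong (5 *_) (sym q-def))
  value≡scaled fresh      = trans (*-assoc 2 250 x) (cong (2 *_) (sym p-def))
  value≡scaled (paired _) = sym c-def

  valueV≡scaledV : ∀ {k} (ss : Vec (Status n) k) → valueV ss ≡ scaledV ss
  valueV≡scaledV []       = refl
  valueV≡scaledV (s ∷ ss) = cong₂ _*_ (value≡scaled s) (valueV≡scaledV ss)

  weightV≡bitWeight : ∀ {k} α (L : Vec (Fin n) k) ss → weightV α L ss ≡ bitWeight ss (Vec.map (lookup α) L)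
  weightV≡bitWeight α []      []       = refl
  weightV≡bitWeight α (i ∷ L) (s ∷ ss) = cong (weight₁ s (lookup α i) *_) (weightV≡bitWeight α L ss)

  localCheck : ∀ {k} → Vec (Status n) k → ℕ → List (Child k) → (Vec Bool k → Bool) → Bool
  localCheck {k} olds d children constraint = allBits k λ bs →
    constraint bs ⇒ (d * bitWeight olds bs ≤ᵇ sumBy children (λ (e , ss) → e * bitWeight ss bs))

  -- The weight comparison depends on a solution only through its bits on `L`, so it is checked by
  -- evaluation on all bit vectors that meet the constraint.
  gadget-branch : ∀ {k} {L : Vec (Fin n) k} → Unique L → (st : State n) (olds : Vec (Status n) k) → Vec.map st L ≡ olds →
    (d : ℕ) → d ≢ 0 → (children : List (Child k)) (constraint : Vec Bool k → Bool) →
    T (localCheck olds d children constraint) →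
    (∀ {α} → α ∈ sols → T (constraint (Vec.map (lookup α) L))) →
    sumBy children (λ (e , ss) → e * scaledV ss) ≤ d * scaledV olds →
    (∀ {e ss} → (e , ss) ∈ children → Bounded (setAll L ss st)) →
    Bounded st
  gadget-branch {L = L} uL st olds refl d d≢0 children constraint check holds values =
    branch uL st d d≢0 children
      (λ {α} α∈ _ → subst₂ _≤_ (cong (d *_) (sym (weightV≡bitWeight α L olds)))
        (sumBy-cong children (λ {(e , ss)} _ → cong (e *_) (sym (weightV≡bitWeight α L ss))))
        (≤ᵇ⇒≤ _ _ (⇒-elim (allBits-sound _ check (Vec.map (lookup α) L)) (holds α∈))))
      (subst₂ _≤_ (sumBy-cong children (λ {(e , ss)} _ → cong (e *_) (sym (valueV≡scaledV ss))))
        (cong (d *_) (sym (valueV≡scaledV olds))) values)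

  -- In the lists for cherries, the entries of a child belong to u, x, y, v, w in this order; they are followed by the petal
  -- of a third triple at u in exposeKids, and by the third vertex of a triple on x and y in outerKids.
  triKids : List (Child 3)
  triKids = (1 , one ∷ half ∷ half ∷ []) ∷ (1 , half ∷ one ∷ half ∷ []) ∷ (1 , half ∷ half ∷ one ∷ []) ∷ []

  -- If `u` is true, the rest stays undecided. If `u` is false, each of the three petals contains a
  -- true vertex; choosing one, half or half, one on a petal gives total weight 2 whether one or
  -- both vertices are true. The eight other children are the combinations of these choices.
  exposeKids : List (Child 7)
  exposeKids =
    (8 , one  ∷ full ∷ full ∷ full ∷ full ∷ fresh ∷ fresh ∷ []) ∷
    (1 , dead ∷ one  ∷ half ∷ one  ∷ half ∷ one  ∷ half ∷ []) ∷
    (1 , dead ∷ one  ∷ half ∷ one  ∷ half ∷ half ∷ one  ∷ []) ∷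
    (1 , dead ∷ one  ∷ half ∷ half ∷ one  ∷ one  ∷ half ∷ []) ∷
    (1 , dead ∷ one  ∷ half ∷ half ∷ one  ∷ half ∷ one  ∷ []) ∷
    (1 , dead ∷ half ∷ one  ∷ one  ∷ half ∷ one  ∷ half ∷ []) ∷
    (1 , dead ∷ half ∷ one  ∷ one  ∷ half ∷ half ∷ one  ∷ []) ∷
    (1 , dead ∷ half ∷ one  ∷ half ∷ one  ∷ one  ∷ half ∷ []) ∷
    (1 , dead ∷ half ∷ one  ∷ half ∷ one  ∷ half ∷ one  ∷ []) ∷ []

  -- If the petal x, y contains a true vertex, it is split into one, half and half, one. If not, the
  -- two triples through it force both `u` and the outer third vertex to be true.
  outerKids : List (Child 6)
  outerKids =
    (1 , fresh ∷ one  ∷ half ∷ fresh ∷ fresh ∷ half ∷ []) ∷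
    (1 , fresh ∷ half ∷ one  ∷ fresh ∷ fresh ∷ half ∷ []) ∷
    (2 , one   ∷ dead ∷ dead ∷ full  ∷ full  ∷ one  ∷ []) ∷ []

  -- The same idea when the further triple on x, y has its third vertex in the petal v, w: `d` and
  -- `e` are the statuses of v and w once x and y are false, with `one` at that third vertex.
  innerKids : Status n → Status n → List (Child 5)
  innerKids d e =
    (1 , fresh ∷ one  ∷ half ∷ fresh ∷ fresh ∷ []) ∷
    (1 , fresh ∷ half ∷ one  ∷ fresh ∷ fresh ∷ []) ∷
    (2 , one   ∷ dead ∷ dead ∷ d     ∷ e     ∷ []) ∷ []

  -- The first child covers a true center with v and w false entirely, and half of the cases with v
  -- or w true. The other six combine a choice from the triple u, x, y, with multiplicities 1, 2, 2,
  -- and a choice from the petal v, w; they cover a false center and the missing half.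
  pairKids : Fin n → Fin n → List (Child 5)
  pairKids i j =
    (4 , one  ∷ paired j ∷ paired i ∷ half ∷ half ∷ []) ∷
    (1 , one  ∷ half ∷ half ∷ one  ∷ half ∷ []) ∷
    (2 , half ∷ one  ∷ half ∷ one  ∷ half ∷ []) ∷
    (2 , half ∷ half ∷ one  ∷ one  ∷ half ∷ []) ∷
    (1 , one  ∷ half ∷ half ∷ half ∷ one  ∷ []) ∷
    (2 , half ∷ one  ∷ half ∷ half ∷ one  ∷ []) ∷
    (2 , half ∷ half ∷ one  ∷ half ∷ one  ∷ []) ∷ []

  private
    6qq≤pp : 6 * (q * q) ≤ p * p
    6qq≤pp = rescale 250 p q p-def q-def
      where
      rescale : ∀ a p q → p ≡ a * x → q ≡ a * y → 6 * (q * q) ≤ p * p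
      rescale a p q refl refl = subst₂ _≤_ (r a y) (r′ a x) (*-monoʳ-≤ (a * a) (Near√6.6yy≤xx near))
        where
        r : ∀ a y → a * a * (6 * (y * y)) ≡ 6 * (a * y * (a * y))
        r = solve-∀
        r′ : ∀ a x → a * a * (x * x) ≡ a * x * (a * x)
        r′ = solve-∀

    10⁴p≤24499q : 10000 * p ≤ 24499 * q
    10⁴p≤24499q = rescale 250 p q 10000 24499 p-def q-def (Near√6.10⁴x≤24499y near)
      where
      rescale : ∀ a p q m k → p ≡ a * x → q ≡ a * y → m * x ≤ k * y → m * p ≤ k * q
      rescale a p q m k refl refl le = subst₂ _≤_ (r a m x) (r a k y) (*-monoʳ-≤ a le)
        where
        r : ∀ a b x → a * (b * x) ≡ b * (a * x)
        r = solve-∀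

    cc : 62500 * (c * c) ≡ 1437601 * (q * q)
    cc = rescale 250 1199 c q 62500 1437601 c-def q-def refl refl
      where
      rescale : ∀ a b c q a² b² → c ≡ b * y → q ≡ a * y → a² ≡ a * a → b² ≡ b * b → a² * (c * c) ≡ b² * (q * q)
      rescale a b c q a² b² refl refl refl refl = r a b y
        where
        r : ∀ a b y → a * a * (b * y * (b * y)) ≡ b * b * (a * y * (a * y))
        r = solve-∀

    61q≤25p : 61 * q ≤ 25 * p
    61q≤25p = square-cancel (begin
      61 * q * (61 * q) ≡⟨ r 61 q ⟩
      61 * 61 * (q * q) ≤⟨ *-monoˡ-≤ (q * q) (≤ᵇ⇒≤ (61 * 61) (625 * 6) tt) ⟩
      625 * 6 * (q * q) ≡⟨ *-assoc 625 6 (q * q) ⟩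
      625 * (6 * (q * q)) ≤⟨ *-monoʳ-≤ 625 6qq≤pp ⟩
      625 * (p * p) ≡⟨ r′ 25 p ⟩
      25 * p * (25 * p) ∎)
      where
      open ≤-Reasoning
      r : ∀ a q → a * q * (a * q) ≡ a * a * (q * q)
      r = solve-∀
      r′ : ∀ a p → a * a * (p * p) ≡ a * p * (a * p)
      r′ = solve-∀

    tri-poly : ∀ p q → 6 * (q * q) ≤ p * p →
      1 * (p * (8 * q * (8 * q * 1))) + (1 * (8 * q * (p * (8 * q * 1))) + (1 * (8 * q * (8 * q * (p * 1))) + 0)) ≤
      4 * (2 * p * (2 * p * (2 * p * 1)))
    tri-poly p q le = subst₂ _≤_ (r p q) (r′ p) (*-monoʳ-≤ (32 * p) le)
      where
      r : ∀ p q → 32 * p * (6 * (q * q)) ≡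
        1 * (p * (8 * q * (8 * q * 1))) + (1 * (8 * q * (p * (8 * q * 1))) + (1 * (8 * q * (8 * q * (p * 1))) + 0))
      r = solve-∀
      r′ : ∀ p → 32 * p * (p * p) ≡ 4 * (2 * p * (2 * p * (2 * p * 1)))
      r′ = solve-∀

  tri-values : sumBy triKids (λ (e , ss) → e * scaledV ss) ≤ 4 * scaledV (fresh ∷ fresh ∷ fresh ∷ [])
  tri-values = tri-poly p q 6qq≤pp

  private
    36qqqq≤pppp : ∀ p q → 6 * (q * q) ≤ p * p → 36 * (q * q * (q * q)) ≤ p * p * (p * p)
    36qqqq≤pppp p q le = subst (_≤ p * p * (p * p)) (r q) (*-mono-≤ le le)
      where
      r : ∀ q → 6 * (q * q) * (6 * (q * q)) ≡ 36 * (q * q * (q * q))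
      r = solve-∀

    expose-poly : ∀ p q → 6 * (q * q) ≤ p * p → let f = 2 * p; h = 8 * q; d = 4 * q; g = 5 * q in
      8 * (p * (g * (g * (g * (g * (f * (f * 1))))))) +
      8 * (d * (p * h) * (p * h) * (p * h)) ≤ 8 * (f * (f * (f * (f * (f * (f * (f * 1)))))))
    expose-poly p q le = begin
      8 * (p * (5 * q * (5 * q * (5 * q * (5 * q * (2 * p * (2 * p * 1))))))) + 8 * (4 * q * (p * (8 * q)) * (p * (8 * q)) * (p * (8 * q)))
        ≡⟨ r p q ⟩
      p * p * p * (36384 * (q * q * (q * q))) ≤⟨ *-monoʳ-≤ (p * p * p) (*-monoˡ-≤ (q * q * (q * q)) (≤ᵇ⇒≤ 36384 (1024 * 36) tt)) ⟩
      p * p * p * (1024 * 36 * (q * q * (q * q))) ≡⟨ cong (p * p * p *_) (*-assoc 1024 36 (q * q * (q * q))) ⟩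
      p * p * p * (1024 * (36 * (q * q * (q * q)))) ≤⟨ *-monoʳ-≤ (p * p * p) (*-monoʳ-≤ 1024 (36qqqq≤pppp p q le)) ⟩
      p * p * p * (1024 * (p * p * (p * p))) ≡⟨ r′ p ⟩
      8 * (2 * p * (2 * p * (2 * p * (2 * p * (2 * p * (2 * p * (2 * p * 1))))))) ∎
      where
      open ≤-Reasoning
      r : ∀ p q → 8 * (p * (5 * q * (5 * q * (5 * q * (5 * q * (2 * p * (2 * p * 1))))))) +
        8 * (4 * q * (p * (8 * q)) * (p * (8 * q)) * (p * (8 * q))) ≡ p * p * p * (36384 * (q * q * (q * q)))
      r = solve-∀
      r′ : ∀ p → p * p * p * (1024 * (p * p * (p * p))) ≡ 8 * (2 * p * (2 * p * (2 * p * (2 * p * (2 * p * (2 * p * (2 * p * 1)))))))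
      r′ = solve-∀

  expose-values : sumBy exposeKids (λ (e , ss) → e * scaledV ss) ≤ 8 * scaledV (Vec.replicate 7 fresh)
  expose-values = subst (_≤ 8 * scaledV (Vec.replicate 7 fresh)) (cong (first +_) (merge p (8 * q) (4 * q)))
    (expose-poly p q 6qq≤pp)
    where
    first : ℕ
    first = 8 * scaledV (one ∷ full ∷ full ∷ full ∷ full ∷ fresh ∷ fresh ∷ [])
    merge : ∀ o h d → 8 * (d * (o * h) * (o * h) * (o * h)) ≡
      1 * (d * (o * (h * (o * (h * (o * (h * 1))))))) + (1 * (d * (o * (h * (o * (h * (h * (o * 1))))))) +
      (1 * (d * (o * (h * (h * (o * (o * (h * 1))))))) + (1 * (d * (o * (h * (h * (o * (h * (o * 1))))))) +
      (1 * (d * (h * (o * (o * (h * (o * (h * 1))))))) + (1 * (d * (h * (o * (o * (h * (h * (o * 1))))))) +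
      (1 * (d * (h * (o * (h * (o * (o * (h * 1))))))) + (1 * (d * (h * (o * (h * (o * (h * (o * 1))))))) + 0)))))))
    merge = solve-∀

  private
    -- With r = p / q this is A r² + B ≤ C r³. By r ≥ 61/25 the right side is at least 61 C r² / 25;
    -- the part D of 61 C that is left after 25 A pays for B by r² ≥ 6.
    cubic : ∀ p q A B C D → 6 * (q * q) ≤ p * p → 61 * q ≤ 25 * p → 25 * A + D ≡ 61 * C → 25 * B ≤ 6 * D →
      A * (p * p * q) + B * (q * q * q) ≤ C * (p * p * p)
    cubic p q A B C D le le′ num num′ = *-cancelˡ-≤ 25 (begin
      25 * (A * (p * p * q) + B * (q * q * q)) ≡⟨ r 25 A B p q ⟩
      25 * A * (p * p * q) + 25 * B * (q * q * q) ≤⟨ +-monoʳ-≤ (25 * A * (p * p * q)) (*-monoˡ-≤ (q * q * q) num′) ⟩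
      25 * A * (p * p * q) + 6 * D * (q * q * q) ≡⟨ cong (25 * A * (p * p * q) +_) (r′ 6 D q) ⟩
      25 * A * (p * p * q) + D * q * (6 * (q * q)) ≤⟨ +-monoʳ-≤ (25 * A * (p * p * q)) (*-monoʳ-≤ (D * q) le) ⟩
      25 * A * (p * p * q) + D * q * (p * p) ≡⟨ r″ (25 * A) D p q ⟩
      (25 * A + D) * (p * p * q) ≡⟨ cong (_* (p * p * q)) num ⟩
      61 * C * (p * p * q) ≡⟨ s 61 C p q ⟩
      C * (p * p) * (61 * q) ≤⟨ *-monoʳ-≤ (C * (p * p)) le′ ⟩
      C * (p * p) * (25 * p) ≡⟨ s′ 25 C p ⟩
      25 * (C * (p * p * p)) ∎)
      where
      open ≤-Reasoning
      r : ∀ k A B p q → k * (A * (p * p * q) + B * (q * q * q)) ≡ k * A * (p * p * q) + k * B * (q * q * q)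
      r = solve-∀
      r′ : ∀ k D q → k * D * (q * q * q) ≡ D * q * (k * (q * q))
      r′ = solve-∀
      r″ : ∀ A D p q → A * (p * p * q) + D * q * (p * p) ≡ (A + D) * (p * p * q)
      r″ = solve-∀
      s : ∀ k C p q → k * C * (p * p * q) ≡ C * (p * p) * (k * q)
      s = solve-∀
      s′ : ∀ k C p → C * (p * p) * (k * p) ≡ k * (C * (p * p * p))
      s′ = solve-∀

    outer-poly : ∀ p q → 6 * (q * q) ≤ p * p → 61 * q ≤ 25 * p → let f = 2 * p; h = 8 * q; d = 4 * q; g = 5 * q in
      1 * (f * (p * (h * (f * (f * (h * 1)))))) + (1 * (f * (h * (p * (f * (f * (h * 1)))))) +
        (2 * (p * (d * (d * (g * (g * (p * 1)))))) + 0)) ≤ 2 * (f * (f * (f * (f * (f * (h * 1))))))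
    outer-poly p q le le′ = subst₂ _≤_ (r p q) (r′ p q) (*-monoʳ-≤ (p * p * q) (cubic p q 1024 800 512 5632 le le′ refl (≤ᵇ⇒≤ (25 * 800) (6 * 5632) tt)))
      where
      r : ∀ p q → p * p * q * (1024 * (p * p * q) + 800 * (q * q * q)) ≡
        1 * (2 * p * (p * (8 * q * (2 * p * (2 * p * (8 * q * 1)))))) + (1 * (2 * p * (8 * q * (p * (2 * p * (2 * p * (8 * q * 1)))))) +
        (2 * (p * (4 * q * (4 * q * (5 * q * (5 * q * (p * 1)))))) + 0))
      r = solve-∀
      r′ : ∀ p q → p * p * q * (512 * (p * p * p)) ≡ 2 * (2 * p * (2 * p * (2 * p * (2 * p * (2 * p * (8 * q * 1))))))
      r′ = solve-∀

    inner-poly : ∀ p q → 6 * (q * q) ≤ p * p → 61 * q ≤ 25 * p → let f = 2 * p; h = 8 * q; d = 4 * q; g = 5 * q in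
      1 * (f * (p * (h * (f * (f * 1))))) + (1 * (f * (h * (p * (f * (f * 1))))) +
        (2 * (p * (d * (d * (p * (g * 1))))) + 0)) ≤ 2 * (f * (f * (f * (f * (f * 1)))))
    inner-poly p q le le′ = subst₂ _≤_ (r p q) (r′ p) (*-monoʳ-≤ (p * p) (cubic p q 128 160 64 704 le le′ refl (≤ᵇ⇒≤ (25 * 160) (6 * 704) tt)))
      where
      r : ∀ p q → p * p * (128 * (p * p * q) + 160 * (q * q * q)) ≡
        1 * (2 * p * (p * (8 * q * (2 * p * (2 * p * 1))))) + (1 * (2 * p * (8 * q * (p * (2 * p * (2 * p * 1))))) +
        (2 * (p * (4 * q * (4 * q * (p * (5 * q * 1))))) + 0))
      r = solve-∀
      r′ : ∀ p → p * p * (64 * (p * p * p)) ≡ 2 * (2 * p * (2 * p * (2 * p * (2 * p * (2 * p * 1)))))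
      r′ = solve-∀

    -- This bounds the value of a paired variable from above: at √6 it may be at most about 1.1992.
    pair-poly : ∀ p q c → 6 * (q * q) ≤ p * p → 10000 * p ≤ 24499 * q → 62500 * (c * c) ≡ 1437601 * (q * q) →
      let h = 8 * q; f = 2 * p in
      4 * (p * (c * (c * (h * (h * 1))))) + (1 * (p * (h * (h * (p * (h * 1))))) + (2 * (h * (p * (h * (p * (h * 1))))) +
        (2 * (h * (h * (p * (p * (h * 1))))) + (1 * (p * (h * (h * (h * (p * 1))))) + (2 * (h * (p * (h * (h * (p * 1))))) +
        (2 * (h * (h * (p * (h * (p * 1))))) + 0)))))) ≤ 16 * (f * (f * (f * (f * (f * 1)))))
    pair-poly p q c le le′ eq = subst₂ _≤_ (r p q c) (r′ p) (*-monoʳ-≤ p core)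
      where
      r : ∀ p q c → p * (256 * (c * c) * (q * q) + 5120 * p * (q * q * q)) ≡
        4 * (p * (c * (c * (8 * q * (8 * q * 1))))) + (1 * (p * (8 * q * (8 * q * (p * (8 * q * 1))))) +
        (2 * (8 * q * (p * (8 * q * (p * (8 * q * 1))))) + (2 * (8 * q * (8 * q * (p * (p * (8 * q * 1))))) +
        (1 * (p * (8 * q * (8 * q * (8 * q * (p * 1))))) + (2 * (8 * q * (p * (8 * q * (8 * q * (p * 1))))) +
        (2 * (8 * q * (8 * q * (p * (8 * q * (p * 1))))) + 0))))))
      r = solve-∀
      r′ : ∀ p → p * (512 * (p * p * (p * p))) ≡ 16 * (2 * p * (2 * p * (2 * p * (2 * p * (2 * p * 1)))))
      r′ = solve-∀
      open ≤-Reasoning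
      Q⁴ = q * q * (q * q)
      core : 256 * (c * c) * (q * q) + 5120 * p * (q * q * q) ≤ 512 * (p * p * (p * p))
      core = *-cancelˡ-≤ 62500 (begin
        62500 * (256 * (c * c) * (q * q) + 5120 * p * (q * q * q)) ≡⟨ s 62500 256 5120 (c * c) p q refl refl ⟩
        256 * (62500 * (c * c)) * (q * q) + 32000 * (10000 * p) * (q * q * q)
          ≤⟨ +-mono-≤ (≤-reflexive (cong (λ z → 256 * z * (q * q)) eq)) (*-monoˡ-≤ (q * q * q) (*-monoʳ-≤ 32000 le′)) ⟩
        256 * (1437601 * (q * q)) * (q * q) + 32000 * (24499 * q) * (q * q * q) ≡⟨ s′ 256 1437601 32000 24499 q ⟩
        (256 * 1437601 + 32000 * 24499) * Q⁴ ≤⟨ *-monoˡ-≤ Q⁴ (≤ᵇ⇒≤ (256 * 1437601 + 32000 * 24499) (32000000 * 36) tt) ⟩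
        32000000 * 36 * Q⁴ ≡⟨ *-assoc 32000000 36 Q⁴ ⟩
        32000000 * (36 * Q⁴) ≤⟨ *-monoʳ-≤ 32000000 (36qqqq≤pppp p q le) ⟩
        32000000 * (p * p * (p * p)) ≡⟨ s″ 62500 512 32000000 (p * p * (p * p)) refl ⟩
        62500 * (512 * (p * p * (p * p))) ∎)
        where
        t : ∀ N a b C M k p q → N * b ≡ M * k → N * (a * C * (q * q) + b * p * (q * q * q)) ≡ a * (N * C) * (q * q) + M * (k * p) * (q * q * q)
        t N a b C M k p q eq = trans (u N a b C p q) (trans (cong (λ z → a * (N * C) * (q * q) + z * p * (q * q * q)) eq) (v a N C M k p q))
          where
          u : ∀ N a b C p q → N * (a * C * (q * q) + b * p * (q * q * q)) ≡ a * (N * C) * (q * q) + N * b * p * (q * q * q)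
          u = solve-∀
          v : ∀ a N C M k p q → a * (N * C) * (q * q) + M * k * p * (q * q * q) ≡ a * (N * C) * (q * q) + M * (k * p) * (q * q * q)
          v = solve-∀
        s : ∀ N a b C p q → N ≡ 62500 → b ≡ 5120 → N * (a * C * (q * q) + b * p * (q * q * q)) ≡ a * (N * C) * (q * q) + 32000 * (10000 * p) * (q * q * q)
        s N a b C p q refl refl = t 62500 a 5120 C 32000 10000 p q refl
        s′ : ∀ a b m k q → a * (b * (q * q)) * (q * q) + m * (k * q) * (q * q * q) ≡ (a * b + m * k) * (q * q * (q * q))
        s′ = solve-∀
        s″ : ∀ a b m z → m ≡ a * b → m * z ≡ a * (b * z)
        s″ a b m z refl = *-assoc a b z

  outer-values : sumBy outerKids (λ (e , ss) → e * scaledV ss) ≤ 2 * scaledV (fresh ∷ fresh ∷ fresh ∷ fresh ∷ fresh ∷ half ∷ [])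
  outer-values = outer-poly p q 6qq≤pp 61q≤25p

  inner-values : sumBy (innerKids one full) (λ (e , ss) → e * scaledV ss) ≤ 2 * scaledV (Vec.replicate 5 fresh)
  inner-values = inner-poly p q 6qq≤pp 61q≤25p

  inner′-values : sumBy (innerKids full one) (λ (e , ss) → e * scaledV ss) ≤ 2 * scaledV (Vec.replicate 5 fresh)
  inner′-values = subst (_≤ 2 * scaledV (Vec.replicate 5 fresh))
    (cong (λ z → first + (second + (z + 0))) (flip p (4 * q) (5 * q))) inner-values
    where
    first second : ℕ
    first  = 1 * scaledV (fresh ∷ one  ∷ half ∷ fresh ∷ fresh ∷ [])
    second = 1 * scaledV (fresh ∷ half ∷ one  ∷ fresh ∷ fresh ∷ [])
    flip : ∀ o d g → 2 * (o * (d * (d * (o * (g * 1))))) ≡ 2 * (o * (d * (d * (g * (o * 1)))))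
    flip = solve-∀

  pair-values : ∀ i j → sumBy (pairKids i j) (λ (e , ss) → e * scaledV ss) ≤ 16 * scaledV (Vec.replicate 5 fresh)
  pair-values i j = pair-poly p q c 6qq≤pp 10⁴p≤24499q cc

-- Branching on the pieces of the family

-- A decidable goal is stable under double negation, so excluded middle may be used for an arbitrary
-- `P`.
by-cases : ∀ {P G : Set} → Dec G → (P → G) → (¬ P → G) → G
by-cases (yes g) _ _ = g
by-cases (no ¬g) f h = ⊥-elim (¬g (h (λ p → ¬g (f p))))

⇝-trans : ∀ {n} {s t r : Status n} → s ⇝ t → t ⇝ r → s ⇝ r
⇝-trans {s = one}      refl eq = eq
⇝-trans {s = dead}     refl eq = eq
⇝-trans {s = half}     st   tr = ⇝-settled tr st
⇝-trans {s = full}     ne   tr = λ eq → ne (⇝-fresh tr eq)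
⇝-trans {s = paired _} ne   tr = λ eq → ne (⇝-fresh tr eq)
⇝-trans {s = fresh}    _    _  = tt

setAll-lookup : ∀ {A : Set} {n k} {L : Vec (Fin n) k} → Unique L → ∀ (as : Vec A k) (f : Fin n → A) i →
  setAll L as f (lookup L i) ≡ lookup as i
setAll-lookup {L = j ∷ L} (_ ∷ uL)   (a ∷ as) f zero    = updateAt-updates j (setAll L as f)
setAll-lookup {L = j ∷ L} (j∉L ∷ uL) (a ∷ as) f (suc i) = trans
  (updateAt-minimal (lookup L i) j (setAll L as f) (λ eq → VAll.lookup j∉L (∈-lookup i L) (sym eq))) (setAll-lookup uL as f i)

-- cherry u x y v w stands for the two triples u x y and u v w, which share the center u and have the petals x y and v w.
data Piece (n : ℕ) : Set where
  triangle : (a b c : Fin n) → Piece n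
  cherry   : (u x y v w : Fin n) → Piece n

corners : ∀ {n} → Piece n → List (Fin n)
corners (triangle a b c)   = a ∷ b ∷ c ∷ []
corners (cherry u x y v w) = u ∷ x ∷ y ∷ v ∷ w ∷ []

covered : ∀ {n} → List (Piece n) → List (Fin n)
covered = concatMap corners

corner∈covered : ∀ {n} {s : Piece n} {ps i} → s ∈ ps → i ∈ corners s → i ∈ covered ps
corner∈covered (here refl)              i∈ = ∈-++⁺ˡ i∈
corner∈covered {ps = p ∷ _} (there s∈) i∈ = ∈-++⁺ʳ (corners p) (corner∈covered s∈ i∈)

covered-↭ : ∀ {n} {ps qs : List (Piece n)} → ps ↭ qs → covered ps ↭ covered qs
covered-↭ Perm.refl                = ↭-refl
covered-↭ (prep p ps↭qs)      = ++⁺ˡ (corners p) (covered-↭ ps↭qs)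
covered-↭ (swap p q ps↭qs)    = ↭-trans (shifts (corners p) (corners q)) (++⁺ˡ (corners q) (++⁺ˡ (corners p) (covered-↭ ps↭qs)))
covered-↭ (Perm.trans ps↭qs qs↭rs) = ↭-trans (covered-↭ ps↭qs) (covered-↭ qs↭rs)

bring-to-front : ∀ {A : Set} {a : A} {as} → a ∈ as → ∃ λ bs → as ↭ a ∷ bs
bring-to-front a∈ with ∈-∃++ a∈
... | bs , cs , refl = bs ++ cs , shift _ bs cs

-- Maximality of the family enters through `outer-nae` and `petal-nae`: the first locates the
-- triples that could remain harmful, the second the further triples through a petal.
module Process {n} (sols : List (Assignment n)) (x y K : ℕ) (x>0 : 0 < x) (y>0 : 0 < y) (near : Near√6 x y)
  (p q c : ℕ) (p-def : p ≡ 250 * x) (q-def : q ≡ 250 * y) (c-def : c ≡ 1199 * y)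
  (finished : ∀ st → PairsOK sols st → Clean sols st → Weighted.Bounded sols x y K x>0 y>0 st)
  (family : List (Piece n))
  (triangle-nae : ∀ {a b c} → triangle a b c ∈ family → NAE sols a b c)
  (cherry-nae : ∀ {u x y v w} → cherry u x y v w ∈ family → NAE sols u x y × NAE sols u v w)
  (outer-nae : ∀ {a b c} → a ≢ b → a ≢ c → b ≢ c → NAE sols a b c → a ∉ covered family → b ∉ covered family →
    ∃ λ x → ∃ λ y → ∃ λ v → ∃ λ w → cherry c x y v w ∈ family)
  (petal-nae : ∀ {u x y v w z} → cherry u x y v w ∈ family → z ≢ x → z ≢ y → NAE sols x y z →
    z ≡ u ⊎ z ≡ v ⊎ z ≡ w ⊎ (∃ λ a → ∃ λ b → ∃ λ c → triangle a b c ∈ family × z ∈ corners (triangle a b c)) ⊎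
    (∃ λ x′ → ∃ λ y′ → ∃ λ v′ → ∃ λ w′ → cherry z x′ y′ v′ w′ ∈ family))
  where

  open Gadgets sols x y K x>0 y>0 near p q c p-def q-def c-def

  Out : Fin n → Set
  Out i = i ∉ covered family

  -- Excludes a third petal at `u` made of fresh vertices outside the family. The condition is void
  -- for a decided center, so it needs care only if the center ends up `half`.
  Tame : State n → Fin n → Set
  Tame st u = ∀ {r t} → r ≢ t → Out r → Out t → NAE sols u r t → st r ≡ fresh → st t ≡ fresh → ¬ Live (st u)

  Resolved : State n → Piece n → Set
  Resolved st (triangle a b c)   = Settled (st a) × Settled (st b) × Settled (st c)
  Resolved st (cherry u _ _ _ _) = Settled (st u) × Tame st u

  Tame-later : ∀ {st st′} u → Later st st′ → Tame st u → Tame st′ u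
  Tame-later u later tame r≢t r-out t-out t fr ft live =
    tame r≢t r-out t-out t (⇝-fresh (later _) fr) (⇝-fresh (later _) ft) (⇝-live (later u) live)

  Resolved-later : ∀ {st st′} s → Later st st′ → Resolved st s → Resolved st′ s
  Resolved-later (triangle a b c)   later (sa , sb , sc) =
    ⇝-settled (later a) sa , ⇝-settled (later b) sb , ⇝-settled (later c) sc
  Resolved-later (cherry u _ _ _ _) later (su , tame) = ⇝-settled (later u) su , Tame-later u later tame

  -- By `outer`, a processed piece leaves no fresh corner, so once nothing is left every fresh
  -- variable is outside the family.
  record Inv (rest : List (Piece n)) (st : State n) : Set where
    field
      known    : ∀ {s} → s ∈ rest → s ∈ family
      disjoint : List.Unique (covered rest)
      intact   : ∀ {i} → i ∈ covered rest → st i ≡ fresh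
      outer    : ∀ {i} → st i ≡ fresh → Out i ⊎ i ∈ covered rest
      resolved : ∀ {s} → s ∈ family → s ∈ rest ⊎ Resolved st s
      pairs    : PairsOK sols st

  Inv-↭ : ∀ {rest rest′ st} → rest ↭ rest′ → Inv rest st → Inv rest′ st
  Inv-↭ perm inv = record
    { known    = λ s∈ → I.known (∈-resp-↭ (↭-sym perm) s∈)
    ; disjoint = Unique-resp-↭ (setoid (Fin n)) (↭⇒↭ₛ (covered-↭ perm)) I.disjoint
    ; intact   = λ i∈ → I.intact (∈-resp-↭ (↭-sym (covered-↭ perm)) i∈)
    ; outer    = λ f → [ inj₁ , (λ i∈ → inj₂ (∈-resp-↭ (covered-↭ perm) i∈)) ]′ (I.outer f)
    ; resolved = λ s∈ → [ (λ i∈ → inj₁ (∈-resp-↭ perm i∈)) , inj₂ ]′ (I.resolved s∈)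
    ; pairs    = I.pairs
    }
    where module I = Inv inv

  advance : ∀ done {rest st st′} → Inv (done ++ rest) st → Later st st′ →
    (∀ {i} → i ∈ covered rest → st′ i ≡ st i) → (∀ {i} → i ∈ covered done → st′ i ≢ fresh) →
    (∀ {s} → s ∈ done → Resolved st′ s) → PairsOK sols st′ → Inv rest st′
  advance done {rest} inv later same used res pairs = record
    { known    = I.known ∘ ∈-++⁺ʳ done
    ; disjoint = drop (covered done) (subst List.Unique (covered-++ done) I.disjoint)
    ; intact   = λ {i} i∈ → trans (same i∈) (I.intact (subst (i ∈_) (sym (covered-++ done)) (∈-++⁺ʳ (covered done) i∈)))
    ; outer    = λ {i} f → [ inj₁ , (λ i∈ → [ (λ i∈s → contradiction f (used i∈s)) , inj₂ ]′
                              (∈-++⁻ (covered done) (subst (i ∈_) (covered-++ done) i∈))) ]′ (I.outer (⇝-fresh (later i) f))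
    ; resolved = λ {t} t∈ → [ (λ t∈′ → [ inj₂ ∘ res , inj₁ ]′ (∈-++⁻ done t∈′)) , inj₂ ∘ Resolved-later t later ]′ (I.resolved t∈)
    ; pairs    = pairs
    }
    where
    module I = Inv inv
    covered-++ : ∀ ps → covered (ps ++ rest) ≡ covered ps ++ covered rest
    covered-++ ps = concatMap-++ corners ps rest
    drop : ∀ {A : Set} (as : List A) {bs} → List.Unique (as ++ bs) → List.Unique bs
    drop []       u       = u
    drop (_ ∷ as) (_ ∷ u) = drop as u

  AllFresh : ∀ {k} → State n → Vec (Fin n) k → Set
  AllFresh st = VAll.All (λ j → st j ≡ fresh)

  free-moves : ∀ {k} {L : Vec (Fin n) k} {st : State n} → AllFresh st L → ∀ ss → Zip (λ j s → st j ⇝ s) L ss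
  free-moves []       []       = tt
  free-moves (f ∷ fs) (s ∷ ss) = subst (_⇝ s) (sym f) tt , free-moves fs ss

  unpaired? : Status n → Bool
  unpaired? (paired _) = false
  unpaired? _          = true

  allUnpaired : ∀ {k} → Vec (Status n) k → Bool
  allUnpaired []       = true
  allUnpaired (s ∷ ss) = unpaired? s ∧ allUnpaired ss

  unpaired-sound : ∀ {k} {L : Vec (Fin n) k} (ss : Vec (Status n) k) → T (allUnpaired ss) → Zip (λ _ → NotPaired sols) L ss
  unpaired-sound {L = []}    []       _ = tt
  unpaired-sound {L = _ ∷ _} (s ∷ ss) t with Equivalence.to (T-∧ {unpaired? s}) t
  ... | t₁ , t₂ = notPaired s t₁ , unpaired-sound ss t₂
    where
    notPaired : ∀ s → T (unpaired? s) → NotPaired sols s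
    notPaired (paired _) ()
    notPaired one        _ ()
    notPaired dead       _ ()
    notPaired half       _ ()
    notPaired full       _ ()
    notPaired fresh      _ ()

  fresh-pairs : ∀ {k} {L : Vec (Fin n) k} (ss : Vec (Status n) k) {st : State n} → AllFresh st L → Unique L → T (allUnpaired ss) →
    PairsOK sols st → PairsOK sols (setAll L ss st)
  fresh-pairs {L = L} ss fs uL t =
    PairsOK-setAll sols (free-moves fs ss) (unpaired-sound ss t) uL
      (VAll.map (λ f v e → contradiction (trans (sym f) e) (λ ())) fs)

  map-fresh : ∀ {k} {L : Vec (Fin n) k} {st : State n} → AllFresh st L → Vec.map st L ≡ Vec.replicate k fresh
  map-fresh []       = refl
  map-fresh (f ∷ fs) = cong₂ _∷_ f (map-fresh fs)

  nae-T : ∀ {a b c α} → NAE sols a b c → α ∈ sols → T (nae (lookup α a) (lookup α b) (lookup α c))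
  nae-T t α∈ = Equivalence.from T-≡ (t α∈)

  triangle-step : ∀ {a b c} {st : State n} → Unique (a ∷ b ∷ c ∷ []) → NAE sols a b c → AllFresh st (a ∷ b ∷ c ∷ []) →
    (∀ {e ss} → (e , ss) ∈ triKids → Bounded (setAll (a ∷ b ∷ c ∷ []) ss st)) → Bounded st
  triangle-step {st = st} uL t fs = gadget-branch uL st (fresh ∷ fresh ∷ fresh ∷ []) (map-fresh fs) 4 (λ ()) triKids
    (λ { (a ∷ b ∷ c ∷ []) → nae a b c }) tt (λ {α} → nae-T t) tri-values

  covered⇒known : ∀ {rest i} → (∀ {s} → s ∈ rest → s ∈ family) → i ∈ covered rest → i ∈ covered family
  covered⇒known {s ∷ rest} known i∈ with ∈-++⁻ (corners s) i∈
  ... | inj₁ i∈s = corner∈covered (known (here refl)) i∈s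
  ... | inj₂ i∈r = covered⇒known {rest} (known ∘ there) i∈r

  -- Serves a triangle of the family, the second triple of a cherry whose petal x, y is already
  -- decided, and the same situation when a second cherry is completed together with it; hence
  -- `done` is a list.
  finish-triangle : ∀ done {rest st st₁ u v w} → Inv (done ++ rest) st →
    Unique (u ∷ v ∷ w ∷ []) → NAE sols u v w → AllFresh st₁ (u ∷ v ∷ w ∷ []) →
    Later st st₁ → (∀ {i} → i ∈ covered rest → st₁ i ≡ st i) → PairsOK sols st₁ →
    (∀ {i} → i ∈ covered done → i ≡ u ⊎ i ≡ v ⊎ i ≡ w ⊎ st₁ i ≢ fresh) →
    (∀ {i} → i ∈ covered rest → Outside i (u ∷ v ∷ w ∷ [])) →
    (∀ {st₂} → Later st₁ st₂ → Settled (st₂ u) → Settled (st₂ v) → Settled (st₂ w) → ∀ {s} → s ∈ done → Resolved st₂ s) →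
    (∀ st₂ → Inv rest st₂ → Bounded st₂) → Bounded st₁
  finish-triangle done {rest} {st} {st₁} {u} {v} {w} inv uL t fs later same pairs used outside res continue =
    triangle-step uL t fs (λ {e} {ss} m → continue _ (after ss (property m)))
    where
    L = u ∷ v ∷ w ∷ []
    property : ∀ {e ss} → (e , ss) ∈ triKids → T (allUnpaired ss) × VAll.All Settled ss
    property (here refl)                 = tt , one ∷ half ∷ half ∷ []
    property (there (here refl))         = tt , half ∷ one ∷ half ∷ []
    property (there (there (here refl))) = tt , half ∷ half ∷ one ∷ []
    settled≢fresh : ∀ {s : Status n} → Settled s → s ≢ fresh
    settled≢fresh one  ()
    settled≢fresh dead ()
    settled≢fresh half ()
    after : ∀ ss → T (allUnpaired ss) × VAll.All Settled ss → Inv rest (setAll L ss st₁)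
    after ss (unp , settled) = advance done inv (λ j → ⇝-trans (later j) (later₂ j))
      (λ i∈ → trans (setAll-outside L ss st₁ (outside i∈)) (same i∈))
      used₂ (res later₂ (at zero) (at (suc zero)) (at (# 2))) (fresh-pairs ss fs uL unp pairs)
      where
      later₂ : Later st₁ (setAll L ss st₁)
      later₂ = setAll-later {L = L} (free-moves fs ss)
      at : ∀ k → Settled (setAll L ss st₁ (lookup L k))
      at k = subst Settled (sym (setAll-lookup uL ss st₁ k)) (VAll.lookup settled (∈-lookup k ss))
      used₂ : ∀ {i} → i ∈ covered done → setAll L ss st₁ i ≢ fresh
      used₂ i∈ with used i∈
      ... | inj₁ refl = settled≢fresh (at zero)
      ... | inj₂ (inj₁ refl) = settled≢fresh (at (suc zero))
      ... | inj₂ (inj₂ (inj₁ refl)) = settled≢fresh (at (# 2))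
      ... | inj₂ (inj₂ (inj₂ ne)) = λ f → ne (⇝-fresh (later₂ _) f)

  expose-step : ∀ {u x y v w r t} {st : State n} → Unique (u ∷ x ∷ y ∷ v ∷ w ∷ r ∷ t ∷ []) →
    AllFresh st (u ∷ x ∷ y ∷ v ∷ w ∷ r ∷ t ∷ []) →
    NAE sols u x y → NAE sols u v w → NAE sols u r t →
    (∀ {e ss} → (e , ss) ∈ exposeKids → Bounded (setAll (u ∷ x ∷ y ∷ v ∷ w ∷ r ∷ t ∷ []) ss st)) → Bounded st
  expose-step {st = st} uL fs nae₁ nae₂ nae₃ =
    gadget-branch uL st (Vec.replicate 7 fresh) (map-fresh fs) 8 (λ ()) exposeKids
      (λ { (a ∷ b ∷ c ∷ d ∷ e ∷ f ∷ g ∷ []) → nae a b c ∧ nae a d e ∧ nae a f g }) tt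
      (λ {α} α∈ → Equivalence.from T-∧ (nae-T nae₁ α∈ , Equivalence.from T-∧ (nae-T nae₂ α∈ , nae-T nae₃ α∈)))
      expose-values

  used? : Status n → Bool
  used? fresh = false
  used? _     = true

  used-sound : ∀ {s} → T (used? s) → s ≢ fresh
  used-sound {fresh} () _

  -- A center that becomes `one` or `dead` is harmless afterwards; it may become `half` only if it
  -- is tame.
  center? : Bool → Status n → Bool
  center? tame one  = true
  center? tame dead = true
  center? tame half = tame
  center? tame _    = false

  center-sound : ∀ {tame s} → T (center? tame s) → Settled s × (Live s → T tame)
  center-sound {s = one}  _ = one , λ live → contradiction refl (proj₁ live)
  center-sound {s = dead} _ = dead , λ live → contradiction refl (proj₂ live)
  center-sound {s = half} t = half , λ _ → t

  leaf? : ∀ {k} → Bool → Vec (Status n) (5 + k) → Bool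
  leaf? tame (a ∷ b ∷ c ∷ d ∷ e ∷ ss) =
    center? tame a ∧ used? b ∧ used? c ∧ used? d ∧ used? e

  module Cherry {u x y v w rest st} (inv : Inv (cherry u x y v w ∷ rest) st) where
    module I = Inv inv

    corner : ∀ {i} → i ∈ corners (cherry u x y v w) → i ∈ covered (cherry u x y v w ∷ rest)
    corner = ∈-++⁺ˡ

    all-fresh : AllFresh st (u ∷ x ∷ y ∷ v ∷ w ∷ [])
    all-fresh = I.intact (here refl) ∷ I.intact (there (here refl)) ∷ I.intact (there (there (here refl))) ∷
      I.intact (there (there (there (here refl)))) ∷ I.intact (there (there (there (there (here refl))))) ∷ []

    unique : Unique (u ∷ x ∷ y ∷ v ∷ w ∷ [])
    unique with I.disjoint
    ... | (ux ∷ uy ∷ uv ∷ uw ∷ _) ∷ (xy ∷ xv ∷ xw ∷ _) ∷ (yv ∷ yw ∷ _) ∷ (vw ∷ _) ∷ _ ∷ _ =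
      (ux ∷ uy ∷ uv ∷ uw ∷ []) ∷ (xy ∷ xv ∷ xw ∷ []) ∷ (yv ∷ yw ∷ []) ∷ (vw ∷ []) ∷ [] ∷ []

    outside : ∀ {i} → i ∈ covered rest → Outside i (u ∷ x ∷ y ∷ v ∷ w ∷ [])
    outside i∈ with I.disjoint
    ... | (_ ∷ _ ∷ _ ∷ _ ∷ us) ∷ (_ ∷ _ ∷ _ ∷ xs) ∷ (_ ∷ _ ∷ ys) ∷ (_ ∷ vs) ∷ ws ∷ _ =
      (All.lookup us i∈ ∘ sym) ∷ (All.lookup xs i∈ ∘ sym) ∷ (All.lookup ys i∈ ∘ sym) ∷
      (All.lookup vs i∈ ∘ sym) ∷ (All.lookup ws i∈ ∘ sym) ∷ []

    in-family : cherry u x y v w ∈ family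
    in-family = I.known (here refl)

    nae₁ : NAE sols u x y
    nae₁ = proj₁ (cherry-nae in-family)

    nae₂ : NAE sols u v w
    nae₂ = proj₂ (cherry-nae in-family)

    out≢ : ∀ {i r} → i ∈ covered (cherry u x y v w ∷ rest) → Out r → i ≢ r
    out≢ i∈ r-out refl = r-out (covered⇒known I.known i∈)

    leaf : ∀ {k} {L : Vec (Fin n) k} tame → (T tame → Tame st u) → Unique (u ∷ x ∷ y ∷ v ∷ w ∷ L) →
      ∀ ss → (∀ {i} → i ∈ covered rest → setAll (u ∷ x ∷ y ∷ v ∷ w ∷ L) ss st i ≡ st i) →
      Zip (λ j s → st j ⇝ s) (u ∷ x ∷ y ∷ v ∷ w ∷ L) ss → T (leaf? tame ss) →
      PairsOK sols (setAll (u ∷ x ∷ y ∷ v ∷ w ∷ L) ss st) → Inv rest (setAll (u ∷ x ∷ y ∷ v ∷ w ∷ L) ss st)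
    leaf {L = L} tame tame-u uL ss@(a ∷ b ∷ c ∷ d ∷ e ∷ _) same moves ok pairs =
      advance (cherry u x y v w ∷ []) inv later same used
        (λ { (here refl) → settled , λ r≢t r-out t-out t fr ft live →
               Tame-later u later (tame-u (live⇒tame live)) r≢t r-out t-out t fr ft live }) pairs
      where
      L′ = u ∷ x ∷ y ∷ v ∷ w ∷ L
      later : Later st (setAll L′ ss st)
      later = setAll-later {L = L′} moves
      parts = Equivalence.to (T-∧ {center? tame a}) ok
      parts₂ = Equivalence.to (T-∧ {used? b}) (proj₂ parts)
      parts₃ = Equivalence.to (T-∧ {used? c}) (proj₂ parts₂)
      parts₄ = Equivalence.to (T-∧ {used? d}) (proj₂ parts₃)
      at : ∀ k → setAll L′ ss st (lookup L′ k) ≡ lookup ss k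
      at = setAll-lookup uL ss st
      center : Settled a × (Live a → T tame)
      center = center-sound {tame} (proj₁ parts)
      settled : Settled (setAll L′ ss st u)
      settled = subst Settled (sym (at zero)) (proj₁ center)
      live⇒tame : Live (setAll L′ ss st u) → T tame
      live⇒tame live = proj₂ center (subst Live (at zero) live)
      used : ∀ {i} → i ∈ covered (cherry u x y v w ∷ []) → setAll L′ ss st i ≢ fresh
      used (here refl) eq with subst Settled eq settled
      ... | ()
      used (there (here refl)) eq = used-sound (proj₁ parts₂) (trans (sym (at (suc zero))) eq)
      used (there (there (here refl))) eq = used-sound (proj₁ parts₃) (trans (sym (at (# 2))) eq)
      used (there (there (there (here refl)))) eq = used-sound (proj₁ parts₄) (trans (sym (at (# 3))) eq)
      used (there (there (there (there (here refl))))) eq = used-sound (proj₂ parts₄) (trans (sym (at (# 4))) eq)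

    Continue : List (Piece n) → Set
    Continue ps = ∀ st′ → Inv ps st′ → Bounded st′

    -- A center with a third fresh petal cannot be left live. Three petals make it affordable to
    -- decide it outright: in every child it is `one` or `dead`.
    expose-outer : ∀ {r t} → r ≢ t → Out r → Out t → NAE sols u r t → st r ≡ fresh → st t ≡ fresh → Continue rest → Bounded st
    expose-outer {r} {t} r≢t r-out t-out nae₃ fr ft continue =
      expose-step uL fs nae₁ nae₂ nae₃
        (λ {e} {ss} m → let ok , unp = All.lookup good m in
          continue _ (leaf {L = r ∷ t ∷ []} false (λ ()) uL ss (λ i∈ → setAll-outside L ss st (out i∈)) (free-moves fs ss) ok (fresh-pairs ss fs uL unp I.pairs)))
      where
      L = u ∷ x ∷ y ∷ v ∷ w ∷ r ∷ t ∷ []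
      fs : AllFresh st L
      fs = All-++⁺ all-fresh (fr ∷ ft ∷ [])
      uL : Unique L
      uL = AllPairs-++⁺ unique ((r≢t ∷ []) ∷ [] ∷ [])
        (both (here refl) ∷ both (there (here refl)) ∷ both (there (there (here refl))) ∷
         both (there (there (there (here refl)))) ∷ both (there (there (there (there (here refl))))) ∷ [])
        where
        both : ∀ {i} → i ∈ corners (cherry u x y v w) → VAll.All (i ≢_) (r ∷ t ∷ [])
        both i∈ = out≢ (corner i∈) r-out ∷ out≢ (corner i∈) t-out ∷ []
      out : ∀ {i} → i ∈ covered rest → Outside i L
      out i∈ = All-++⁺ (outside i∈) (out≢ (∈-++⁺ʳ (corners (cherry u x y v w)) i∈) r-out ∷ out≢ (∈-++⁺ʳ (corners (cherry u x y v w)) i∈) t-out ∷ [])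
      good : All (λ (e , ss) → T (leaf? false ss) × T (allUnpaired ss)) exposeKids
      good = (tt , tt) ∷ (tt , tt) ∷ (tt , tt) ∷ (tt , tt) ∷ (tt , tt) ∷ (tt , tt) ∷ (tt , tt) ∷ (tt , tt) ∷ (tt , tt) ∷ []

    plain-leaf : ∀ tame → (T tame → Tame st u) → ∀ ss → T (leaf? tame ss) →
      PairsOK sols (setAll (u ∷ x ∷ y ∷ v ∷ w ∷ []) ss st) → Inv rest (setAll (u ∷ x ∷ y ∷ v ∷ w ∷ []) ss st)
    plain-leaf tame tame-u ss = leaf {L = []} tame tame-u unique ss
      (λ i∈ → setAll-outside (u ∷ x ∷ y ∷ v ∷ w ∷ []) ss st (outside i∈)) (free-moves all-fresh ss)

    paired-outside : ∀ {a b} → st a ≡ paired b → Outside a (u ∷ x ∷ y ∷ v ∷ w ∷ [])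
    paired-outside eq = VAll.map (λ { f refl → contradiction (trans (sym f) eq) (λ ()) }) all-fresh

    -- No live vertex other than the center forms a triple with x and y, so these become a valid
    -- pair once the center is true. With `full` in place of `paired` the same branching would
    -- exceed its budget.
    pair-step : Tame st u → (∀ z → z ≢ u → z ≢ x → z ≢ y → NAE sols x y z → ¬ Live (st z)) → Continue rest → Bounded st
    pair-step tame isolated continue =
      gadget-branch unique st (Vec.replicate 5 fresh) (map-fresh all-fresh) 16 (λ ()) (pairKids x y)
        (λ { (a ∷ b ∷ c ∷ d ∷ e ∷ []) → nae a b c ∧ nae a d e }) tt
        (λ {α} α∈ → Equivalence.from T-∧ (nae-T nae₁ α∈ , nae-T nae₂ α∈)) (pair-values x y) kids
      where
      L = u ∷ x ∷ y ∷ v ∷ w ∷ []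
      ss₀ = one ∷ paired y ∷ paired x ∷ half ∷ half ∷ []
      st₀ = setAll L ss₀ st
      later₀ : Later st st₀
      later₀ = setAll-later {L = L} (free-moves all-fresh ss₀)
      at : ∀ k → st₀ (lookup L k) ≡ lookup ss₀ k
      at = setAll-lookup unique ss₀ st
      paired-injective : ∀ {i j : Fin n} → paired i ≡ paired j → i ≡ j
      paired-injective refl = refl
      x≢y : x ≢ y
      x≢y with unique
      ... | _ ∷ (ne ∷ _) ∷ _ = ne
      not-live : ∀ z → z ≢ x → z ≢ y → NAE sols x y z → ¬ Live (st₀ z)
      not-live z z≢x z≢y t live with z ≟ᶠ u
      -- The triple of the cherry itself does not disturb isolation, since its center is now `one`.
      ... | yes refl = proj₁ live (at zero)
      ... | no z≢u   = isolated z z≢u z≢x z≢y t (⇝-live (later₀ z) live)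
      center-true : ∀ {α} → Agree st₀ α → lookup α u ≡ true
      center-true {α} agree with lookup α u | subst (λ s → Compatible s (lookup α u)) (at zero) (agree u)
      ... | true  | _ = refl
      ... | false | nz = contradiction refl nz
      not-both : ∀ a b → nae true a b ≡ true → a ≡ true → b ≡ false
      not-both true false _ _ = refl
      excl-x : ∀ {α} → α ∈ sols → Agree st₀ α → lookup α x ≡ true → lookup α y ≡ false
      excl-x {α} α∈ agree = not-both _ _ (subst (λ b → nae b (lookup α x) (lookup α y) ≡ true) (center-true {α} agree) (nae₁ α∈))
      excl-y : ∀ {α} → α ∈ sols → Agree st₀ α → lookup α y ≡ true → lookup α x ≡ false
      excl-y {α} α∈ agree ty with lookup α x in tx
      ... | false = refl
      ... | true  = contradiction (trans (sym ty) (excl-x α∈ agree tx)) (λ ())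
      pairs₀ : PairsOK sols st₀
      pairs₀ {a} {b} eq = locate (a ≟ᶠ u) (a ≟ᶠ x) (a ≟ᶠ y) (a ≟ᶠ v) (a ≟ᶠ w)
        where
        locate : Dec (a ≡ u) → Dec (a ≡ x) → Dec (a ≡ y) → Dec (a ≡ v) → Dec (a ≡ w) → Pair sols st₀ a b
        locate (yes refl) _ _ _ _ = contradiction (trans (sym (at zero)) eq) (λ ())
        locate _ (yes refl) _ _ _ with paired-injective (trans (sym (at (suc zero))) eq)
        ... | refl = record
          { symmetric = at (# 2) ; distinct = x≢y ; exclusive = λ {α} → excl-x {α}
          ; isolated = λ z z≢x z≢y t → not-live z z≢x z≢y t }
        locate _ _ (yes refl) _ _ with paired-injective (trans (sym (at (# 2))) eq)
        ... | refl = record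
          { symmetric = at (suc zero) ; distinct = x≢y ∘ sym ; exclusive = λ {α} → excl-y {α}
          ; isolated = λ z z≢y z≢x t → not-live z z≢x z≢y (NAE-swap sols t) }
        locate _ _ _ (yes refl) _ = contradiction (trans (sym (at (# 3))) eq) (λ ())
        locate _ _ _ _ (yes refl) = contradiction (trans (sym (at (# 4))) eq) (λ ())
        locate (no a≢u) (no a≢x) (no a≢y) (no a≢v) (no a≢w) = record
          { symmetric = trans (setAll-outside L ss₀ st (paired-outside P.symmetric)) P.symmetric
          ; distinct = P.distinct
          ; exclusive = λ {α} α∈ agree → P.exclusive α∈ (Later-agree α later₀ agree)
          ; isolated = λ c c≢a c≢b t live → P.isolated c c≢a c≢b t (⇝-live (later₀ c) live) }
          where
          module P = Pair (I.pairs (trans (sym (setAll-outside L ss₀ st (a≢u ∷ a≢x ∷ a≢y ∷ a≢v ∷ a≢w ∷ []))) eq))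
      simple : ∀ a b c d e → let ss = a ∷ b ∷ c ∷ d ∷ e ∷ [] in T (leaf? true ss) → T (allUnpaired ss) → Bounded (setAll L ss st)
      simple a b c d e ok unp = let ss = a ∷ b ∷ c ∷ d ∷ e ∷ [] in
        continue _ (plain-leaf true (λ _ → tame) ss ok (fresh-pairs ss all-fresh unique unp I.pairs))
      kids : ∀ {e ss} → (e , ss) ∈ pairKids x y → Bounded (setAll L ss st)
      kids (here refl) = continue _ (plain-leaf true (λ _ → tame) ss₀ tt pairs₀)
      kids (there (here refl)) = simple one half half one half tt tt
      kids (there (there (here refl))) = simple half one half one half tt tt
      kids (there (there (there (here refl)))) = simple half half one one half tt tt
      kids (there (there (there (there (here refl))))) = simple one half half half one tt tt
      kids (there (there (there (there (there (here refl)))))) = simple half one half half one tt tt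
      kids (there (there (there (there (there (there (here refl))))))) = simple half half one half one tt tt

    triangle-uvw : Unique (u ∷ v ∷ w ∷ [])
    triangle-uvw with unique
    ... | (_ ∷ _ ∷ uv ∷ uw ∷ _) ∷ _ ∷ _ ∷ (vw ∷ _) ∷ _ = (uv ∷ uw ∷ []) ∷ (vw ∷ []) ∷ [] ∷ []

    outside-uvw : ∀ {i} → i ∈ covered rest → Outside i (u ∷ v ∷ w ∷ [])
    outside-uvw i∈ with outside i∈
    ... | iu ∷ _ ∷ _ ∷ iv ∷ iw ∷ [] = iu ∷ iv ∷ iw ∷ []

    -- The petal x, y has been decided; what remains of the cherry is the triple u, v, w.
    petal-done : Tame st u → ∀ {k} {L : Vec (Fin n) k} → Unique (u ∷ x ∷ y ∷ v ∷ w ∷ L) →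
      (∀ {i} → i ∈ covered rest → Outside i (u ∷ x ∷ y ∷ v ∷ w ∷ L)) → ∀ b c ss →
      let L′ = u ∷ x ∷ y ∷ v ∷ w ∷ L; ss′ = fresh ∷ b ∷ c ∷ fresh ∷ fresh ∷ ss in
      T (used? b) → T (used? c) → Zip (λ j s → st j ⇝ s) L′ ss′ → PairsOK sols (setAll L′ ss′ st) →
      Continue rest → Bounded (setAll L′ ss′ st)
    petal-done tame {L = L} uL out b c ss ub uc moves pairs continue =
      finish-triangle (cherry u x y v w ∷ []) inv triangle-uvw nae₂ (at zero ∷ at (# 3) ∷ at (# 4) ∷ [])
        later (λ i∈ → setAll-outside L′ ss′ st (out i∈)) pairs used outside-uvw
        (λ {st₂} later₂ settled _ _ → λ { (here refl) → settled ,
          λ r≢t r-out t-out t fr ft live → Tame-later u (λ j → ⇝-trans (later j) (later₂ j)) tame r≢t r-out t-out t fr ft live })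
        continue
      where
      L′ = u ∷ x ∷ y ∷ v ∷ w ∷ L
      ss′ = fresh ∷ b ∷ c ∷ fresh ∷ fresh ∷ ss
      later : Later st (setAll L′ ss′ st)
      later = setAll-later {L = L′} moves
      at : ∀ k → setAll L′ ss′ st (lookup L′ k) ≡ lookup ss′ k
      at = setAll-lookup uL ss′ st
      used : ∀ {i} → i ∈ covered (cherry u x y v w ∷ []) → i ≡ u ⊎ i ≡ v ⊎ i ≡ w ⊎ setAll L′ ss′ st i ≢ fresh
      used (here refl) = inj₁ refl
      used (there (here refl)) = inj₂ (inj₂ (inj₂ λ eq → used-sound ub (trans (sym (at (suc zero))) eq)))
      used (there (there (here refl))) = inj₂ (inj₂ (inj₂ λ eq → used-sound uc (trans (sym (at (# 2))) eq)))
      used (there (there (there (here refl)))) = inj₂ (inj₁ refl)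
      used (there (there (there (there (here refl))))) = inj₂ (inj₂ (inj₁ refl))

    inner-branch : ∀ d e (constraint : Vec Bool 5 → Bool) → T (localCheck (Vec.replicate 5 fresh) 2 (innerKids d e) constraint) →
      (∀ {α} → α ∈ sols → T (constraint (Vec.map (lookup α) (u ∷ x ∷ y ∷ v ∷ w ∷ [])))) →
      sumBy (innerKids d e) (λ (k , ss) → k * scaledV ss) ≤ 2 * scaledV (Vec.replicate 5 fresh) →
      T (leaf? false (one ∷ dead ∷ dead ∷ d ∷ e ∷ [])) → T (allUnpaired (one ∷ dead ∷ dead ∷ d ∷ e ∷ [])) →
      Tame st u → Continue rest → Bounded st
    inner-branch d e constraint check holds values ok unpaired tame continue =
      gadget-branch unique st (Vec.replicate 5 fresh) (map-fresh all-fresh) 2 (λ ()) (innerKids d e) constraint check holds values kids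
      where
      go : ∀ b c → T (used? b) → T (used? c) → T (allUnpaired (fresh ∷ b ∷ c ∷ fresh ∷ fresh ∷ [])) →
        Bounded (setAll (u ∷ x ∷ y ∷ v ∷ w ∷ []) (fresh ∷ b ∷ c ∷ fresh ∷ fresh ∷ []) st)
      go b c ub uc unp = petal-done tame unique outside b c [] ub uc (free-moves all-fresh (fresh ∷ b ∷ c ∷ fresh ∷ fresh ∷ []))
        (fresh-pairs (fresh ∷ b ∷ c ∷ fresh ∷ fresh ∷ []) all-fresh unique unp I.pairs) continue
      kids : ∀ {k ss} → (k , ss) ∈ innerKids d e → Bounded (setAll (u ∷ x ∷ y ∷ v ∷ w ∷ []) ss st)
      kids (here refl) = go one half tt tt tt
      kids (there (here refl)) = go half one tt tt tt
      kids (there (there (here refl))) = let ss = one ∷ dead ∷ dead ∷ d ∷ e ∷ [] in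
        continue _ (plain-leaf false (λ ()) ss ok (fresh-pairs ss all-fresh unique unpaired I.pairs))

    inner-step : Tame st u → NAE sols x y v → Continue rest → Bounded st
    inner-step tame nae₃ = inner-branch one full (λ { (a ∷ b ∷ c ∷ d ∷ e ∷ []) → nae a b c ∧ nae a d e ∧ nae b c d }) tt
      (λ {α} α∈ → Equivalence.from T-∧ (nae-T nae₁ α∈ , Equivalence.from T-∧ (nae-T nae₂ α∈ , nae-T nae₃ α∈)))
      inner-values tt tt tame

    inner-step′ : Tame st u → NAE sols x y w → Continue rest → Bounded st
    inner-step′ tame nae₃ = inner-branch full one (λ { (a ∷ b ∷ c ∷ d ∷ e ∷ []) → nae a b c ∧ nae a d e ∧ nae b c e }) tt
      (λ {α} α∈ → Equivalence.from T-∧ (nae-T nae₁ α∈ , Equivalence.from T-∧ (nae-T nae₂ α∈ , nae-T nae₃ α∈)))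
      inner′-values tt tt tame

    outer-step : ∀ {z} → Tame st u → NAE sols x y z → st z ≡ half → Continue rest → Bounded st
    outer-step {z} tame nae₃ hz continue =
      gadget-branch uL st (fresh ∷ fresh ∷ fresh ∷ fresh ∷ fresh ∷ half ∷ []) olds 2 (λ ()) outerKids
        (λ { (a ∷ b ∷ c ∷ d ∷ e ∷ f ∷ []) → nae a b c ∧ nae a d e ∧ nae b c f }) tt
        (λ {α} α∈ → Equivalence.from T-∧ (nae-T nae₁ α∈ , Equivalence.from T-∧ (nae-T nae₂ α∈ , nae-T nae₃ α∈)))
        outer-values kids
      where
      L = u ∷ x ∷ y ∷ v ∷ w ∷ z ∷ []
      fresh≢z : ∀ {i} → st i ≡ fresh → i ≢ z
      fresh≢z f refl = contradiction (trans (sym f) hz) (λ ())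
      uL : Unique L
      uL = AllPairs-++⁺ unique ([] ∷ []) (VAll.map (λ f → fresh≢z f ∷ []) all-fresh)
      out : ∀ {i} → i ∈ covered rest → Outside i L
      out i∈ = All-++⁺ (outside i∈) (fresh≢z (I.intact (∈-++⁺ʳ (corners (cherry u x y v w)) i∈)) ∷ [])
      olds : Vec.map st L ≡ fresh ∷ fresh ∷ fresh ∷ fresh ∷ fresh ∷ half ∷ []
      olds = trans (Vecₚ.map-++ st (u ∷ x ∷ y ∷ v ∷ w ∷ []) (z ∷ [])) (cong₂ Vec._++_ (map-fresh all-fresh) (cong (_∷ []) hz))
      moves : ∀ ss {s} → half ⇝ s → Zip (λ j s → st j ⇝ s) L (ss Vec.++ s ∷ [])
      moves ss {s} m = Zip-++ (free-moves all-fresh ss) (subst (_⇝ s) (sym hz) m , tt)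
      pairs : ∀ ss {s} → half ⇝ s → T (allUnpaired (ss Vec.++ s ∷ [])) → PairsOK sols (setAll L (ss Vec.++ s ∷ []) st)
      pairs ss {s} m unp = PairsOK-setAll sols (moves ss m) (unpaired-sound (ss Vec.++ s ∷ []) unp) uL
        (All-++⁺ (VAll.map (λ f v e → contradiction (trans (sym f) e) (λ ())) all-fresh) ((λ v e → contradiction (trans (sym hz) e) (λ ())) ∷ []))
        I.pairs
      go : ∀ b c → T (used? b) → T (used? c) → T (allUnpaired (fresh ∷ b ∷ c ∷ fresh ∷ fresh ∷ half ∷ [])) →
        Bounded (setAll L (fresh ∷ b ∷ c ∷ fresh ∷ fresh ∷ half ∷ []) st)
      go b c ub uc unp = petal-done tame uL out b c (half ∷ []) ub uc (moves (fresh ∷ b ∷ c ∷ fresh ∷ fresh ∷ []) half)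
        (pairs (fresh ∷ b ∷ c ∷ fresh ∷ fresh ∷ []) half unp) continue
      kids : ∀ {e ss} → (e , ss) ∈ outerKids → Bounded (setAll L ss st)
      kids (here refl) = go one half tt tt tt
      kids (there (here refl)) = go half one tt tt tt
      kids (there (there (here refl))) = continue _ (leaf {L = z ∷ []} false (λ ()) uL (one ∷ dead ∷ dead ∷ full ∷ full ∷ one ∷ [])
        (λ i∈ → setAll-outside L (one ∷ dead ∷ dead ∷ full ∷ full ∷ one ∷ []) st (out i∈))
        (moves (one ∷ dead ∷ dead ∷ full ∷ full ∷ []) one) tt (pairs (one ∷ dead ∷ dead ∷ full ∷ full ∷ []) one tt))

  Continue : List (Piece n) → Set
  Continue ps = ∀ st → Inv ps st → Bounded st

  -- Here z is the center of three not-all-equal triples, so it can be exposed with the petal x, y of the other cherry.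
  shared-step : ∀ {u x y v w z x₁ y₁ v₁ w₁ rest st} → Inv (cherry u x y v w ∷ cherry z x₁ y₁ v₁ w₁ ∷ rest) st →
    Tame st u → NAE sols x y z → Continue (cherry u x y v w ∷ rest) → Continue rest → Bounded st
  shared-step {u} {x} {y} {v} {w} {z} {x₁} {y₁} {v₁} {w₁} {rest} {st} inv tame nae₃ continue₁ continue₂ =
    expose-step uL fs C.nae₁ C.nae₂ (NAE-rotate sols (NAE-rotate sols nae₃)) kids
    where
    inv′ : Inv (cherry z x₁ y₁ v₁ w₁ ∷ cherry u x y v w ∷ rest) st
    inv′ = Inv-↭ (swap _ _ ↭-refl) inv
    module D = Cherry inv
    module C = Cherry inv′
    L = z ∷ x₁ ∷ y₁ ∷ v₁ ∷ w₁ ∷ x ∷ y ∷ []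
    x∈ : x ∈ covered (cherry u x y v w ∷ rest)
    x∈ = there (here refl)
    y∈ : y ∈ covered (cherry u x y v w ∷ rest)
    y∈ = there (there (here refl))
    fs : AllFresh st L
    fs = All-++⁺ C.all-fresh (D.I.intact (there (here refl)) ∷ D.I.intact (there (there (here refl))) ∷ [])
    x≢y : x ≢ y
    x≢y with D.unique
    ... | _ ∷ (ne ∷ _) ∷ _ = ne
    uL : Unique L
    uL = AllPairs-++⁺ C.unique ((x≢y ∷ []) ∷ [] ∷ [])
      (VAll.map (λ (a , b) → (a ∘ sym) ∷ (b ∘ sym) ∷ []) (VAll.zip (C.outside x∈ , C.outside y∈)))
    outside-L : ∀ {i} → i ∈ covered (cherry u x y v w ∷ rest) → i ≢ x → i ≢ y → Outside i L
    outside-L i∈ i≢x i≢y = All-++⁺ (C.outside i∈) (i≢x ∷ i≢y ∷ [])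
    outside-rest : ∀ {i} → i ∈ covered rest → Outside i L
    outside-rest i∈ with D.outside (∈-++⁺ʳ (corners (cherry z x₁ y₁ v₁ w₁)) i∈)
    ... | _ ∷ i≢x ∷ i≢y ∷ _ = outside-L (∈-++⁺ʳ (corners (cherry u x y v w)) i∈) i≢x i≢y
    ss₀ = one ∷ full ∷ full ∷ full ∷ full ∷ fresh ∷ fresh ∷ []
    same₀ : ∀ {i} → i ∈ covered (cherry u x y v w ∷ rest) → setAll L ss₀ st i ≡ st i
    same₀ {i} i∈ with i ≟ᶠ x | i ≟ᶠ y
    ... | yes refl | _ = trans (setAll-lookup uL ss₀ st (# 5)) (sym (D.I.intact (there (here refl))))
    ... | no _ | yes refl = trans (setAll-lookup uL ss₀ st (# 6)) (sym (D.I.intact (there (there (here refl)))))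
    ... | no i≢x | no i≢y = setAll-outside L ss₀ st (outside-L i∈ i≢x i≢y)
    other : ∀ a b c d e f → let ss = dead ∷ a ∷ b ∷ c ∷ d ∷ e ∷ f ∷ [] in
      T (used? a ∧ used? b ∧ used? c ∧ used? d ∧ used? e ∧ used? f) → T (allUnpaired ss) → Bounded (setAll L ss st)
    other a b c d e f ok unp =
      -- With z false, the petal x, y is decided along with the petals at z. The cherry at z is
      -- complete, and of the other only the triple u, v, w remains.
      finish-triangle (cherry z x₁ y₁ v₁ w₁ ∷ cherry u x y v w ∷ []) inv′ D.triangle-uvw D.nae₂
        (still u (here refl) u≢x u≢y ∷ still v (there (there (there (here refl)))) v≢x v≢y ∷
          still w (there (there (there (there (here refl))))) w≢x w≢y ∷ [])
        later (λ i∈ → setAll-outside L ss st (outside-rest i∈)) (fresh-pairs ss fs uL unp C.I.pairs) used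
        (λ i∈ → D.outside-uvw (∈-++⁺ʳ (corners (cherry z x₁ y₁ v₁ w₁)) i∈)) resolved continue₂
      where
      ss = dead ∷ a ∷ b ∷ c ∷ d ∷ e ∷ f ∷ []
      later : Later st (setAll L ss st)
      later = setAll-later {L = L} (free-moves fs ss)
      at : ∀ k → setAll L ss st (lookup L k) ≡ lookup ss k
      at = setAll-lookup uL ss st
      o₂ = Equivalence.to (T-∧ {used? a}) ok
      o₃ = Equivalence.to (T-∧ {used? b}) (proj₂ o₂)
      o₄ = Equivalence.to (T-∧ {used? c}) (proj₂ o₃)
      o₅ = Equivalence.to (T-∧ {used? d}) (proj₂ o₄)
      o₆ = Equivalence.to (T-∧ {used? e}) (proj₂ o₅)
      u≢x : u ≢ x
      u≢x with D.unique
      ... | (ne ∷ _) ∷ _ = ne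
      u≢y : u ≢ y
      u≢y with D.unique
      ... | (_ ∷ ne ∷ _) ∷ _ = ne
      v≢x : v ≢ x
      v≢x with D.unique
      ... | _ ∷ (_ ∷ ne ∷ _) ∷ _ = ne ∘ sym
      w≢x : w ≢ x
      w≢x with D.unique
      ... | _ ∷ (_ ∷ _ ∷ ne ∷ _) ∷ _ = ne ∘ sym
      v≢y : v ≢ y
      v≢y with D.unique
      ... | _ ∷ _ ∷ (ne ∷ _) ∷ _ = ne ∘ sym
      w≢y : w ≢ y
      w≢y with D.unique
      ... | _ ∷ _ ∷ (_ ∷ ne ∷ _) ∷ _ = ne ∘ sym
      still : ∀ i → i ∈ covered (cherry u x y v w ∷ rest) → i ≢ x → i ≢ y → setAll L ss st i ≡ fresh
      still i i∈ i≢x i≢y = trans (setAll-outside L ss st (outside-L i∈ i≢x i≢y))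
        (C.I.intact (∈-++⁺ʳ (corners (cherry z x₁ y₁ v₁ w₁)) i∈))
      nf : ∀ k → T (used? (lookup ss k)) → setAll L ss st (lookup L k) ≢ fresh
      nf k t eq = used-sound t (trans (sym (at k)) eq)
      used : ∀ {i} → i ∈ covered (cherry z x₁ y₁ v₁ w₁ ∷ cherry u x y v w ∷ []) →
        i ≡ u ⊎ i ≡ v ⊎ i ≡ w ⊎ setAll L ss st i ≢ fresh
      used (here refl) = inj₂ (inj₂ (inj₂ (nf zero tt)))
      used (there (here refl)) = inj₂ (inj₂ (inj₂ (nf (suc zero) (proj₁ o₂))))
      used (there (there (here refl))) = inj₂ (inj₂ (inj₂ (nf (# 2) (proj₁ o₃))))
      used (there (there (there (here refl)))) = inj₂ (inj₂ (inj₂ (nf (# 3) (proj₁ o₄))))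
      used (there (there (there (there (here refl))))) = inj₂ (inj₂ (inj₂ (nf (# 4) (proj₁ o₅))))
      used (there (there (there (there (there (here refl)))))) = inj₁ refl
      used (there (there (there (there (there (there (here refl))))))) = inj₂ (inj₂ (inj₂ (nf (# 5) (proj₁ o₆))))
      used (there (there (there (there (there (there (there (here refl)))))))) =
        inj₂ (inj₂ (inj₂ (nf (# 6) (proj₂ o₆))))
      used (there (there (there (there (there (there (there (there (here refl))))))))) = inj₂ (inj₁ refl)
      used (there (there (there (there (there (there (there (there (there (here refl)))))))))) = inj₂ (inj₂ (inj₁ refl))
      resolved : ∀ {st₂} → Later (setAll L ss st) st₂ → Settled (st₂ u) → Settled (st₂ v) → Settled (st₂ w) →
        ∀ {s} → s ∈ cherry z x₁ y₁ v₁ w₁ ∷ cherry u x y v w ∷ [] → Resolved st₂ s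
      resolved {st₂} later₂ settled _ _ (here refl) = subst Settled (sym is-dead) dead , λ _ _ _ _ _ _ live → proj₂ live is-dead
        where
        is-dead : st₂ z ≡ dead
        is-dead = subst (_⇝ st₂ z) (at zero) (later₂ z)
      resolved {st₂} later₂ settled _ _ (there (here refl)) = settled ,
        λ r≢t r-out t-out t fr ft live → Tame-later u (λ j → ⇝-trans (later j) (later₂ j)) tame r≢t r-out t-out t fr ft live
    kids : ∀ {e ss} → (e , ss) ∈ exposeKids → Bounded (setAll L ss st)
    -- With z true, x and y stay fresh, so the other cherry is intact and remains to be processed.
    kids (here refl) = continue₁ _ (C.leaf {L = x ∷ y ∷ []} false (λ ()) uL ss₀ same₀ (free-moves fs ss₀) tt (fresh-pairs ss₀ fs uL tt C.I.pairs))
    kids (there (here refl)) = other one half one half one half tt tt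
    kids (there (there (here refl))) = other one half one half half one tt tt
    kids (there (there (there (here refl)))) = other one half half one one half tt tt
    kids (there (there (there (there (here refl))))) = other one half half one half one tt tt
    kids (there (there (there (there (there (here refl)))))) = other half one one half one half tt tt
    kids (there (there (there (there (there (there (here refl))))))) = other half one one half half one tt tt
    kids (there (there (there (there (there (there (there (here refl)))))))) = other half one half one one half tt tt
    kids (there (there (there (there (there (there (there (there (here refl))))))))) = other half one half one half one tt tt

  NoTriangle : List (Piece n) → Set
  NoTriangle rest = ∀ {a b c} → triangle a b c ∉ rest

  settled-half : ∀ {s : Status n} → Settled s → Live s → s ≡ half
  settled-half one  live = contradiction refl (proj₁ live)
  settled-half dead live = contradiction refl (proj₂ live)
  settled-half half _    = refl

  -- Two fresh vertices are outside the family by now. If they form a triple with `c`, maximality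
  -- makes `c` the center of a cherry, and a resolved center is tame.
  clean : ∀ {st} → Inv [] st → Clean sols st
  clean {st} inv {a} {b} {c} a≢b a≢c b≢c t fa fb live with I.outer fa | I.outer fb
    where module I = Inv inv
  ... | inj₁ a-out | inj₁ b-out with outer-nae a≢b a≢c b≢c t a-out b-out
  ...   | _ , _ , _ , _ , s∈ with Inv.resolved inv s∈
  ...     | inj₂ (_ , tame) = tame a≢b a-out b-out (NAE-rotate sols (NAE-rotate sols t)) fa fb live

  -- Third petals at the center are removed first, because the other branchings may leave the center
  -- `half`. The next question is whether x and y lie in a further triple with a live vertex; if
  -- not, they can form a pair.
  process : ∀ k rest st → length rest ≤ k → NoTriangle rest → Inv rest st → Bounded st
  process k [] st _ _ inv = finished st (Inv.pairs inv) (clean inv)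
  process (suc k) (triangle a b c ∷ rest) st _ nt _ = contradiction (here refl) nt
  process (suc k) (cherry u x y v w ∷ rest) st (s≤s le) nt inv =
    by-cases (_ ≤? _) wild (λ ¬wild → by-cases (_ ≤? _) (shared (tame ¬wild)) (free (tame ¬wild)))
    where
    open Cherry inv using (module I; expose-outer; pair-step; inner-step; inner-step′; outer-step; in-family)
    continue : Continue rest
    continue st′ inv′ = process k rest st′ le (nt ∘ there) inv′
    Wild : Set
    Wild = ∃ λ r → ∃ λ t → r ≢ t × Out r × Out t × NAE sols u r t × st r ≡ fresh × st t ≡ fresh
    wild : Wild → Bounded st
    wild (r , t , r≢t , r-out , t-out , nae₃ , fr , ft) = expose-outer r≢t r-out t-out nae₃ fr ft continue
    tame : ¬ Wild → Tame st u
    tame ¬wild {r} {t} r≢t r-out t-out nae₃ fr ft _ = ¬wild (r , t , r≢t , r-out , t-out , nae₃ , fr , ft)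
    Shared : Set
    Shared = ∃ λ z → z ≢ u × z ≢ x × z ≢ y × NAE sols x y z × Live (st z)
    free : Tame st u → ¬ Shared → Bounded st
    free tame ¬shared = pair-step tame (λ z z≢u z≢x z≢y t live → ¬shared (z , z≢u , z≢x , z≢y , t , live)) continue
    shared : Tame st u → Shared → Bounded st
    shared tame (z , z≢u , z≢x , z≢y , t , live) with petal-nae in-family z≢x z≢y t
    ... | inj₁ z≡u = contradiction z≡u z≢u
    ... | inj₂ (inj₁ refl) = inner-step tame t continue
    ... | inj₂ (inj₂ (inj₁ refl)) = inner-step′ tame t continue
    ... | inj₂ (inj₂ (inj₂ (inj₁ (a , b , c , s∈ , z∈)))) with I.resolved s∈
    ...   | inj₁ s∈rest = contradiction s∈rest nt
    -- All triangles have been branched on before the cherries, so a live vertex of one is `half`.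
    ...   | inj₂ (sa , sb , sc) = outer-step tame t (settled-half (settled-z z∈) live) continue
      where
      settled-z : z ∈ corners (triangle a b c) → Settled (st z)
      settled-z (here refl) = sa
      settled-z (there (here refl)) = sb
      settled-z (there (there (here refl))) = sc
    shared tame (z , z≢u , z≢x , z≢y , t , live) | inj₂ (inj₂ (inj₂ (inj₂ (x₁ , y₁ , v₁ , w₁ , s∈)))) with I.resolved s∈
    ... | inj₂ (settled , _) = outer-step tame t (settled-half settled live) continue
    ... | inj₁ (here refl) = contradiction refl z≢u
    ... | inj₁ (there s∈rest) with bring-to-front s∈rest
    ...   | rest′ , perm = shared-step (Inv-↭ (prep _ perm) inv) tame t
        (λ st′ → process k (cherry u x y v w ∷ rest′) st′ shorter
          (λ { (here ()) ; (there m) → nt (there (∈-resp-↭ (↭-sym perm) (there m))) }))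
        (λ st′ → process k rest′ st′ (≤-trans (n≤1+n _) shorter) (λ m → nt (there (∈-resp-↭ (↭-sym perm) (there m)))))
      where
      shorter : suc (length rest′) ≤ k
      shorter = subst (_≤ k) (↭-length perm) le

  process-triangles : ∀ k ts cs st → length ts + length cs ≤ k → NoTriangle cs →
    (∀ {s} → s ∈ ts → ∃ λ a → ∃ λ b → ∃ λ c → s ≡ triangle a b c) → Inv (ts ++ cs) st → Bounded st
  process-triangles k [] cs st le nt all inv = process k cs st le nt inv
  process-triangles (suc k) (t ∷ ts) cs st (s≤s le) nt all inv with all (here refl)
  ... | a , b , c , refl = finish-triangle (triangle a b c ∷ []) inv unique (triangle-nae (I.known (here refl)))
      (I.intact (here refl) ∷ I.intact (there (here refl)) ∷ I.intact (there (there (here refl))) ∷ [])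
      (λ j → ⇝-refl (st j)) (λ _ → refl) I.pairs
      (λ { (here refl) → inj₁ refl ; (there (here refl)) → inj₂ (inj₁ refl) ; (there (there (here refl))) → inj₂ (inj₂ (inj₁ refl)) })
      outside (λ _ sa sb sc → λ { (here refl) → sa , sb , sc }) (λ st′ → process-triangles k ts cs st′ le nt (all ∘ there))
    where
    module I = Inv inv
    unique : Unique (a ∷ b ∷ c ∷ [])
    unique with I.disjoint
    ... | (ab ∷ ac ∷ _) ∷ (bc ∷ _) ∷ _ = (ab ∷ ac ∷ []) ∷ (bc ∷ []) ∷ [] ∷ []
    outside : ∀ {i} → i ∈ covered (ts ++ cs) → Outside i (a ∷ b ∷ c ∷ [])
    outside i∈ with I.disjoint
    ... | (_ ∷ _ ∷ as) ∷ (_ ∷ bs) ∷ cs ∷ _ = (All.lookup as i∈ ∘ sym) ∷ (All.lookup bs i∈ ∘ sym) ∷ (All.lookup cs i∈ ∘ sym) ∷ []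

-- Maximal families of disjoint triangles and cherries

score : ∀ {n} → Piece n → ℕ
score (triangle _ _ _)   = 3
score (cherry _ _ _ _ _) = 4

scores : ∀ {n} → List (Piece n) → ℕ
scores ps = sumBy ps score

unique-prefix : ∀ {A : Set} (xs : List A) {ys} → List.Unique (xs ++ ys) → List.Unique xs
unique-prefix []       _        = []
unique-prefix (x ∷ xs) (px ∷ u) = All.tabulate (λ m → All.lookup px (∈-++⁺ˡ m)) ∷ unique-prefix xs u

unique-suffix : ∀ {A : Set} (xs : List A) {ys} → List.Unique (xs ++ ys) → List.Unique ys
unique-suffix []       u       = u
unique-suffix (_ ∷ xs) (_ ∷ u) = unique-suffix xs u

unique-disjoint : ∀ {A : Set} (xs : List A) {ys a} → List.Unique (xs ++ ys) → a ∈ xs → a ∉ ys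
unique-disjoint (x ∷ xs) (px ∷ u) (here refl) a∈ys = All.lookup px (∈-++⁺ʳ xs a∈ys) refl
unique-disjoint (x ∷ xs) (px ∷ u) (there a∈)  a∈ys = unique-disjoint xs u a∈ a∈ys

unique-lookup : ∀ {A : Set} {xs : List A} → List.Unique xs → ∀ {i j} →
  lookupᴸ xs i ≡ lookupᴸ xs j → i ≡ j
unique-lookup (px ∷ u) {zero}  {zero}  eq = refl
unique-lookup (px ∷ u) {zero}  {suc j} eq = contradiction eq (All.lookup px (∈-lookupᴸ j))
unique-lookup (px ∷ u) {suc i} {zero}  eq = contradiction (sym eq) (All.lookup px (∈-lookupᴸ i))
unique-lookup (px ∷ u) {suc i} {suc j} eq = cong suc (unique-lookup u eq)

unique-length : ∀ {n} {xs : List (Fin n)} → List.Unique xs → length xs ≤ n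
unique-length u = injective⇒≤ (unique-lookup u)

unique-select : ∀ {A : Set} (xs : List A) {ys} → List.Unique (xs ++ ys) → (is : List (Fin (length xs))) →
  List.Unique is → List.Unique (map (lookupᴸ xs) is ++ ys)
unique-select xs u is v = Unique-++⁺ (Unique-map⁺ (unique-lookup (unique-prefix xs u)) v) (unique-suffix xs u)
  (λ { (m , m′) → let i , _ , eq = ∈-map⁻ _ m in unique-disjoint xs u (∈-lookupᴸ i) (subst (_∈ _) eq m′) })

covered-++ : ∀ {n} (ps qs : List (Piece n)) → covered (ps ++ qs) ≡ covered ps ++ covered qs
covered-++ = concatMap-++ corners

scores≤length : ∀ {n} (ps : List (Piece n)) → scores ps ≤ length (covered ps)
scores≤length []                       = z≤n
scores≤length (triangle _ _ _ ∷ ps)   = +-monoʳ-≤ 3 (scores≤length ps)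
scores≤length (cherry _ _ _ _ _ ∷ ps) = ≤-trans (+-monoʳ-≤ 4 (scores≤length ps)) (n≤1+n _)

module Packings {n} (sols : List (Assignment n)) where

  Sound : Piece n → Set
  Sound (triangle a b c)   = NAE sols a b c
  Sound (cherry u x y v w) = NAE sols u x y × NAE sols u v w

  record Packing (ps : List (Piece n)) : Set where
    field
      unique : List.Unique (covered ps)
      sound  : ∀ {s} → s ∈ ps → Sound s

  Maximal : List (Piece n) → Set
  Maximal ps = ∀ {qs} → Packing qs → scores qs ≤ scores ps

  -- A packing is improved as long as possible; since scores are at most n, the number `k` of
  -- possible improvements runs out. The decidable goal allows asking whether a better packing
  -- exists.
  with-maximal : ∀ {G : Set} → Dec G → (∀ ps → Packing ps → Maximal ps → G) → G
  with-maximal G? f = go n [] (record { unique = [] ; sound = λ () }) (m≤m+n n 0)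
    where
    go : ∀ k ps → Packing ps → n ≤ k + scores ps → _
    go k ps packing le = by-cases G? (better k le) (λ none → f ps packing (λ {qs} packing′ → ≮⇒≥ (λ lt → none (qs , packing′ , lt))))
      where
      better : ∀ k → n ≤ k + scores ps → (∃ λ qs → Packing qs × scores ps < scores qs) → _
      better zero le (qs , packing′ , lt) =
        contradiction (≤-trans (scores≤length qs) (unique-length (Packing.unique packing′))) (<⇒≱ (<-≤-trans (s≤s le) lt))
      better (suc k) le (qs , packing′ , lt) =
        go k qs packing′ (≤-trans le (≤-trans (≤-reflexive (sym (+-suc k (scores ps)))) (+-monoʳ-≤ k lt)))

  -- The exchanges below gain because 3 < 4, 4 < 2 · 3 and 2 · 4 < 3 · 3: a cherry beats a triangle,
  -- two triangles beat a cherry, and three triangles beat two cherries.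
  module Optimal {ps} (packing : Packing ps) (maximal : Maximal ps) where

    open Packing packing

    -- The corners of added are given by their positions in extra ++ covered removed, so that their disjointness is decided by evaluation.
    no-gain : ∀ extra removed {rest} added → ps ↭ removed ++ rest → List.Unique extra → (∀ {i} → i ∈ extra → i ∉ covered ps) →
      (is : List (Fin (length (extra ++ covered removed)))) → True (unique? _≟ᶠ_ is) →
      covered added ≡ map (lookupᴸ (extra ++ covered removed)) is → (∀ {s} → s ∈ added → Sound s) →
      ¬ (scores removed < scores added)
    no-gain extra removed {rest} added perm extra-unique extra-out is is-unique eq added-sound lt =
      <⇒≱ bigger (maximal (record { unique = added-unique ; sound = λ m → [ added-sound , (λ m → sound (∈-resp-↭ (↭-sym perm) (∈-++⁺ʳ removed m))) ]′ (∈-++⁻ added m) }))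
      where
      scores-++ : ∀ ps qs → scores (ps ++ qs) ≡ scores ps + scores qs
      scores-++ ps qs = trans (cong sum (map-++ score ps qs)) (sum-++ (map score ps) (map score qs))
      bigger : scores ps < scores (added ++ rest)
      bigger = subst₂ _<_ (trans (sym (scores-++ removed rest)) (sym (sum-↭ (↭-map⁺ score perm)))) (sym (scores-++ added rest)) (+-monoˡ-< (scores rest) lt)
      removed-unique : List.Unique (covered removed ++ covered rest)
      removed-unique = subst List.Unique (covered-++ removed rest) (Unique-resp-↭ (setoid (Fin n)) (↭⇒↭ₛ (covered-↭ perm)) unique)
      all-unique : List.Unique ((extra ++ covered removed) ++ covered rest)
      all-unique = subst List.Unique (sym (++-assoc extra (covered removed) (covered rest)))
        (Unique-++⁺ extra-unique removed-unique (λ (m , m′) → extra-out m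
          (∈-resp-↭ (↭-sym (covered-↭ perm)) (subst (_ ∈_) (sym (covered-++ removed rest)) m′))))
      added-unique : List.Unique (covered (added ++ rest))
      added-unique = subst List.Unique (sym (covered-++ added rest)) (subst (λ L → List.Unique (L ++ covered rest)) (sym eq)
        (unique-select (extra ++ covered removed) all-unique is (toWitness is-unique)))

    private
      covered? : ∀ i → Dec (i ∈ covered ps)
      covered? i = _∈?_ _≟ᶠ_ i (covered ps)

      piece-of : ∀ {qs : List (Piece n)} {i} → i ∈ covered qs → ∃ λ s → s ∈ qs × i ∈ corners s
      piece-of {s ∷ qs} i∈ with ∈-++⁻ (corners s) i∈
      ... | inj₁ i∈s = s , here refl , i∈s
      ... | inj₂ i∈qs = let t , t∈ , i∈t = piece-of {qs} i∈qs in t , there t∈ , i∈t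

      pair-unique : ∀ {a b : Fin n} → a ≢ b → List.Unique (a ∷ b ∷ [])
      pair-unique a≢b = (a≢b ∷ []) ∷ [] ∷ []

      all₁ : ∀ {s : Piece n} → Sound s → ∀ {t} → t ∈ s ∷ [] → Sound t
      all₁ p (here refl) = p

      all₂ : ∀ {s t : Piece n} → Sound s → Sound t → ∀ {r} → r ∈ s ∷ t ∷ [] → Sound r
      all₂ p q (here refl) = p
      all₂ p q (there (here refl)) = q

      all₃ : ∀ {r s t : Piece n} → Sound r → Sound s → Sound t → ∀ {o} → o ∈ r ∷ s ∷ t ∷ [] → Sound o
      all₃ p q r (here refl) = p
      all₃ p q r (there m) = all₂ q r m

    -- Otherwise a and b improve the family: with an uncovered c they form a new triangle, with a
    -- corner of a triangle they extend it to a cherry, and with a petal vertex of a cherry they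
    -- form a triangle next to the triple of the cherry that avoids it.
    outer-nae : ∀ {a b c} → a ≢ b → a ≢ c → b ≢ c → NAE sols a b c → a ∉ covered ps → b ∉ covered ps →
      ∃ λ x → ∃ λ y → ∃ λ v → ∃ λ w → cherry c x y v w ∈ ps
    outer-nae {a} {b} {c} a≢b a≢c b≢c t a-out b-out with covered? c
    ... | no c-out = ⊥-elim (no-gain (a ∷ b ∷ c ∷ []) [] (triangle a b c ∷ []) ↭-refl
        ((a≢b ∷ a≢c ∷ []) ∷ (b≢c ∷ []) ∷ [] ∷ []) (λ { (here refl) → a-out ; (there (here refl)) → b-out ; (there (there (here refl))) → c-out })
        (# 0 ∷ # 1 ∷ # 2 ∷ []) tt refl (all₁ {triangle a b c} t) (s≤s z≤n))
    ... | yes c∈ with piece-of {ps} c∈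
    ...   | s , s∈ , c∈s with bring-to-front s∈
    ...     | _ , perm = locate s s∈ perm c∈s
      where
      extra-out : ∀ {i} → i ∈ a ∷ b ∷ [] → i ∉ covered ps
      extra-out (here refl) = a-out
      extra-out (there (here refl)) = b-out
      cab : NAE sols c a b
      cab = NAE-rotate sols (NAE-rotate sols t)
      locate : ∀ s {rest} → s ∈ ps → ps ↭ s ∷ rest → c ∈ corners s → ∃ λ x → ∃ λ y → ∃ λ v → ∃ λ w → cherry c x y v w ∈ ps
      locate (triangle d e f) s∈ perm (here refl) =
        ⊥-elim (no-gain (a ∷ b ∷ []) (triangle d e f ∷ []) (cherry d e f a b ∷ []) perm (pair-unique a≢b) extra-out
          (# 2 ∷ # 3 ∷ # 4 ∷ # 0 ∷ # 1 ∷ []) tt refl (all₁ {cherry d e f a b} (sound s∈ , cab)) ≤-refl)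
      locate (triangle d e f) s∈ perm (there (here refl)) =
        ⊥-elim (no-gain (a ∷ b ∷ []) (triangle d e f ∷ []) (cherry e f d a b ∷ []) perm (pair-unique a≢b) extra-out
          (# 3 ∷ # 4 ∷ # 2 ∷ # 0 ∷ # 1 ∷ []) tt refl (all₁ {cherry e f d a b} (NAE-rotate sols (sound s∈) , cab)) ≤-refl)
      locate (triangle d e f) s∈ perm (there (there (here refl))) =
        ⊥-elim (no-gain (a ∷ b ∷ []) (triangle d e f ∷ []) (cherry f d e a b ∷ []) perm (pair-unique a≢b) extra-out
          (# 4 ∷ # 2 ∷ # 3 ∷ # 0 ∷ # 1 ∷ []) tt refl (all₁ {cherry f d e a b} (NAE-rotate sols (NAE-rotate sols (sound s∈)) , cab)) ≤-refl)
      locate (cherry u x y v w) s∈ perm (here refl) = x , y , v , w , s∈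
      locate (cherry u x y v w) s∈ perm (there (here refl)) =
        ⊥-elim (no-gain (a ∷ b ∷ []) (cherry u x y v w ∷ []) (triangle x a b ∷ triangle u v w ∷ []) perm (pair-unique a≢b) extra-out
          (# 3 ∷ # 0 ∷ # 1 ∷ # 2 ∷ # 5 ∷ # 6 ∷ []) tt refl (all₂ {triangle x a b} {triangle u v w} cab (proj₂ (sound s∈))) (≤ᵇ⇒≤ 5 6 tt))
      locate (cherry u x y v w) s∈ perm (there (there (here refl))) =
        ⊥-elim (no-gain (a ∷ b ∷ []) (cherry u x y v w ∷ []) (triangle y a b ∷ triangle u v w ∷ []) perm (pair-unique a≢b) extra-out
          (# 4 ∷ # 0 ∷ # 1 ∷ # 2 ∷ # 5 ∷ # 6 ∷ []) tt refl (all₂ {triangle y a b} {triangle u v w} cab (proj₂ (sound s∈))) (≤ᵇ⇒≤ 5 6 tt))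
      locate (cherry u x y v w) s∈ perm (there (there (there (here refl)))) =
        ⊥-elim (no-gain (a ∷ b ∷ []) (cherry u x y v w ∷ []) (triangle v a b ∷ triangle u x y ∷ []) perm (pair-unique a≢b) extra-out
          (# 5 ∷ # 0 ∷ # 1 ∷ # 2 ∷ # 3 ∷ # 4 ∷ []) tt refl (all₂ {triangle v a b} {triangle u x y} cab (proj₁ (sound s∈))) (≤ᵇ⇒≤ 5 6 tt))
      locate (cherry u x y v w) s∈ perm (there (there (there (there (here refl))))) =
        ⊥-elim (no-gain (a ∷ b ∷ []) (cherry u x y v w ∷ []) (triangle w a b ∷ triangle u x y ∷ []) perm (pair-unique a≢b) extra-out
          (# 6 ∷ # 0 ∷ # 1 ∷ # 2 ∷ # 3 ∷ # 4 ∷ []) tt refl (all₂ {triangle w a b} {triangle u x y} cab (proj₁ (sound s∈))) (≤ᵇ⇒≤ 5 6 tt))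

    -- The triangles x y z and u v w could replace the cherry if z were uncovered. If z is a petal
    -- vertex of another cherry, that cherry still has a triple avoiding z, and three triangles
    -- replace the two cherries.
    petal-nae : ∀ {u x y v w z} → cherry u x y v w ∈ ps → z ≢ x → z ≢ y → NAE sols x y z →
      z ≡ u ⊎ z ≡ v ⊎ z ≡ w ⊎ (∃ λ a → ∃ λ b → ∃ λ c → triangle a b c ∈ ps × z ∈ corners (triangle a b c)) ⊎
      (∃ λ x′ → ∃ λ y′ → ∃ λ v′ → ∃ λ w′ → cherry z x′ y′ v′ w′ ∈ ps)
    petal-nae {u} {x} {y} {v} {w} {z} s∈ z≢x z≢y t with bring-to-front s∈ | covered? z
    ... | rest , perm | no z-out = ⊥-elim (no-gain (z ∷ []) (cherry u x y v w ∷ []) (triangle x y z ∷ triangle u v w ∷ []) perm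
        ([] ∷ []) (λ { (here refl) → z-out }) (# 2 ∷ # 3 ∷ # 0 ∷ # 1 ∷ # 4 ∷ # 5 ∷ []) tt refl
        (all₂ {triangle x y z} {triangle u v w} t (proj₂ (sound s∈))) (≤ᵇ⇒≤ 5 6 tt))
    ... | rest , perm | yes z∈ with piece-of {cherry u x y v w ∷ rest} (∈-resp-↭ (covered-↭ perm) z∈)
    ...   | s , here refl , here refl = inj₁ refl
    ...   | s , here refl , there (here refl) = contradiction refl z≢x
    ...   | s , here refl , there (there (here refl)) = contradiction refl z≢y
    ...   | s , here refl , there (there (there (here refl))) = inj₂ (inj₁ refl)
    ...   | s , here refl , there (there (there (there (here refl)))) = inj₂ (inj₂ (inj₁ refl))
    ...   | triangle a b c , there s′∈ , z∈s = inj₂ (inj₂ (inj₂ (inj₁ (a , b , c , ∈-resp-↭ (↭-sym perm) (there s′∈) , z∈s))))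
    ...   | cherry u′ x′ y′ v′ w′ , there s′∈ , z∈s with bring-to-front s′∈
    ...     | rest′ , perm′ = locate z∈s
      where
      perm₂ : ps ↭ cherry u x y v w ∷ cherry u′ x′ y′ v′ w′ ∷ rest′
      perm₂ = ↭-trans perm (prep _ perm′)
      s′∈ps : cherry u′ x′ y′ v′ w′ ∈ ps
      s′∈ps = ∈-resp-↭ (↭-sym perm) (there s′∈)
      gain : (is : List (Fin 10)) → True (unique? _≟ᶠ_ is) → ∀ {d e} → (Sound (triangle u′ d e)) →
        x ∷ y ∷ z ∷ u ∷ v ∷ w ∷ u′ ∷ d ∷ e ∷ [] ≡
          map (lookupᴸ (u ∷ x ∷ y ∷ v ∷ w ∷ u′ ∷ x′ ∷ y′ ∷ v′ ∷ w′ ∷ [])) is → ⊥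
      gain is is-unique {d} {e} p eq = no-gain [] (cherry u x y v w ∷ cherry u′ x′ y′ v′ w′ ∷ [])
        (triangle x y z ∷ triangle u v w ∷ triangle u′ d e ∷ []) perm₂ [] (λ ()) is is-unique eq
        (all₃ {triangle x y z} {triangle u v w} {triangle u′ d e} t (proj₂ (sound s∈)) p) (≤ᵇ⇒≤ 9 9 tt)
      locate : z ∈ corners (cherry u′ x′ y′ v′ w′) → _
      locate (here refl) = inj₂ (inj₂ (inj₂ (inj₂ (x′ , y′ , v′ , w′ , s′∈ps))))
      locate (there (here refl)) =
        ⊥-elim (gain (# 1 ∷ # 2 ∷ # 6 ∷ # 0 ∷ # 3 ∷ # 4 ∷ # 5 ∷ # 8 ∷ # 9 ∷ []) tt (proj₂ (sound s′∈ps)) refl)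
      locate (there (there (here refl))) =
        ⊥-elim (gain (# 1 ∷ # 2 ∷ # 7 ∷ # 0 ∷ # 3 ∷ # 4 ∷ # 5 ∷ # 8 ∷ # 9 ∷ []) tt (proj₂ (sound s′∈ps)) refl)
      locate (there (there (there (here refl)))) =
        ⊥-elim (gain (# 1 ∷ # 2 ∷ # 8 ∷ # 0 ∷ # 3 ∷ # 4 ∷ # 5 ∷ # 6 ∷ # 7 ∷ []) tt (proj₁ (sound s′∈ps)) refl)
      locate (there (there (there (there (here refl))))) =
        ⊥-elim (gain (# 1 ∷ # 2 ∷ # 9 ∷ # 0 ∷ # 3 ∷ # 4 ∷ # 5 ∷ # 6 ∷ # 7 ∷ []) tt (proj₁ (sound s′∈ps)) refl)

-- The clause violated by the ones of a state

isOneᵇ : ∀ {n} → Status n → Bool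
isOneᵇ one = true
isOneᵇ _   = false

count-isOneᵇ : ∀ {n} (s : Status n) → count (isOneᵇ s) ≡ isOne s
count-isOneᵇ one        = refl
count-isOneᵇ dead       = refl
count-isOneᵇ half       = refl
count-isOneᵇ full       = refl
count-isOneᵇ fresh      = refl
count-isOneᵇ (paired _) = refl

isOneᵇ⁻ : ∀ {n} (s : Status n) → isOneᵇ s ≡ true → s ≡ one
isOneᵇ⁻ one _ = refl

sumF-cong : ∀ {n} {f g : Fin n → ℕ} → (∀ i → f i ≡ g i) → sumF f ≡ sumF g
sumF-cong {zero}  eq = refl
sumF-cong {suc n} eq = cong₂ _+_ (eq zero) (sumF-cong (eq ∘ suc))

sumF-+ : ∀ {n} (f g : Fin n → ℕ) → sumF (λ i → f i + g i) ≡ sumF f + sumF g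
sumF-+ {zero}  f g = refl
sumF-+ {suc n} f g rewrite sumF-+ (f ∘ suc) (g ∘ suc) = interchange +-commutativeSemigroup (f zero) (g zero) (sumF (f ∘ suc)) (sumF (g ∘ suc))

sumF-const : ∀ n → sumF {n} (λ _ → 1) ≡ n
sumF-const zero    = refl
sumF-const (suc n) = cong suc (sumF-const n)

prod-^ : ∀ {n} a (f : Fin n → ℕ) → prod (λ i → a ^ f i) ≡ a ^ sumF f
prod-^ {zero}  a f = refl
prod-^ {suc n} a f = trans (cong (a ^ f zero *_) (prod-^ a (f ∘ suc))) (sym (^-distribˡ-+-* a (f zero) _))

prod-* : ∀ {n} (f g : Fin n → ℕ) → prod (λ i → f i * g i) ≡ prod f * prod g
prod-* {zero}  f g = refl
prod-* {suc n} f g rewrite prod-* (f ∘ suc) (g ∘ suc) = [m*n]*[o*p]≡[m*o]*[n*p] (f zero) (g zero) (prod (f ∘ suc)) (prod (g ∘ suc))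

weight-sumF : ∀ {n} (α : Assignment n) → weight α ≡ sumF (λ i → count (lookup α i))
weight-sumF []          = refl
weight-sumF (true ∷ α)  = cong suc (weight-sumF α)
weight-sumF (false ∷ α) = weight-sumF α

sumBy-++ : ∀ {A : Set} (xs ys : List A) (f : A → ℕ) → sumBy (xs ++ ys) f ≡ sumBy xs f + sumBy ys f
sumBy-++ xs ys f = trans (cong sum (map-++ f xs ys)) (sum-++ (map f xs) (map f ys))

sumBy-filter : ∀ {A : Set} {P : A → Set} (P? : ∀ a → Dec (P a)) (xs : List A) (f : A → ℕ) → sumBy (filter P? xs) f ≤ sumBy xs f
sumBy-filter P? []       f = z≤n
sumBy-filter P? (x ∷ xs) f with P? x
... | yes _ = +-monoʳ-≤ (f x) (sumBy-filter P? xs f)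
... | no  _ = ≤-trans (sumBy-filter P? xs f) (m≤n+m _ (f x))

sumBy-1 : ∀ {A : Set} (xs : List A) → sumBy xs (λ _ → 1) ≡ length xs
sumBy-1 []       = refl
sumBy-1 (x ∷ xs) = cong suc (sumBy-1 xs)

sum-assignments : ∀ {n} (g : Fin n → Bool → ℕ) →
  sumBy (assignments n) (λ α → prod (λ i → g i (lookup α i))) ≡ prod (λ i → g i false + g i true)
sum-assignments {zero}  g = refl
sum-assignments {suc n} g = begin
  sumBy (map (false ∷_) As ++ map (true ∷_) As) G ≡⟨ sumBy-++ (map (false ∷_) As) _ G ⟩
  sumBy (map (false ∷_) As) G + sumBy (map (true ∷_) As) G ≡⟨ cong₂ _+_ (with-head false) (with-head true) ⟩
  g zero false * R + g zero true * R ≡⟨ sym (*-distribʳ-+ R (g zero false) _) ⟩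
  (g zero false + g zero true) * R ∎
  where
  open ≡-Reasoning
  As = assignments n
  G = λ (α : Assignment (suc n)) → prod (λ i → g i (lookup α i))
  R = prod (λ i → g (suc i) false + g (suc i) true)
  with-head : ∀ b → sumBy (map (b ∷_) As) G ≡ g zero b * R
  with-head b = trans (sumBy-map (b ∷_) As G) (trans (sumBy-*ˡ As _ (g zero b)) (cong (g zero b *_) (sum-assignments (g ∘ suc))))

module Balanced {n} (F : CNF n) (F-3 : Is3CNF F) (no-light : NoLightSolution F) (closed : NegationClosed F)
  (m : ℕ) (even : 2 * m ≡ n) where

  sols : List (Assignment n)
  sols = filter (isBalancedSolution? F) (assignments n)

  satisfies : ∀ {α} → α ∈ sols → Satisfies α F
  satisfies α∈ = proj₁ (proj₂ (∈-filter⁻ (isBalancedSolution? F) {xs = assignments n} α∈))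

  balanced : ∀ {α} → α ∈ sols → weight α ≡ m
  balanced {α} α∈ = *-cancelˡ-≡ (weight α) m 2
    (trans (proj₂ (proj₂ (∈-filter⁻ (isBalancedSolution? F) {xs = assignments n} α∈))) (sym even))

  -- Three false variables violate the clause itself; three true ones violate it after negation of
  -- the solution.
  positive-nae : ∀ {a b c} → (pos a ∷ pos b ∷ pos c ∷ []) ∈ F → NAE sols a b c
  positive-nae {a} {b} {c} C∈ {α} α∈ =
    check (All.lookup (satisfies α∈) C∈) (All.lookup (closed α (satisfies α∈)) C∈) refl refl refl
    where
    check : SatisfiesClause α (pos a ∷ pos b ∷ pos c ∷ []) → SatisfiesClause (negate α) (pos a ∷ pos b ∷ pos c ∷ []) →
      ∀ {p q r} → lookup α a ≡ p → lookup α b ≡ q → lookup α c ≡ r → nae p q r ≡ true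
    check s t {false} {true}          _ _ _ = refl
    check s t {true}  {false}         _ _ _ = refl
    check s t {false} {false} {true}  _ _ _ = refl
    check s t {true}  {true}  {false} _ _ _ = refl
    check s t {false} {false} {false} ea eb ec with s
    ... | here e = trans (sym ea) e
    ... | there (here e) = trans (sym eb) e
    ... | there (there (here e)) = trans (sym ec) e
    check s t {true} {true} {true} ea eb ec with t
    ... | here e = contradiction e (flipped ea)
      where
      flipped : ∀ {i} → lookup α i ≡ true → lookup (negate α) i ≢ true
      flipped {i} e e′ with () ← trans (sym e′) (trans (Vecₚ.lookup-map i not α) (cong not e))
    ... | there (here e) with () ← trans (sym e) (trans (Vecₚ.lookup-map b not α) (cong not eb))
    ... | there (there (here e)) with () ← trans (sym e) (trans (Vecₚ.lookup-map c not α) (cong not ec))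

  module _ (st : State n) where

    onesOnly : Assignment n
    onesOnly = Vec.tabulate (isOneᵇ ∘ st)

    weight-onesOnly : weight onesOnly ≡ ones st
    weight-onesOnly = trans (weight-sumF onesOnly)
      (sumF-cong (λ i → trans (cong count (Vecₚ.lookup∘tabulate (isOneᵇ ∘ st) i)) (count-isOneᵇ (st i))))

    -- Collects the literals of a violated clause that a compatible solution can still satisfy; all
    -- of these are positive. `exact` records whether any literal was dropped.
    record LiveVariables (C : Clause n) : Set where
      field
        vars  : List (Fin n)
        live  : All (Live ∘ st) vars
        hit   : ∀ {α} → Agree st α → SatisfiesClause α C → 1 ≤ trues α vars
        exact : C ≡ map pos vars ⊎ length vars < length C

    liveVariables : ∀ C → All (λ ℓ → eval onesOnly ℓ ≢ true) C → LiveVariables C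
    liveVariables [] [] = record { vars = [] ; live = [] ; hit = λ _ () ; exact = inj₁ refl }
    liveVariables (ℓ ∷ C) (f ∷ fs) = extend ℓ f (liveVariables C fs)
      where
      shorter : (rest : LiveVariables C) → length (LiveVariables.vars rest) < suc (length C)
      shorter rest with LiveVariables.exact rest
      ... | inj₁ eq = s≤s (≤-reflexive (sym (trans (cong length eq) (length-map pos (LiveVariables.vars rest)))))
      ... | inj₂ lt   = m<n⇒m<1+n lt
      skip : ∀ ℓ → (∀ {α} → Agree st α → eval α ℓ ≢ true) → LiveVariables C → LiveVariables (ℓ ∷ C)
      skip ℓ never rest = record
        { vars = vars ; live = live ; exact = inj₂ (shorter rest)
        ; hit  = λ { {α} agree (here e) → contradiction e (never {α} agree) ; {α} agree (there s) → hit {α} agree s } }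
        where open LiveVariables rest
      keep : ∀ i → Live (st i) → LiveVariables C → LiveVariables (pos i ∷ C)
      keep i li rest = record
        { vars = i ∷ vars ; live = li ∷ live ; exact = [ (λ eq → inj₁ (cong (pos i ∷_) eq)) , (λ lt → inj₂ (s≤s lt)) ]′ exact
        ; hit  = λ { {α} agree (here e) → subst (λ b → 1 ≤ count b + trues α vars) (sym e) (s≤s z≤n)
                   ; {α} agree (there s) → ≤-trans (hit {α} agree s) (m≤n+m _ (count (lookup α i))) } }
        where open LiveVariables rest
      extend : ∀ ℓ → eval onesOnly ℓ ≢ true → LiveVariables C → LiveVariables (ℓ ∷ C)
      extend (pos i) f rest = by-status (st i) refl
        where
        by-status : ∀ s → st i ≡ s → LiveVariables (pos i ∷ C)
        by-status one  eq = contradiction (trans (Vecₚ.lookup∘tabulate (isOneᵇ ∘ st) i) (cong isOneᵇ eq)) f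
        by-status dead eq = skip (pos i) (λ {α} agree e → agree i (cong₂ weight₁ eq e)) rest
        by-status half       eq = keep i (subst Live (sym eq) ((λ ()) , (λ ()))) rest
        by-status full       eq = keep i (subst Live (sym eq) ((λ ()) , (λ ()))) rest
        by-status fresh      eq = keep i (subst Live (sym eq) ((λ ()) , (λ ()))) rest
        by-status (paired _) eq = keep i (subst Live (sym eq) ((λ ()) , (λ ()))) rest
      -- A violated negative literal belongs to a variable of status `one`, which is true in every
      -- compatible solution too.
      extend (neg i) f rest = skip (neg i) (λ {α} → never {α}) rest
        where
        is-one : st i ≡ one
        is-one with isOneᵇ (st i) in eq
        ... | true  = isOneᵇ⁻ (st i) eq
        ... | false = contradiction (cong not (trans (Vecₚ.lookup∘tabulate (isOneᵇ ∘ st) i) eq)) f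
        never : ∀ {α} → Agree st α → not (lookup α i) ≢ true
        never {α} agree e with lookup α i in eq
        ... | false = agree i (cong₂ weight₁ is-one eq)

    falsified : ones st < m → Falsified sols st
    falsified lt = found (find (¬All⇒Any¬ (λ C → any? (λ ℓ → eval onesOnly ℓ ≟ᵇ true) C) F
        (no-light onesOnly (subst₂ (λ a b → 2 * a < b) (sym weight-onesOnly) even (*-monoʳ-< 2 lt)))))
      where
      -- A clause may contain the same literal several times.
      dedupe : ∀ α a {cs} → 1 ≤ count (lookup α a) + (count (lookup α a) + trues α cs) → 1 ≤ count (lookup α a) + trues α cs
      dedupe α a le with lookup α a
      ... | true  = s≤s z≤n
      ... | false = le
      at-most-two : ∀ {a b} → Live (st a) → Live (st b) → Hits sols st (a ∷ b ∷ []) → Falsified sols st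
      at-most-two {a} {b} la lb hits with a ≟ᶠ b
      ... | yes refl = unit la (λ {α} α∈ agree → dedupe α a {[]} (hits α∈ agree))
      ... | no a≢b = two a≢b la lb hits
      found : (∃ λ C → C ∈ F × ¬ SatisfiesClause onesOnly C) → Falsified sols st
      found (C , C∈ , unsat) = classify (liveVariables C (¬Any⇒All¬ C unsat))
        where
        classify : LiveVariables C → Falsified sols st
        classify record { vars = vars ; live = live ; hit = hit ; exact = exact } =
          by-length vars live (λ {α} α∈ agree → hit {α} agree (All.lookup (satisfies α∈) C∈)) exact
          where
          by-length : ∀ vars → All (Live ∘ st) vars → Hits sols st vars → C ≡ map pos vars ⊎ length vars < length C → Falsified sols st
          by-length [] _ hits _ = none hits
          by-length (a ∷ []) (la ∷ _) hits _ = unit la hits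
          by-length (a ∷ b ∷ []) (la ∷ lb ∷ _) hits _ = at-most-two la lb hits
          by-length (a ∷ b ∷ c ∷ []) (la ∷ lb ∷ lc ∷ _) hits ex with a ≟ᶠ b | a ≟ᶠ c | b ≟ᶠ c
          ... | yes refl | _ | _ = at-most-two la lc (λ {α} α∈ agree → dedupe α a {c ∷ []} (hits α∈ agree))
          ... | no _ | yes refl | _ = at-most-two la lb (λ {α} α∈ agree → dedupe α a {b ∷ []}
                  (≤-trans (hits α∈ agree) (≤-reflexive (rotate (count (lookup α a)) (count (lookup α b))))))
            where
            rotate : ∀ a b → a + (b + (a + 0)) ≡ a + (a + (b + 0))
            rotate = solve-∀
          ... | no _ | no _ | yes refl = at-most-two la lb (λ {α} α∈ agree → dedupe′ α (hits α∈ agree))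
            where
            dedupe′ : ∀ α → 1 ≤ trues α (a ∷ b ∷ b ∷ []) → 1 ≤ trues α (a ∷ b ∷ [])
            dedupe′ α le with lookup α a
            ... | true  = s≤s z≤n
            ... | false = dedupe α b {[]} le
          ... | no a≢b | no a≢c | no b≢c with ex
          ...   | inj₁ refl = three a≢b a≢c b≢c la lb lc (positive-nae C∈) hits
          ...   | inj₂ lt = contradiction (All.lookup F-3 C∈) (<⇒≱ lt)
          by-length (a ∷ b ∷ c ∷ d ∷ vars) _ _ ex with All.lookup F-3 C∈ | ex
          ... | s≤s (s≤s (s≤s ())) | inj₁ refl
          ... | le | inj₂ lt = contradiction (≤-trans (<⇒≤ lt) le) λ { (s≤s (s≤s (s≤s ()))) }

^-distrib-* : ∀ n a b → (a * b) ^ n ≡ a ^ n * b ^ n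
^-distrib-* zero    a b = refl
^-distrib-* (suc n) a b = trans (cong (a * b *_) (^-distrib-* n a b)) ([m*n]*[o*p]≡[m*o]*[n*p] a b (a ^ n) (b ^ n))

split-pieces : ∀ {n} (ps : List (Piece n)) → ∃ λ ts → ∃ λ cs → ps ↭ ts ++ cs ×
  (∀ {s} → s ∈ ts → ∃ λ a → ∃ λ b → ∃ λ c → s ≡ triangle a b c) × (∀ {a b c} → triangle a b c ∉ cs)
split-pieces [] = [] , [] , ↭-refl , (λ ()) , (λ ())
split-pieces (s ∷ ps) with split-pieces ps
split-pieces (triangle a b c ∷ ps) | ts , cs , perm , ts-ok , cs-ok =
  triangle a b c ∷ ts , cs , prep _ perm , (λ { (here refl) → a , b , c , refl ; (there m) → ts-ok m }) , cs-ok
split-pieces (cherry u x y v w ∷ ps) | ts , cs , perm , ts-ok , cs-ok =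
  ts , cherry u x y v w ∷ cs , ↭-trans (prep _ perm) (↭-sym (shift _ ts cs)) , ts-ok , (λ { (there m) → cs-ok m })

-- Saturated states and the bound for the state with all variables fresh

module Bound {n} (F : CNF n) (F-3 : Is3CNF F) (no-light : NoLightSolution F) (closed : NegationClosed F)
  (m : ℕ) (even : 2 * m ≡ n) (x y : ℕ) (x>0 : 0 < x) (y>0 : 0 < y) (near : Near√6 x y) where

  open Balanced F F-3 no-light closed m even

  K : ℕ
  K = (250 * x * (1000 * y)) ^ m

  open Weighted sols x y K x>0 y>0

  notOne : Status n → ℕ
  notOne s = 1 ∸ isOne s

  residual : Status n → ℕ
  residual one = 1
  residual s   = weight₁ s false

  -- The weight restricted to the assignment that is true exactly at the ones; `residual` is its
  -- weight there.
  forced : Status n → Bool → ℕ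
  forced one true  = 1
  forced one false = 0
  forced s   true  = 0
  forced s   false = weight₁ s false

  forced-sum : ∀ s → forced s false + forced s true ≡ residual s
  forced-sum one        = refl
  forced-sum dead       = refl
  forced-sum half       = refl
  forced-sum full       = refl
  forced-sum fresh      = refl
  forced-sum (paired _) = refl

  -- The end of the branching bounds the values from below: each must cover the weight of the only
  -- assignment left. It is exact for `one`, `dead` and `half`.
  residual-value : ∀ s → residual s * ((250 * x) ^ isOne s * (1000 * y) ^ notOne s) ≤ value s
  residual-value s = ≤-trans (≤-reflexive (cong (residual s *_) (simplify s))) (dominated s)
    where
    cost : Status n → ℕ
    cost one = 250 * x
    cost _   = 1000 * y
    dead-cost : ∀ a b → a ^ 0 * b ^ 1 ≡ b
    dead-cost a b = trans (*-identityˡ (b ^ 1)) (*-identityʳ b)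
    simplify : ∀ s → (250 * x) ^ isOne s * (1000 * y) ^ notOne s ≡ cost s
    simplify one        = trans (*-identityʳ _) (*-identityʳ (250 * x))
    simplify dead       = dead-cost (250 * x) (1000 * y)
    simplify half       = dead-cost (250 * x) (1000 * y)
    simplify full       = dead-cost (250 * x) (1000 * y)
    simplify fresh      = dead-cost (250 * x) (1000 * y)
    simplify (paired _) = dead-cost (250 * x) (1000 * y)
    scale : ∀ a b c → c * a ≡ b → c * (a * y) ≡ b * y
    scale a b c eq = trans (sym (*-assoc c a y)) (cong (_* y) eq)
    dominated : ∀ s → residual s * cost s ≤ value s
    dominated one        = ≤-reflexive (*-identityˡ (250 * x))
    dominated dead       = ≤-reflexive (*-identityˡ (1000 * y))
    dominated half       = ≤-reflexive (scale 1000 2000 2 refl)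
    dominated full       = ≤-trans (≤-reflexive (*-identityˡ (1000 * y))) (*-monoˡ-≤ y (≤ᵇ⇒≤ 1000 1250 tt))
    dominated fresh      = begin
      1 * (1000 * y) ≡⟨ *-identityˡ (1000 * y) ⟩
      1000 * y ≡⟨ sym (trans (sym (*-assoc 500 2 y)) refl) ⟩
      500 * (2 * y) ≤⟨ *-monoʳ-≤ 500 (Near√6.2y≤x near) ⟩
      500 * x ∎
      where open ≤-Reasoning
    dominated (paired _) = ≤-trans (≤-reflexive (*-identityˡ (1000 * y))) (*-monoˡ-≤ y (≤ᵇ⇒≤ 1000 1199 tt))

  module _ (st : State n) where

    contains : ∀ {α} → Agree st α → ∀ i → isOne (st i) ≤ count (lookup α i)
    contains {α} agree i with st i | lookup α i | agree i
    ... | one      | true  | _ = ≤-refl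
    ... | one      | false | c = contradiction refl c
    ... | dead     | _ | _ = z≤n
    ... | half     | _ | _ = z≤n
    ... | full     | _ | _ = z≤n
    ... | fresh    | _ | _ = z≤n
    ... | paired _ | _ | _ = z≤n

    ones≤m : ∀ {α} → α ∈ sols → Agree st α → ones st ≤ m
    ones≤m {α} α∈ agree = subst (ones st ≤_) (trans (sym (weight-sumF α)) (balanced α∈)) (sumF-mono (contains {α} agree))

    -- A compatible solution is true at every `one` and has only m true variables, so it is true
    -- nowhere else.
    saturated-weight : m ≤ ones st → ∀ {α} → α ∈ sols → weightOf st α ≤ prod (λ i → forced (st i) (lookup α i))
    saturated-weight m≤ {α} α∈ with weightOf st α ≟ 0
    ... | yes z = ≤-trans (≤-reflexive z) z≤n
    ... | no nz = prod-mono pointwise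
      where
      agree : Agree st α
      agree = weightOf≢0⇒agree st α nz
      only-ones : ∀ i → ¬ (isOne (st i) < count (lookup α i))
      only-ones i lt = <⇒≱ (sumF-strict (contains {α} agree) i lt)
        (subst (_≤ ones st) (trans (sym (balanced α∈)) (weight-sumF α)) m≤)
      pointwise : ∀ i → weight₁ (st i) (lookup α i) ≤ forced (st i) (lookup α i)
      pointwise i with st i | lookup α i | only-ones i
      ... | one      | true  | _ = ≤-refl
      ... | one      | false | _ = ≤-refl
      ... | dead     | false | _ = ≤-refl
      ... | half     | false | _ = ≤-refl
      ... | full     | false | _ = ≤-refl
      ... | fresh    | false | _ = ≤-refl
      ... | paired _ | false | _ = ≤-refl
      ... | dead     | true  | c = contradiction (s≤s z≤n) c
      ... | half     | true  | c = contradiction (s≤s z≤n) c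
      ... | full     | true  | c = contradiction (s≤s z≤n) c
      ... | fresh    | true  | c = contradiction (s≤s z≤n) c
      ... | paired _ | true  | c = contradiction (s≤s z≤n) c

    -- Summing the restricted weights over all assignments factorises over the variables, which
    -- spares singling out the one assignment that contributes.
    total≤residual : m ≤ ones st → total st ≤ prod (λ i → residual (st i))
    total≤residual m≤ = begin
      sumBy sols (weightOf st) ≤⟨ sumBy-mono sols (saturated-weight m≤) ⟩
      sumBy sols (λ α → prod (λ i → forced (st i) (lookup α i))) ≤⟨ sumBy-filter (isBalancedSolution? F) (assignments n) _ ⟩
      sumBy (assignments n) (λ α → prod (λ i → forced (st i) (lookup α i))) ≡⟨ sum-assignments (forced ∘ st) ⟩
      prod (λ i → forced (st i) false + forced (st i) true) ≡⟨ prod-cong (forced-sum ∘ st) ⟩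
      prod (λ i → residual (st i)) ∎
      where open ≤-Reasoning

    -- With more than m ones no solution is compatible. With exactly m, the other m variables are
    -- charged the value of `dead`, which matches the two kinds of factors in `K`.
    saturated : m ≤ ones st → Bounded st
    saturated m≤ with m<1+n⇒m<n∨m≡n (s≤s m≤)
    ... | inj₁ m< = ≤-trans (≤-reflexive (cong (_* K) empty)) z≤n
      where
      empty : total st ≡ 0
      empty = trans (sumBy-cong sols (λ {α} α∈ → by-zero α α∈ (weightOf st α ≟ 0))) (sumBy-0 sols)
        where
        by-zero : ∀ α → α ∈ sols → Dec (weightOf st α ≡ 0) → weightOf st α ≡ 0
        by-zero α α∈ (yes z) = z
        by-zero α α∈ (no nz) = contradiction (ones≤m α∈ (weightOf≢0⇒agree st α nz)) (<⇒≱ m<)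
    ... | inj₂ m≡ = begin
      total st * K ≤⟨ *-monoˡ-≤ K (total≤residual m≤) ⟩
      prod (residual ∘ st) * K ≡⟨ cong (prod (residual ∘ st) *_) K-prod ⟩
      prod (residual ∘ st) * prod (λ i → (250 * x) ^ isOne (st i) * (1000 * y) ^ notOne (st i)) ≡⟨ sym (prod-* (residual ∘ st) _) ⟩
      prod (λ i → residual (st i) * ((250 * x) ^ isOne (st i) * (1000 * y) ^ notOne (st i))) ≤⟨ prod-mono (residual-value ∘ st) ⟩
      potential st ∎
      where
      open ≤-Reasoning
      together : ∀ (s : Status n) → isOne s + notOne s ≡ 1
      together one        = refl
      together dead       = refl
      together half       = refl
      together full       = refl
      together fresh      = refl
      together (paired _) = refl
      notOnes : sumF (notOne ∘ st) ≡ m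
      notOnes = +-cancelˡ-≡ m _ _ (trans (cong (_+ sumF (notOne ∘ st)) m≡) (trans (sym (sumF-+ (isOne ∘ st) (notOne ∘ st)))
        (trans (sumF-cong (together ∘ st)) (trans (sumF-const n) (trans (sym even) (cong (m +_) (+-identityʳ m)))))))
      K-prod : K ≡ prod (λ i → (250 * x) ^ isOne (st i) * (1000 * y) ^ notOne (st i))
      K-prod = sym (trans (prod-* (λ i → (250 * x) ^ isOne (st i)) (λ i → (1000 * y) ^ notOne (st i)))
        (trans (cong₂ _*_ (trans (prod-^ (250 * x) (isOne ∘ st)) (cong ((250 * x) ^_) (sym m≡)))
                          (trans (prod-^ (1000 * y) (notOne ∘ st)) (cong ((1000 * y) ^_) notOnes)))
               (sym (^-distrib-* m (250 * x) (1000 * y)))))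

  finished : ∀ st → PairsOK sols st → Clean sols st → Bounded st
  finished st = Finish.finish sols x y K x>0 y>0 near m falsified saturated m st (m≤n+m m (ones st))

  all-fresh : State n
  all-fresh _ = fresh

  bounded : Bounded all-fresh
  bounded = with-maximal (total all-fresh * K ≤? potential all-fresh) from-maximal
    where
    open Packings sols
    from-maximal : ∀ ps → Packing ps → Maximal ps → Bounded all-fresh
    from-maximal ps packing maximal with split-pieces ps
    ... | ts , cs , perm , ts-triangles , no-triangle =
      process-triangles (length ts + length cs) ts cs all-fresh ≤-refl no-triangle ts-triangles (Inv-↭ perm start)
      where
      open Optimal packing maximal
      open Packing packing
      open Process sols x y K x>0 y>0 near (250 * x) (250 * y) (1199 * y) refl refl refl finished ps
        sound sound outer-nae petal-nae
      start : Inv ps all-fresh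
      start = record
        { known    = id
        ; disjoint = unique
        ; intact   = λ _ → refl
        ; outer    = λ {i} _ → decide i (_∈?_ _≟ᶠ_ i (covered ps))
        ; resolved = inj₁
        ; pairs    = λ ()
        }
        where
        decide : ∀ i → Dec (i ∈ covered ps) → Out i ⊎ i ∈ covered ps
        decide i (yes i∈) = inj₂ i∈
        decide i (no i∉)  = inj₁ i∉

  solutions-bound : length sols * y ^ m ≤ x ^ m
  solutions-bound = *-cancelʳ-≤ _ _ (u ^ m) {{m^n≢0 u m {{u-nonzero}}}} (begin
    length sols * y ^ m * u ^ m ≡⟨ *-assoc (length sols) _ _ ⟩
    length sols * (y ^ m * u ^ m) ≡⟨ cong₂ _*_ (sym total-fresh) (sym (^-distrib-* m y u)) ⟩
    total all-fresh * (y * u) ^ m ≡⟨ cong (λ z → total all-fresh * z ^ m) (trans (K-base x y) refl) ⟩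
    total all-fresh * K ≤⟨ bounded ⟩
    potential all-fresh ≡⟨ potential-fresh ⟩
    (500 * x) ^ n ≡⟨ cong ((500 * x) ^_) (sym even) ⟩
    (500 * x) ^ (2 * m) ≡⟨ sym (^-*-assoc (500 * x) 2 m) ⟩
    ((500 * x) ^ 2) ^ m ≡⟨ cong (_^ m) (square x) ⟩
    (x * u) ^ m ≡⟨ ^-distrib-* m x u ⟩
    x ^ m * u ^ m ∎)
    where
    open ≤-Reasoning
    -- The common factor of both sides: the square of 500 x is x u, and the base of `K` is y u.
    u = 250 * x * 1000
    u-nonzero : NonZero u
    u-nonzero = >-nonZero (*-mono-< {0} {250 * x} {0} {1000} (*-mono-< {0} {250} {0} {x} z<s x>0) z<s)
    rearrange : ∀ a b x y → y * (a * x * b) ≡ a * x * (b * y)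
    rearrange = solve-∀
    K-base : ∀ x y → y * (250 * x * 1000) ≡ 250 * x * (1000 * y)
    K-base = rearrange 250 1000
    square-general : ∀ c a b x → c * c ≡ a * b → (c * x) * (c * x * 1) ≡ x * (a * x * b)
    square-general c a b x eq = trans (expand c x) (trans (cong (λ z → x * (z * x)) eq) (collect a b x))
      where
      expand : ∀ c x → (c * x) * (c * x * 1) ≡ x * (c * c * x)
      expand = solve-∀
      collect : ∀ a b x → x * (a * b * x) ≡ x * (a * x * b)
      collect = solve-∀
    square : ∀ x → (500 * x) ^ 2 ≡ x * (250 * x * 1000)
    square x = square-general 500 250 1000 x refl
    total-fresh : total all-fresh ≡ length sols
    total-fresh = trans (sumBy-cong sols (λ _ → prod-1 n)) (sumBy-1 sols)
      where
      prod-1 : ∀ n → prod {n} (λ _ → 1) ≡ 1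
      prod-1 zero    = refl
      prod-1 (suc n) = trans (*-identityˡ _) (prod-1 n)
    potential-fresh : potential all-fresh ≡ (500 * x) ^ n
    potential-fresh = trans (cong-prod n) refl
      where
      cong-prod : ∀ n → prod {n} (λ _ → 500 * x) ≡ (500 * x) ^ n
      cong-prod zero    = refl
      cong-prod (suc n) = cong (500 * x *_) (cong-prod n)

-- Approximating √6 by solutions of the Pell equation

record Pell (x y : ℕ) : Set where
  constructor pell
  field equation : x * x ≡ 6 * (y * y) + 1

-- Multiplication of x + y √6 by the fundamental solution 5 + 2 √6.
pell-step : ∀ {x y} → Pell x y → Pell (5 * x + 12 * y) (2 * x + 5 * y)
pell-step {x} {y} (pell eq) = pell (trans (left x y) (trans (cong (_+ (24 * (x * x) + 120 * (x * y) + 144 * (y * y))) eq) (right x y)))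
  where
  left : ∀ x y → (5 * x + 12 * y) * (5 * x + 12 * y) ≡ x * x + (24 * (x * x) + 120 * (x * y) + 144 * (y * y))
  left = solve-∀
  right : ∀ x y → 6 * (y * y) + 1 + (24 * (x * x) + 120 * (x * y) + 144 * (y * y)) ≡ 6 * ((2 * x + 5 * y) * (2 * x + 5 * y)) + 1
  right = solve-∀

pell-large : ∀ k → ∃ λ x → ∃ λ y → Pell x y × k ≤ y
pell-large zero    = 5 , 2 , pell refl , z≤n
pell-large (suc k) with pell-large k
... | x , y , s@(pell eq) , k≤y = 5 * x + 12 * y , 2 * x + 5 * y , pell-step s , grow x eq
  where
  grow : ∀ x → x * x ≡ 6 * (y * y) + 1 → suc k ≤ 2 * x + 5 * y
  grow zero eq with () ← trans eq (+-comm (6 * (y * y)) 1)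
  grow (suc x) _ = s≤s (≤-trans k≤y (≤-trans (m≤m+n y (4 * y)) (m≤n+m (5 * y) (x + suc (x + 0)))))

-- The square of q / p exceeds 6 by d / p², that of x / y only by 1 / y², which is smaller once y
-- reaches `k`.
pell-ratio : ∀ {x y} → Pell x y → ∀ p q d k → q * q ≡ p * p * 6 + d → p * p ≤ d * (k * k) → k ≤ y → p * x ≤ q * y
pell-ratio {x} {y} (pell eq) p q d k q² p² k≤y = square-cancel (begin
  p * x * (p * x) ≡⟨ [m*n]*[o*p]≡[m*o]*[n*p] p x p x ⟩
  p * p * (x * x) ≡⟨ cong (p * p *_) eq ⟩
  p * p * (6 * (y * y) + 1) ≡⟨ expand (p * p) (y * y) ⟩
  p * p * 6 * (y * y) + p * p ≤⟨ +-monoʳ-≤ (p * p * 6 * (y * y)) (≤-trans p² (*-monoʳ-≤ d (*-mono-≤ k≤y k≤y))) ⟩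
  p * p * 6 * (y * y) + d * (y * y) ≡⟨ sym (*-distribʳ-+ (y * y) (p * p * 6) d) ⟩
  (p * p * 6 + d) * (y * y) ≡⟨ cong (_* (y * y)) (sym q²) ⟩
  q * q * (y * y) ≡⟨ [m*n]*[o*p]≡[m*o]*[n*p] q q y y ⟩
  q * y * (q * y) ∎)
  where
  open ≤-Reasoning
  expand : ∀ a b → a * (6 * b + 1) ≡ a * 6 * b + a
  expand = solve-∀

pell-near√6 : ∀ {x y} → Pell x y → 23 ≤ y → Near√6 x y
pell-near√6 {x} {y} s@(pell eq) y≥ = record
  { 2y≤x     = square-cancel (≤-trans (≤-trans (≤-reflexive (double y)) (*-monoˡ-≤ (y * y) (≤ᵇ⇒≤ 4 6 tt))) below)
  -- 24499² = 6 · 10⁸ + 201001, and 23 is the least k with 10⁸ ≤ 201001 · k².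
  ; 10⁴x≤24499y = pell-ratio {x} {y} s 10000 24499 201001 23 refl (≤ᵇ⇒≤ 100000000 106329529 tt) y≥
  ; 6yy≤xx   = below
  }
  where
  below : 6 * (y * y) ≤ x * x
  below = ≤-trans (m≤m+n _ 1) (≤-reflexive (sym eq))
  double : ∀ y → 2 * y * (2 * y) ≡ 4 * (y * y)
  double = solve-∀

-- This is (6 + 1 / Y) ^ m ≤ 6 ^ m + 8 ^ m / Y. In the induction the new error, times Y, is 6 · 8 ^
-- m + 6 ^ m + 8 ^ m / Y, at most 8 · 8 ^ m; this is where the base 8 comes from.
power-growth : ∀ Y → 1 ≤ Y → ∀ m → Y * (6 * Y + 1) ^ m ≤ Y ^ m * (6 ^ m * Y + 8 ^ m)
power-growth Y Y>0 zero    = ≤-trans (≤-reflexive (*-identityʳ Y)) (≤-trans (m≤m+n Y 1) (≤-reflexive (base Y)))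
  where
  base : ∀ Y → Y + 1 ≡ 1 * (1 * Y + 1)
  base = solve-∀
power-growth Y Y>0 (suc m) = begin
  Y * ((6 * Y + 1) * (6 * Y + 1) ^ m) ≡⟨ left Y (6 * Y + 1) _ ⟩
  (6 * Y + 1) * (Y * (6 * Y + 1) ^ m) ≤⟨ *-monoʳ-≤ (6 * Y + 1) (power-growth Y Y>0 m) ⟩
  (6 * Y + 1) * (Y ^ m * (6 ^ m * Y + 8 ^ m)) ≡⟨ expand Y (Y ^ m) (6 ^ m) (8 ^ m) ⟩
  Y ^ m * (6 * 6 ^ m * (Y * Y) + 6 * 8 ^ m * Y + (6 ^ m * Y + 8 ^ m))
    ≤⟨ *-monoʳ-≤ (Y ^ m) (+-monoʳ-≤ (6 * 6 ^ m * (Y * Y) + 6 * 8 ^ m * Y) (+-mono-≤ (*-monoˡ-≤ Y (^-monoˡ-≤ m (≤ᵇ⇒≤ 6 8 tt)))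
         (≤-trans (≤-reflexive (sym (*-identityʳ (8 ^ m)))) (*-monoʳ-≤ (8 ^ m) Y>0)))) ⟩
  Y ^ m * (6 * 6 ^ m * (Y * Y) + 6 * 8 ^ m * Y + (8 ^ m * Y + 8 ^ m * Y)) ≡⟨ collect Y (Y ^ m) (6 ^ m) (8 ^ m) ⟩
  Y * Y ^ m * (6 * 6 ^ m * Y + 8 * 8 ^ m) ∎
  where
  open ≤-Reasoning
  left : ∀ a b c → a * (b * c) ≡ b * (a * c)
  left = solve-∀
  expand : ∀ Y p s e → (6 * Y + 1) * (p * (s * Y + e)) ≡ p * (6 * s * (Y * Y) + 6 * e * Y + (s * Y + e))
  expand = solve-∀
  collect : ∀ Y p s e → p * (6 * s * (Y * Y) + 6 * e * Y + (e * Y + e * Y)) ≡ Y * p * (6 * s * Y + 8 * e)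
  collect = solve-∀

-- Once y exceeds 8 ^ m, the Pell solution is so close to √6 that rounding the integer N * N down removes the error term.
pell-square-bound : ∀ {x y} N m → Pell x y → 8 ^ m < y → N * y ^ m ≤ x ^ m → N * N ≤ 6 ^ m
pell-square-bound {x} {y} N m (pell eq) large bound = ≮⇒≥ (λ lt → <⇒≱ 8^m<Y (+-cancelˡ-≤ (6 ^ m * Y) Y (8 ^ m) (begin
    6 ^ m * Y + Y ≡⟨ +-comm (6 ^ m * Y) Y ⟩
    suc (6 ^ m) * Y ≤⟨ *-monoˡ-≤ Y lt ⟩
    N * N * Y ≤⟨ scaled ⟩
    6 ^ m * Y + 8 ^ m ∎)))
  where
  open ≤-Reasoning
  Y = y * y
  y>0 : 1 ≤ y
  y>0 = ≤-trans (s≤s z≤n) large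
  Y>0 : 1 ≤ Y
  Y>0 = *-mono-≤ y>0 y>0
  8^m<Y : 8 ^ m < Y
  8^m<Y = ≤-trans large (≤-trans (≤-reflexive (sym (*-identityʳ y))) (*-monoʳ-≤ y y>0))
  squared : N * N * Y ^ m ≤ (6 * Y + 1) ^ m
  squared = begin
    N * N * Y ^ m ≡⟨ cong (N * N *_) (^-distrib-* m y y) ⟩
    N * N * (y ^ m * y ^ m) ≡⟨ [m*n]*[o*p]≡[m*o]*[n*p] N N (y ^ m) (y ^ m) ⟩
    N * y ^ m * (N * y ^ m) ≤⟨ *-mono-≤ bound bound ⟩
    x ^ m * x ^ m ≡⟨ sym (^-distrib-* m x x) ⟩
    (x * x) ^ m ≡⟨ cong (_^ m) eq ⟩
    (6 * Y + 1) ^ m ∎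
  scaled : N * N * Y ≤ 6 ^ m * Y + 8 ^ m
  scaled = *-cancelˡ-≤ (Y ^ m) {{m^n≢0 Y m {{>-nonZero Y>0}}}} (begin
    Y ^ m * (N * N * Y) ≡⟨ regroup (Y ^ m) (N * N) Y ⟩
    Y * (N * N * Y ^ m) ≤⟨ *-monoʳ-≤ Y squared ⟩
    Y * (6 * Y + 1) ^ m ≤⟨ power-growth Y Y>0 m ⟩
    Y ^ m * (6 ^ m * Y + 8 ^ m) ∎)
    where
    regroup : ∀ a b c → a * (b * c) ≡ c * (b * a)
    regroup = solve-∀

square-bound : ∀ N m → (∀ {x y} → Pell x y → 23 ≤ y → N * y ^ m ≤ x ^ m) → N * N ≤ 6 ^ m
square-bound N m bound =
  let x , y , s , y≥ = pell-large (23 + suc (8 ^ m))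
  in  pell-square-bound N m s (≤-trans (m≤n+m (suc (8 ^ m)) 23) y≥) (bound s (≤-trans (m≤m+n 23 (suc (8 ^ m))) y≥))

mainTheorem3 : ∀ (n : ℕ) (F : CNF n) → Is3CNF F → NoLightSolution F → NegationClosed F → #balancedSolutions F ^ 4 ≤ 6 ^ n
mainTheorem3 n F F-3 no-light closed = by-solutions (filter (isBalancedSolution? F) (assignments n)) refl
  where
  N = #balancedSolutions F
  -- A balanced solution is what shows that n is even and supplies m; without one the count is 0.
  by-solutions : ∀ L → filter (isBalancedSolution? F) (assignments n) ≡ L → N ^ 4 ≤ 6 ^ n
  by-solutions [] eq = ≤-trans (≤-reflexive (cong (λ L → length L ^ 4) eq)) z≤n
  by-solutions (α ∷ _) eq = begin
    N ^ 4 ≡⟨ fourth N ⟩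
    N * N * (N * N) ≤⟨ *-mono-≤ small small ⟩
    6 ^ m * 6 ^ m ≡⟨ sym (^-distribˡ-+-* 6 m m) ⟩
    6 ^ (m + m) ≡⟨ cong (6 ^_) (trans (cong (m +_) (sym (+-identityʳ m))) even) ⟩
    6 ^ n ∎
    where
    open ≤-Reasoning
    m = weight α
    even : 2 * m ≡ n
    even = proj₂ (proj₂ (∈-filter⁻ (isBalancedSolution? F) {xs = assignments n} (subst (α ∈_) (sym eq) (here refl))))
    fourth : ∀ N → N * (N * (N * (N * 1))) ≡ N * N * (N * N)
    fourth = solve-∀
    small : N * N ≤ 6 ^ m
    small = square-bound N m (λ {x} {y} s y≥ → Bound.solutions-bound F F-3 no-light closed m even x y
      (≤-trans (≤-trans (s≤s z≤n) y≥) (≤-trans (m≤m+n y _) (Near√6.2y≤x (pell-near√6 s y≥)))) (≤-trans (s≤s z≤n) y≥) (pell-near√6 s y≥))
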